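{- Let $r\ge1$ and $a,b\in\{0,1\}$. Then $$H_r(a,b)=\sum_{\rho\in K_{2r+1}}x^{s(\rho)}\sum_{\substack{r_1+\dots+r_{f(\rho)}=r-c(\rho)\\ r_j\ge0}}L^\rho_{r_1,\ldots,r_{f(\rho)}}(a,b).$$
   Context: Permutations are words. An occurrence of $132$ in $\pi=\pi_1\cdots\pi_n$ is a triple $i<j<k$ with $\pi_i<\pi_k<\pi_j$, and $132(\pi)$ is the number of occurrences. $\operatorname{sign}(\pi)=(-1)^{\#\text{inversions}}$, and $\pi$ is even or odd according as its sign is $1$ or $-1$; the empty permutation is even. Let $e^r(n)$ and $o^r(n)$ be the numbers of even and of odd $\pi\in\mathfrak S_n$ with $132(\pi)=r$. Put $E_r(x)=\sum_{n\ge0}e^r(n)x^n$ and $O_r(x)=\sum_{n\ge0}o^r(n)x^n$. For $a,b\in\{0,1\}$ let $H_r(a,0)=\tfrac12(E_r(x)+(-1)^aE_r(-x))$ and $H_r(a,1)=\tfrac12(O_r(x)+(-1)^aO_r(-x))$. Kernel: form the bipartite graph whose vertices are the entries of $\pi$ and the occurrences of $132$ in $\pi$, an entry being joined to each occurrence containing it. The kernel of $\pi\in\mathfrak S_n$ is the subsequence of entries lying in the connected component containing the entry $n$. Its order-isomorphic permutation $\rho\in\mathfrak S_s$ is the kernel shape, with size $s(\rho)=s$ and capacity $c(\rho)=132(\rho)$. A kernel permutation is one that is the kernel shape of some permutation. $K_t$ is the set of kernel shapes of permutations in $\mathfrak S_t$. Cells: for a kernel permutation $\rho\in\mathfrak S_s$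 and $1\le m\le s$, $1\le l\le s+1$, the cell $C_{ml}$ is the region of positions strictly between the $(l-1)$-st and $l$-th kernel entries (before the first if $l=1$, after the last if $l=s+1$) and values strictly between the $(m-1)$-st and $m$-th smallest kernel entries (below the smallest if $m=1$). $C_{ml}$ is infeasible if an element inserted into $\rho$ at a position between $\rho(l-1)$ and $\rho(l)$, with value between $m-1$ and $m$, would form a $132$ with two entries of $\rho$; otherwise it is feasible. Every non-kernel entry of a permutation with kernel shape $\rho$ lies in a feasible cell. Ordering distinct feasible cells by $C_{ml}\prec C_{m'l'}$ iff $m\ge m'$ and $l\le l'$ gives a linear order $C^1\prec\dots\prec C^{f(\rho)}$. The $k$-th kernel entry lies below $C_{ml}$ if $\rho(k)<m$ and above otherwise; it lies left of $C_{ml}$ if $k<l$ and right otherwise. $l_j(\rho)$ is the number of $k$ such that the $k$-th kernel entry is above-left or below-right of $C^j$. For $\mathbf v\in\{0,1\}^{f(\rho)}$ write $|\mathbf v|=\sum v_i$. Let $X^\rho_\epsilon=\{\mathbf v: (-1)^{|\mathbf v|+s(\rho)}=\epsilon\}$ and $Y^\rho_\epsilon=\{\mathbf v:(-1)^{|\mathbf v|}=\epsilon\}$ for $\epsilon=\pm1$. Let $z_\rho(\mathbf v)=(-1)^{\sum_{i<j}v_iv_j+\sum_j l_j(\rho)v_j}\operatorname{sign}(\rho)$. Finally $$L^\rho_{r_1,\dots,r_{f(\rho)}}(a,b)=\sum_{\mathbf v\in X^\rho_{(-1)^a}}\ \sum_{\mathbf u\in Y^\rho_{(-1)^bz_\rho(\mathbf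 v)}}\ \prod_{j=1}^{f(\rho)}H_{r_j}(v_j,u_j).$$ -}

module Defs where

open import Data.Bool using (Bool; true; false; if_then_else_; _∧_; _∨_; not; _xor_)
open import Data.Nat as ℕ using (ℕ; zero; suc; _∸_; _<ᵇ_; _≡ᵇ_; _≤ᵇ_)
open import Data.Nat.Properties using (_≟_)
open import Data.Integer as ℤ using (ℤ)
open import Data.Integer.DivMod using (_/_)
open import Data.List using (List; []; _∷_; [_]; _++_; map; concatMap; filterᵇ; length;
  upTo; foldr; take; drop; reverse; deduplicate; zipWith)
open import Data.Bool.ListAction using (any)
open import Data.List.Properties using (≡-dec)
open import Data.Product using (_×_; _,_)

-- Words / permutations.  A permutation of [n] is represented as the list
-- π₁ ⋯ πₙ of its values, written 0-based (values 0,…,n-1).  Positions are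
-- 0-based too.  Only relative order matters for everything below.

-- entry at position i (0 if out of range; never used out of range)
at : List ℕ → ℕ → ℕ
at []       _       = 0
at (x ∷ _)  zero    = x
at (_ ∷ xs) (suc i) = at xs i

range : ℕ → ℕ → List ℕ
range a b = map (a ℕ.+_) (upTo (b ∸ a))

countᵇ : {A : Set} → (A → Bool) → List A → ℕ
countᵇ p xs = length (filterᵇ p xs)

memb : ℕ → List ℕ → Bool
memb x xs = any (x ≡ᵇ_) xs

insertions : ℕ → List ℕ → List (List ℕ)
insertions x []       = [ x ∷ [] ]
insertions x (y ∷ ys) = (x ∷ y ∷ ys) ∷ map (y ∷_) (insertions x ys)

perms : ℕ → List (List ℕ)
perms zero    = [ [] ]
perms (suc n) = concatMap (insertions n) (perms n)

triples : ℕ → List (ℕ × ℕ × ℕ)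
triples n = concatMap (λ i → concatMap (λ j → map (λ k → (i , j , k)) (range (suc j) n))
                                       (range (suc i) n)) (upTo n)

occ132 : List ℕ → List (ℕ × ℕ × ℕ)
occ132 w = filterᵇ (λ { (i , j , k) → (at w i <ᵇ at w k) ∧ (at w k <ᵇ at w j) })
                   (triples (length w))

c132 : List ℕ → ℕ
c132 w = length (occ132 w)

inv : List ℕ → ℕ
inv w = countᵇ (λ { (i , j) → at w j <ᵇ at w i })
               (concatMap (λ i → map (λ j → (i , j)) (range (suc i) (length w))) (upTo (length w)))

odd : ℕ → Bool
odd zero    = false
odd (suc n) = not (odd n)

isEven : List ℕ → Bool
isEven w = not (odd (inv w))

-- Formal power series in x with integer coefficients: n ↦ [xⁿ].

Series : Set
Series = ℕ → ℤ

_⊕_ : Series → Series → Series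
(f ⊕ g) n = f n ℤ.+ g n

0S : Series
0S _ = ℤ.0ℤ

1S : Series
1S zero    = ℤ.1ℤ
1S (suc _) = ℤ.0ℤ

_⊛_ : Series → Series → Series
(f ⊛ g) n = foldr ℤ._+_ ℤ.0ℤ (map (λ i → f i ℤ.* g (n ∸ i)) (upTo (suc n)))

sumS : List Series → Series
sumS = foldr _⊕_ 0S

prodS : List Series → Series
prodS = foldr _⊛_ 1S

shift : ℕ → Series → Series
shift s f n = if n <ᵇ s then ℤ.0ℤ else f (n ∸ s)

sgn : ℕ → ℤ
sgn k = if odd k then ℤ.-1ℤ else ℤ.1ℤ

negX : Series → Series
negX f n = sgn n ℤ.* f n

scale : ℤ → Series → Series
scale c f n = c ℤ.* f n

-- coefficientwise halving (exact whenever used below)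
half : Series → Series
half f n = f n / ℤ.+ 2

bit : Bool → ℕ
bit false = 0
bit true  = 1

e : ℕ → ℕ → ℕ
e r n = countᵇ (λ π → isEven π ∧ (c132 π ≡ᵇ r)) (perms n)

o : ℕ → ℕ → ℕ
o r n = countᵇ (λ π → not (isEven π) ∧ (c132 π ≡ᵇ r)) (perms n)

E O : ℕ → Series
E r n = ℤ.+ (e r n)
O r n = ℤ.+ (o r n)

H : ℕ → Bool → Bool → Series
H r a false = half (E r ⊕ scale (sgn (bit a)) (negX (E r)))
H r a true  = half (O r ⊕ scale (sgn (bit a)) (negX (O r)))

posMax : List ℕ → ℕ
posMax w = go 0 w
  where
  go : ℕ → List ℕ → ℕ
  go i []       = 0
  go i (x ∷ xs) = if x ≡ᵇ (length w ∸ 1) then i else go (suc i) xs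

-- one step of growing a set S of positions in the bipartite entry/occurrence
-- graph: add all entries of every occurrence that meets S
growStep : List (ℕ × ℕ × ℕ) → List ℕ → List ℕ
growStep os S = S ++ concatMap (λ { (i , j , k) →
  if memb i S ∨ memb j S ∨ memb k S then i ∷ j ∷ k ∷ [] else [] }) os

iter : ℕ → (List ℕ → List ℕ) → List ℕ → List ℕ
iter zero    f S = S
iter (suc n) f S = iter n f (f S)

-- positions in the connected component of the entry n
-- (n growth steps suffice: the component has at most n entries)
kernelPositions : List ℕ → List ℕ
kernelPositions w = iter (length w) (growStep (occ132 w)) [ posMax w ]

std : List ℕ → List ℕ
std xs = map (λ x → countᵇ (_<ᵇ x) xs) xs

kernel : List ℕ → List ℕ
kernel w = map (at w) (filterᵇ (λ p → memb p (kernelPositions w)) (upTo (length w)))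

kernelShape : List ℕ → List ℕ
kernelShape w = std (kernel w)

K : ℕ → List (List ℕ)
K t = deduplicate (≡-dec _≟_) (map kernelShape (perms t))

sz cap : List ℕ → ℕ
sz ρ = length ρ
cap ρ = c132 ρ

-- Cells.  A cell is a pair (m , l), 1 ≤ m ≤ s, 1 ≤ l ≤ s+1, as in the paper.
-- With ρ(k) the 1-based value of the k-th kernel entry: ρ(k) = at ρ (k-1) + 1.

val : List ℕ → ℕ → ℕ
val ρ k = suc (at ρ (k ∸ 1))

-- ρ with an extra element of value m - ½ inserted between the (l-1)-st and
-- l-th entries (values doubled: ρ(k) ↦ 2ρ(k), new value 2m-1); the new
-- element sits at 0-based position l-1.
insertCell : List ℕ → ℕ → ℕ → List ℕ
insertCell ρ m l = take (l ∸ 1) ρ′ ++ ((2 ℕ.* m ∸ 1) ∷ drop (l ∸ 1) ρ′)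
  where ρ′ = map (λ v → 2 ℕ.* suc v) ρ

infeasible : List ℕ → ℕ → ℕ → Bool
infeasible ρ m l = any (λ { (i , j , k) → (i ≡ᵇ p) ∨ (j ≡ᵇ p) ∨ (k ≡ᵇ p) })
                       (occ132 (insertCell ρ m l))
  where p = l ∸ 1

-- feasible cells listed in the order C¹ ≺ C² ≺ ⋯ : m decreasing, then l increasing
feasibleCells : List ℕ → List (ℕ × ℕ)
feasibleCells ρ = filterᵇ (λ { (m , l) → not (infeasible ρ m l) })
  (concatMap (λ m → map (m ,_) (range 1 (suc (suc (sz ρ))))) (reverse (range 1 (suc (sz ρ)))))

f : List ℕ → ℕ
f ρ = length (feasibleCells ρ)

-- l_j(ρ) for the cell C^j = (m , l): number of k with the k-th kernel entry
-- above-left (ρ(k) ≥ m, k < l) or below-right (ρ(k) < m, k ≥ l) of the cell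
lcell : List ℕ → ℕ × ℕ → ℕ
lcell ρ (m , l) = countᵇ (λ k → (((m ≤ᵇ val ρ k) ∧ (k <ᵇ l))) ∨ ((val ρ k <ᵇ m) ∧ (l ≤ᵇ k)))
                          (range 1 (suc (sz ρ)))

bools : ℕ → List (List Bool)
bools zero    = [ [] ]
bools (suc n) = concatMap (λ v → (false ∷ v) ∷ (true ∷ v) ∷ []) (bools n)

∣_∣ : List Bool → ℕ
∣ v ∣ = countᵇ (λ b → b) v

pairSum : List Bool → ℕ
pairSum []       = 0
pairSum (x ∷ xs) = (if x then ∣ xs ∣ else 0) ℕ.+ pairSum xs

lSum : List ℕ → List Bool → ℕ
lSum ρ v = foldr ℕ._+_ 0 (zipWith (λ c b → if b then lcell ρ c else 0) (feasibleCells ρ) v)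

-- z_ρ(v) = (-1)^{zExp ρ v}  (sign ρ = (-1)^{inv ρ})
zExp : List ℕ → List Bool → ℕ
zExp ρ v = pairSum v ℕ.+ lSum ρ v ℕ.+ inv ρ

-- v ∈ X^ρ_{(-1)^a}  ⇔  (-1)^{|v|+s(ρ)} = (-1)^a
inX : List ℕ → Bool → List Bool → Bool
inX ρ a v = not (odd (∣ v ∣ ℕ.+ sz ρ) xor a)

-- u ∈ Y^ρ_{(-1)^b z_ρ(v)}  ⇔  (-1)^{|u|} = (-1)^{b + zExp ρ v}
inY : List ℕ → Bool → List Bool → List Bool → Bool
inY ρ b v u = not (odd ∣ u ∣ xor odd (bit b ℕ.+ zExp ρ v))

zipWith3 : {A B C D : Set} → (A → B → C → D) → List A → List B → List C → List D
zipWith3 g (x ∷ xs) (y ∷ ys) (z ∷ zs) = g x y z ∷ zipWith3 g xs ys zs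
zipWith3 g _ _ _ = []

L : List ℕ → List ℕ → Bool → Bool → Series
L ρ rs a b = sumS (concatMap (λ v → map (λ u → prodS (zipWith3 H rs v u))
                                         (filterᵇ (inY ρ b v) (bools (f ρ))))
                             (filterᵇ (inX ρ a) (bools (f ρ))))

comps : ℕ → ℕ → List (List ℕ)
comps N zero    = if N ≡ᵇ 0 then [ [] ] else []
comps N (suc k) = concatMap (λ r₁ → map (r₁ ∷_) (comps (N ∸ r₁) k)) (upTo (suc N))

-- right-hand side; shapes with c(ρ) > r contribute the empty sum
RHS : ℕ → Bool → Bool → Series
RHS r a b = sumS (map (λ ρ → if cap ρ ≤ᵇ r
                               then shift (sz ρ) (sumS (map (λ rs → L ρ rs a b) (comps (r ∸ cap ρ) (f ρ))))
                               else 0S)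
                      (K (2 ℕ.* r ℕ.+ 1)))

{-# OPTIONS --safe #-}
-- Let ρ be the kernel shape of π.  An entry outside the kernel forms no occurrence
-- with two kernel entries.  Since the kernel is connected and contains the maximum,
-- this forces that no kernel entry lies to the lower left of the entry and that the
-- kernel entries to its upper right increase.  Hence the feasible cells form a chain
-- from the upper left to the lower right, entries in different cells form
-- inversions, and every occurrence lies in the kernel or in a single cell.  So π
-- arises from ρ by inserting one block α_j after the other into the cells, where
--   132(π) = c(ρ) + Σ 132(α_j),
--   inv(π) = inv(ρ) + Σ inv(α_j) + Σ_{i<j} |α_i||α_j| + Σ l_j |α_j|,
-- and the kernel shape stays ρ under arbitrary insertions, so this is a bijection.
-- Finally s(ρ) ≤ 2c(ρ) + 1, so a shape with c(ρ) ≤ r occurs already in S_{2r+1}.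
module Submission where

open import Defs
open import Data.Bool using (Bool; true; false; if_then_else_; _∧_; _∨_; not; _xor_; T)
open import Data.Bool.ListAction using (any)
open import Data.Bool.Properties using (∧-zeroʳ; ∧-identityʳ; ∨-identityʳ; ∨-comm; ∧-idem)
import Data.Bool.Solver as BoolSolver
open import Data.Empty using (⊥; ⊥-elim)
open import Data.Integer as ℤ using (ℤ; 0ℤ; 1ℤ) renaming (_+_ to _+ᶻ_; _*_ to _*ᶻ_)
open import Data.Integer.DivMod using (_/_)
import Data.Integer.Properties as ℤP
import Data.Integer.Solver as IntegerSolver
open import Data.List using (List; []; _∷_; _++_; map; concatMap; filterᵇ; length; upTo; foldr; take; drop; reverse; zipWith; applyUpTo)
open import Data.List.Membership.Propositional using (_∈_; _∉_; find; lose)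
open import Data.List.Membership.Propositional.Properties
open import Data.List.Membership.Propositional.Properties.WithK using (unique∧set⇒bag)
open import Data.List.Properties using (map-++; map-∘; map-cong; length-map; length-++; take++drop≡id; filter-++; ∷-injectiveˡ; ∷-injectiveʳ; ≡-dec; length-upTo; map-id; length-take; map-injective; unfold-reverse; take-map; drop-map)
open import Data.List.Relation.Binary.BagAndSetEquality using (∼bag⇒↭)
open import Data.List.Relation.Binary.Permutation.Propositional using (_↭_; ↭-sym; ↭-refl; ↭-trans; prep)
import Data.List.Relation.Binary.Permutation.Propositional.Properties as PP
open import Data.List.Relation.Unary.All as All using (All; []; _∷_)
import Data.List.Relation.Unary.All.Properties as AllP
open import Data.List.Relation.Unary.AllPairs as AP using (AllPairs; []; _∷_)
import Data.List.Relation.Unary.AllPairs.Properties as APP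
open import Data.List.Relation.Unary.Any using (here; there)
open import Data.List.Relation.Unary.Unique.Propositional using (Unique)
import Data.List.Relation.Unary.Unique.Propositional.Properties as UP
open import Data.Nat using (ℕ; zero; suc; _+_; _*_; _∸_; _≤_; _<_; z≤n; s≤s; _<ᵇ_; _≡ᵇ_; _≤ᵇ_; _<?_; _≤?_; _⊓_)
import Data.Nat.DivMod as ℕD
open import Data.Nat.ListAction using (sum)
open import Data.Nat.Properties
open import Data.Nat.Solver using (module +-*-Solver)
open import Data.Product using (∃; ∃₂; _×_; _,_; proj₁; proj₂)
open import Data.Sum using (_⊎_; inj₁; inj₂)
open import Function using (_∘_; id)
open import Function.Bundles using (mk⇔)
open import Relation.Binary.Definitions using (tri<; tri≈; tri>)
open import Relation.Binary.PropositionalEquality hiding ([_]) renaming (trans to infixr 4 _⊙_)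
open import Relation.Nullary using (yes; no)
open import Data.List.Relation.Unary.Unique.DecPropositional.Properties (≡-dec _≟_) using (deduplicate-!)
open +-*-Solver using (solve; _:=_; _:+_; _:*_; con)

-- The kernel is handled through closure and minimality: it contains every occurrence that it meets,
-- and it lies in every set with this property that contains the maximum. A claim about all kernel
-- entries is therefore proved by exhibiting a closed set. For the empty lower left quadrant of an
-- entry `y` this is the set of all `z` that exceed `y` or do not stand to its left; the maximum
-- belongs to it, which is where the choice of the component of `n` enters. The hypothesis `1 ≤ r`
-- excludes the empty permutation, which has no maximum and hence no kernel. On the side of the
-- series, `H` sees a block only through its number of occurrences and the parities of its length
-- and of its inversions. A tuple of blocks thus singles out one composition and one pair of vectors
-- `v`, `u`, and the nested sums of the right-hand side collapse to one indicator per tuple. The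
-- exponent `zExp` is the inversion formula modulo 2.

private
  module ZS = IntegerSolver.+-*-Solver
  module BZ = BoolSolver.xor-∧-Solver

-- Boolean tests, filters and counting in lists

≡ᵇ-true⁻ : ∀ {m n} → (m ≡ᵇ n) ≡ true → m ≡ n
≡ᵇ-true⁻ {m} {n} h = ≡ᵇ⇒≡ m n (subst T (sym h) _)

≡ᵇ-true : ∀ {m n} → m ≡ n → (m ≡ᵇ n) ≡ true
≡ᵇ-true {zero}  refl = refl
≡ᵇ-true {suc m} refl = ≡ᵇ-true {m} refl

true≢false : ∀ {ℓ} {A : Set ℓ} {b} → b ≡ true → b ≡ false → A
true≢false refl ()

≢true⇒false : ∀ {b} → b ≢ true → b ≡ false
≢true⇒false {true}  h = ⊥-elim (h refl)
≢true⇒false {false} h = refl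

≡ᵇ-false : ∀ {m n} → m ≢ n → (m ≡ᵇ n) ≡ false
≡ᵇ-false h = ≢true⇒false (h ∘ ≡ᵇ-true⁻)

<ᵇ-true⁻ : ∀ {m n} → (m <ᵇ n) ≡ true → m < n
<ᵇ-true⁻ {m} {n} h = <ᵇ⇒< m n (subst T (sym h) _)

<ᵇ-true : ∀ {m n} → m < n → (m <ᵇ n) ≡ true
<ᵇ-true {zero}  (s≤s h) = refl
<ᵇ-true {suc m} (s≤s h) = <ᵇ-true h

<ᵇ-false : ∀ {m n} → n ≤ m → (m <ᵇ n) ≡ false
<ᵇ-false h = ≢true⇒false (λ e → <⇒≱ (<ᵇ-true⁻ e) h)

<ᵇ-false⁻ : ∀ {m n} → (m <ᵇ n) ≡ false → n ≤ m
<ᵇ-false⁻ h = ≮⇒≥ (λ l → true≢false (<ᵇ-true l) h)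

≤ᵇ-true : ∀ {m n} → m ≤ n → (m ≤ᵇ n) ≡ true
≤ᵇ-true {zero}  h = refl
≤ᵇ-true {suc m} h = <ᵇ-true h

≤ᵇ-true⁻ : ∀ {m n} → (m ≤ᵇ n) ≡ true → m ≤ n
≤ᵇ-true⁻ {zero}  h = z≤n
≤ᵇ-true⁻ {suc m} h = <ᵇ-true⁻ h

iff⇒≡ : ∀ {b c} → (b ≡ true → c ≡ true) → (c ≡ true → b ≡ true) → b ≡ c
iff⇒≡ {true}  {c}     f g = sym (f refl)
iff⇒≡ {false} {true}  f g = g refl
iff⇒≡ {false} {false} f g = refl

bool-case : ∀ {ℓ} {A : Set ℓ} (b : Bool) → (b ≡ true → A) → (b ≡ false → A) → A
bool-case true  f g = f refl
bool-case false f g = g refl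

∧-true⁻ : ∀ {b c} → b ∧ c ≡ true → b ≡ true × c ≡ true
∧-true⁻ {true} h = refl , h

∧-true : ∀ {b c} → b ≡ true → c ≡ true → b ∧ c ≡ true
∧-true refl refl = refl

∨-true⁻ : ∀ {b c} → b ∨ c ≡ true → b ≡ true ⊎ c ≡ true
∨-true⁻ {true}  h = inj₁ refl
∨-true⁻ {false} h = inj₂ h

∨-trueˡ : ∀ {b c} → b ≡ true → b ∨ c ≡ true
∨-trueˡ refl = refl

∨-trueʳ : ∀ {b c} → c ≡ true → b ∨ c ≡ true
∨-trueʳ {true}  refl = refl
∨-trueʳ {false} refl = refl

not-true⁻ : ∀ {b} → not b ≡ true → b ≡ false
not-true⁻ {false} h = refl

filter-true : ∀ {A : Set} (p : A → Bool) {x xs} → p x ≡ true → filterᵇ p (x ∷ xs) ≡ x ∷ filterᵇ p xs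
filter-true p {x} h with p x
filter-true p refl | true = refl

filter-false : ∀ {A : Set} (p : A → Bool) {x xs} → p x ≡ false → filterᵇ p (x ∷ xs) ≡ filterᵇ p xs
filter-false p {x} h with p x
filter-false p refl | false = refl

filter-++ᵇ : ∀ {A : Set} (p : A → Bool) xs ys → filterᵇ p (xs ++ ys) ≡ filterᵇ p xs ++ filterᵇ p ys
filter-++ᵇ p = filter-++ _

count-++ : ∀ {A : Set} (p : A → Bool) xs ys → countᵇ p (xs ++ ys) ≡ countᵇ p xs + countᵇ p ys
count-++ p xs ys = cong length (filter-++ᵇ p xs ys) ⊙ length-++ (filterᵇ p xs)

filter-map : ∀ {A B : Set} (p : B → Bool) (g : A → B) xs → filterᵇ p (map g xs) ≡ map g (filterᵇ (p ∘ g) xs)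
filter-map p g [] = refl
filter-map p g (x ∷ xs) with p (g x)
... | true  = cong (g x ∷_) (filter-map p g xs)
... | false = filter-map p g xs

count-map : ∀ {A B : Set} (p : B → Bool) (g : A → B) xs → countᵇ p (map g xs) ≡ countᵇ (p ∘ g) xs
count-map p g xs = cong length (filter-map p g xs) ⊙ length-map g (filterᵇ (p ∘ g) xs)

filter-cong : ∀ {A : Set} {p q : A → Bool} xs → (∀ {x} → x ∈ xs → p x ≡ q x) → filterᵇ p xs ≡ filterᵇ q xs
filter-cong [] h = refl
filter-cong {p = p} {q} (x ∷ xs) h with p x | q x | h (here refl)
... | true  | .true  | refl = cong (x ∷_) (filter-cong xs (h ∘ there))
... | false | .false | refl = filter-cong xs (h ∘ there)

count-cong : ∀ {A : Set} {p q : A → Bool} xs → (∀ {x} → x ∈ xs → p x ≡ q x) → countᵇ p xs ≡ countᵇ q xs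
count-cong xs h = cong length (filter-cong xs h)

∈-filterᵇ⁺ : ∀ {A : Set} {p : A → Bool} {x xs} → x ∈ xs → p x ≡ true → x ∈ filterᵇ p xs
∈-filterᵇ⁺ m h = ∈-filter⁺ _ m (subst T (sym h) _)

T-true : ∀ {b} → T b → b ≡ true
T-true {true} _ = refl

∈-filterᵇ⁻ : ∀ {A : Set} (p : A → Bool) {x} xs → x ∈ filterᵇ p xs → x ∈ xs × p x ≡ true
∈-filterᵇ⁻ p xs m with ∈-filter⁻ _ {xs = xs} m
... | a , b = a , T-true b

filter-all : ∀ {A : Set} (p : A → Bool) xs → (∀ {x} → x ∈ xs → p x ≡ true) → filterᵇ p xs ≡ xs
filter-all p [] h = refl
filter-all p (x ∷ xs) h = filter-true p (h (here refl)) ⊙ cong (x ∷_) (filter-all p xs (h ∘ there))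

filter-none : ∀ {A : Set} (p : A → Bool) xs → (∀ {x} → x ∈ xs → p x ≡ false) → filterᵇ p xs ≡ []
filter-none p [] h = refl
filter-none p (x ∷ xs) h = filter-false p (h (here refl)) ⊙ filter-none p xs (h ∘ there)

filter-filter : ∀ {A : Set} (p q : A → Bool) xs → filterᵇ p (filterᵇ q xs) ≡ filterᵇ (λ x → q x ∧ p x) xs
filter-filter p q [] = refl
filter-filter p q (x ∷ xs) with q x
... | false = filter-filter p q xs
... | true with p x
... | true  = cong (x ∷_) (filter-filter p q xs)
... | false = filter-filter p q xs

count-all : ∀ {A : Set} (p : A → Bool) xs → (∀ {x} → x ∈ xs → p x ≡ true) → countᵇ p xs ≡ length xs
count-all p xs h = cong length (filter-all p xs h)

count-none : ∀ {A : Set} (p : A → Bool) xs → (∀ {x} → x ∈ xs → p x ≡ false) → countᵇ p xs ≡ 0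
count-none p xs h = cong length (filter-none p xs h)

count≤length : ∀ {A : Set} (p : A → Bool) xs → countᵇ p xs ≤ length xs
count≤length p [] = z≤n
count≤length p (x ∷ xs) with p x
... | true  = s≤s (count≤length p xs)
... | false = m≤n⇒m≤1+n (count≤length p xs)

count-mono : ∀ {A : Set} (p q : A → Bool) xs → (∀ {x} → x ∈ xs → p x ≡ true → q x ≡ true) → countᵇ p xs ≤ countᵇ q xs
count-mono p q [] h = z≤n
count-mono p q (x ∷ xs) h with p x | q x | h (here refl)
... | true  | true  | _ = s≤s (count-mono p q xs (h ∘ there))
... | true  | false | k = true≢false (k refl) refl
... | false | true  | _ = m≤n⇒m≤1+n (count-mono p q xs (h ∘ there))
... | false | false | _ = count-mono p q xs (h ∘ there)

count-strict : ∀ {A : Set} (p q : A → Bool) xs → (∀ {x} → x ∈ xs → p x ≡ true → q x ≡ true) →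
  ∀ {y} → y ∈ xs → p y ≡ false → q y ≡ true → countᵇ p xs < countᵇ q xs
count-strict p q (x ∷ xs) h (here refl) py qy = subst₂ _<_ (sym (cong length (filter-false p {xs = xs} py)))
  (sym (cong length (filter-true q {xs = xs} qy))) (s≤s (count-mono p q xs (h ∘ there)))
count-strict p q (x ∷ xs) h (there m) py qy with p x | q x | h (here refl)
... | true  | true  | _ = s≤s (count-strict p q xs (h ∘ there) m py qy)
... | true  | false | k = true≢false (k refl) refl
... | false | true  | _ = m≤n⇒m≤1+n (count-strict p q xs (h ∘ there) m py qy)
... | false | false | _ = count-strict p q xs (h ∘ there) m py qy

-- Turns a difference between two counts into a witness. `chain-order` obtains from it a kernel
-- letter that separates two entries in value or in position.
count-diff : ∀ {A : Set} (p q : A → Bool) xs → countᵇ p xs < countᵇ q xs →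
  ∃ λ x → x ∈ xs × q x ≡ true × p x ≡ false
count-diff p q (x ∷ xs) h with p x in ep | q x in eq
... | false | true  = x , here refl , eq , ep
... | true  | true  = let y , m , a , b = count-diff p q xs (≤-pred h) in y , there m , a , b
... | true  | false = let y , m , a , b = count-diff p q xs (≤-trans (n≤1+n _) h) in y , there m , a , b
... | false | false = let y , m , a , b = count-diff p q xs h in y , there m , a , b

count-∨ : ∀ {A : Set} (p q : A → Bool) xs → (∀ {x} → x ∈ xs → p x ≡ true → q x ≡ true → ⊥) →
  countᵇ (λ x → p x ∨ q x) xs ≡ countᵇ p xs + countᵇ q xs
count-∨ p q [] h = refl
count-∨ p q (x ∷ xs) h with p x | q x | h (here refl)
... | true  | true  | k = ⊥-elim (k refl refl)
... | true  | false | _ = cong suc (count-∨ p q xs (h ∘ there))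
... | false | true  | _ = cong suc (count-∨ p q xs (h ∘ there)) ⊙ sym (+-suc _ _)
... | false | false | _ = count-∨ p q xs (h ∘ there)

count-filter : ∀ {A : Set} (p q : A → Bool) xs → countᵇ p (filterᵇ q xs) ≡ countᵇ (λ x → q x ∧ p x) xs
count-filter p q xs = cong length (filter-filter p q xs)

count-↭ : ∀ {A : Set} (p : A → Bool) {xs ys : List A} → xs ↭ ys → countᵇ p xs ≡ countᵇ p ys
count-↭ p h = PP.↭-length (PP.filter-↭ _ h)

memb-true⁻ : ∀ {x} xs → memb x xs ≡ true → x ∈ xs
memb-true⁻ (y ∷ ys) h with ∨-true⁻ h
... | inj₁ e = here (≡ᵇ-true⁻ e)
... | inj₂ e = there (memb-true⁻ ys e)

memb-true : ∀ {x xs} → x ∈ xs → memb x xs ≡ true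
memb-true {x} (here e) = ∨-trueˡ (≡ᵇ-true e)
memb-true {x} {y ∷ ys} (there m) = ∨-trueʳ {x ≡ᵇ y} (memb-true m)

memb-false : ∀ {x} xs → x ∉ xs → memb x xs ≡ false
memb-false xs h = ≢true⇒false (h ∘ memb-true⁻ xs)

memb-false⁻ : ∀ {x xs} → memb x xs ≡ false → x ∉ xs
memb-false⁻ h m = true≢false (memb-true m) h

filterᵇ-Unique : ∀ {A : Set} (p : A → Bool) {xs} → Unique xs → Unique (filterᵇ p xs)
filterᵇ-Unique p = UP.filter⁺ _

++-Unique⁻ : ∀ {A : Set} (xs : List A) {ys} → Unique (xs ++ ys) →
  Unique xs × Unique ys × (∀ {x} → x ∈ xs → x ∈ ys → ⊥)
++-Unique⁻ [] u = [] , u , λ ()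
++-Unique⁻ (x ∷ xs) (h ∷ u) with ++-Unique⁻ xs u
... | a , b , c = AllP.++⁻ˡ xs h ∷ a , b , λ { (here refl) m → All.lookup (AllP.++⁻ʳ xs h) m refl ; (there m) n → c m n }

Unique-++ : ∀ {A : Set} {xs ys : List A} → Unique xs → Unique ys → (∀ {x} → x ∈ xs → x ∈ ys → ⊥) → Unique (xs ++ ys)
Unique-++ u v d = UP.++⁺ u v (λ (a , b) → d a b)

Unique-mid⁻ : ∀ {A : Set} (us : List A) {x vs} → Unique (us ++ x ∷ vs) → Unique (us ++ vs) × x ∉ us ++ vs
Unique-mid⁻ us u with ++-Unique⁻ us u
... | a , (h ∷ b) , c = Unique-++ a b (λ m n → c m (there n)) ,
      λ m → case-∈ (∈-++⁻ us m)
  where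
  case-∈ : _ → ⊥
  case-∈ (inj₁ m) = c m (here refl)
  case-∈ (inj₂ m) = All.lookup h m refl

Unique-⊆⇒length≤ : ∀ {A : Set} {xs : List A} (ys : List A) → Unique xs → (∀ {x} → x ∈ xs → x ∈ ys) → length xs ≤ length ys
Unique-⊆⇒length≤ {xs = []} ys u h = z≤n
Unique-⊆⇒length≤ {xs = x ∷ xs} ys (n ∷ u) h with ∈-∃++ (h (here refl))
... | as , bs , refl = subst (suc (length xs) ≤_) (sym (PP.↭-length (PP.shift x as bs)))
   (s≤s (Unique-⊆⇒length≤ (as ++ bs) u (λ {y} m → sub m (h (there m)))))
  where
  sub : ∀ {y} → y ∈ xs → y ∈ as ++ x ∷ bs → y ∈ as ++ bs
  sub m k with ∈-++⁻ as k
  ... | inj₁ a = ∈-++⁺ˡ a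
  ... | inj₂ (here refl) = ⊥-elim (All.lookup n m refl)
  ... | inj₂ (there b) = ∈-++⁺ʳ as b

Unique-⊆⇒↭ : ∀ {xs : List ℕ} (ys : List ℕ) → Unique xs → (∀ {x} → x ∈ xs → x ∈ ys) → length ys ≤ length xs → xs ↭ ys
Unique-⊆⇒↭ {[]} [] u h l = ↭-refl
Unique-⊆⇒↭ {x ∷ xs} ys (n ∷ u) h l with ∈-∃++ (h (here refl))
... | as , bs , refl = ↭-trans (prep x (Unique-⊆⇒↭ (as ++ bs) u (λ {y} m → sub m (h (there m)))
         (≤-pred (subst (_≤ suc (length xs)) (PP.↭-length (PP.shift x as bs)) l)))) (↭-sym (PP.shift x as bs))
  where
  sub : ∀ {y} → y ∈ xs → y ∈ as ++ x ∷ bs → y ∈ as ++ bs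
  sub m k with ∈-++⁻ as k
  ... | inj₁ a = ∈-++⁺ˡ a
  ... | inj₂ (here refl) = ⊥-elim (All.lookup n m refl)
  ... | inj₂ (there b) = ∈-++⁺ʳ as b

-- Permutations as words and the positions of their letters

-- That every value below the length occurs follows by pigeonhole, see `IsPerm-↭` and `IsPerm-∈`.
IsPerm : List ℕ → Set
IsPerm w = Unique w × (∀ {x} → x ∈ w → x < length w)

IsPerm-↭ : ∀ {w} → IsPerm w → w ↭ upTo (length w)
IsPerm-↭ {w} (u , b) = Unique-⊆⇒↭ (upTo (length w)) u (λ m → ∈-upTo⁺ (b m)) (≤-reflexive (length-upTo _))

IsPerm-∈ : ∀ {w x} → IsPerm w → x < length w → x ∈ w
IsPerm-∈ p h = PP.∈-resp-↭ (↭-sym (IsPerm-↭ p)) (∈-upTo⁺ h)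

upTo-suc : ∀ n → upTo (suc n) ≡ 0 ∷ map suc (upTo n)
upTo-suc n = cong (0 ∷_) (sym (map-applyUpTo id n))
  where
  map-applyUpTo : ∀ (g : ℕ → ℕ) n → map suc (applyUpTo g n) ≡ applyUpTo (suc ∘ g) n
  map-applyUpTo g zero = refl
  map-applyUpTo g (suc n) = cong (suc (g 0) ∷_) (map-applyUpTo (g ∘ suc) n)

count-<-upTo : ∀ n v → v ≤ n → countᵇ (_<ᵇ v) (upTo n) ≡ v
count-<-upTo n zero h = count-none (_<ᵇ 0) (upTo n) (λ _ → refl)
count-<-upTo (suc n) (suc v) (s≤s h) = cong (countᵇ (_<ᵇ suc v)) (upTo-suc n) ⊙
  cong suc (count-map (_<ᵇ suc v) suc (upTo n) ⊙ count-<-upTo n v h)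

count-<-perm : ∀ {w v} → IsPerm w → v ≤ length w → countᵇ (_<ᵇ v) w ≡ v
count-<-perm {w} {v} p h = count-↭ (_<ᵇ v) (IsPerm-↭ p) ⊙ count-<-upTo _ v h

map-cong-∈ : ∀ {A B : Set} {g h : A → B} xs → (∀ {x} → x ∈ xs → g x ≡ h x) → map g xs ≡ map h xs
map-cong-∈ [] e = refl
map-cong-∈ (x ∷ xs) e = cong₂ _∷_ (e (here refl)) (map-cong-∈ xs (e ∘ there))

Unique-map : ∀ {A B : Set} (g : A → B) {xs} → (∀ {x y} → x ∈ xs → y ∈ xs → g x ≡ g y → x ≡ y) → Unique xs → Unique (map g xs)
Unique-map g {[]} i [] = []
Unique-map g {x ∷ xs} i (h ∷ u) = All.tabulate (λ m e → absurd m e) ∷ Unique-map g (λ m n → i (there m) (there n)) u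
  where
  absurd : ∀ {z} → z ∈ map g xs → g x ≡ z → ⊥
  absurd m e with ∈-map⁻ g m
  ... | y , n , refl = All.lookup h n (i (here refl) (there n) e)

std-id : ∀ {w} → IsPerm w → std w ≡ w
std-id {w} p = map-cong-∈ w (λ m → count-<-perm p (<⇒≤ (proj₂ p m))) ⊙ map-id w

-- Letters are distinct, so entries are named by their values and positions are recovered from them.
-- For an absent letter the result is the length of the word.
pos : List ℕ → ℕ → ℕ
pos []      x = 0
pos (y ∷ w) x = if y ≡ᵇ x then 0 else suc (pos w x)

pos-here : ∀ x w → pos (x ∷ w) x ≡ 0
pos-here x w rewrite ≡ᵇ-true {x} refl = refl

pos-there : ∀ {x y} w → y ≢ x → pos (y ∷ w) x ≡ suc (pos w x)
pos-there w h rewrite ≡ᵇ-false h = refl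

at-pos : ∀ {x w} → x ∈ w → at w (pos w x) ≡ x
at-pos {x} {y ∷ w} m with y ≡ᵇ x in e
... | true = ≡ᵇ-true⁻ e
at-pos {x} {y ∷ w} (here refl) | false = true≢false (≡ᵇ-true {x} refl) e
at-pos {x} {y ∷ w} (there m)   | false = at-pos m

pos< : ∀ {x w} → x ∈ w → pos w x < length w
pos< {x} {y ∷ w} m with y ≡ᵇ x in e
... | true = s≤s z≤n
pos< {x} {y ∷ w} (here refl) | false = true≢false (≡ᵇ-true {x} refl) e
pos< {x} {y ∷ w} (there m)   | false = s≤s (pos< m)

at∈ : ∀ {i} w → i < length w → at w i ∈ w
at∈ {zero}  (x ∷ w) h = here refl
at∈ {suc i} (x ∷ w) (s≤s h) = there (at∈ w h)

pos-at : ∀ {i w} → Unique w → i < length w → pos w (at w i) ≡ i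
pos-at {zero}  {x ∷ w} u h = pos-here x w
pos-at {suc i} {x ∷ w} (n ∷ u) (s≤s h) = pos-there w (All.lookup n (at∈ w h)) ⊙ cong suc (pos-at u h)

pos-inj : ∀ {x y w} → x ∈ w → y ∈ w → pos w x ≡ pos w y → x ≡ y
pos-inj {w = w} m n e = sym (at-pos m) ⊙ cong (at w) e ⊙ at-pos n

pos-++ˡ : ∀ {x} us vs → x ∈ us → pos (us ++ vs) x ≡ pos us x
pos-++ˡ {x} (u ∷ us) vs m with u ≡ᵇ x in e
... | true = refl
pos-++ˡ {x} (u ∷ us) vs (here refl) | false = true≢false (≡ᵇ-true {x} refl) e
pos-++ˡ {x} (u ∷ us) vs (there m)   | false = cong suc (pos-++ˡ us vs m)

pos-++ʳ : ∀ {x} us vs → x ∉ us → pos (us ++ vs) x ≡ length us + pos vs x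
pos-++ʳ [] vs m = refl
pos-++ʳ (u ∷ us) vs m = pos-there (us ++ vs) (λ e → m (here (sym e))) ⊙ cong suc (pos-++ʳ us vs (m ∘ there))

pos-map : ∀ (g : ℕ → ℕ) {x} w → (∀ {y} → y ∈ w → g y ≡ g x → y ≡ x) → pos (map g w) (g x) ≡ pos w x
pos-map g [] h = refl
pos-map g {x} (y ∷ w) h with y ≡ᵇ x in e
... | true rewrite ≡ᵇ-true⁻ {y} {x} e = pos-here (g x) (map g w)
... | false = pos-there (map g w) (λ k → true≢false (≡ᵇ-true (h (here refl) k)) e) ⊙ cong suc (pos-map g w (h ∘ there))

pos-filter : ∀ (p : ℕ → Bool) {x y} w → x ∈ w → y ∈ w → p x ≡ true → p y ≡ true →
  pos w x < pos w y → pos (filterᵇ p w) x < pos (filterᵇ p w) y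
pos-filter p {x} {y} (z ∷ w) mx my px py h with z ≡ᵇ x in ex | z ≡ᵇ y in ey
... | true | false rewrite ≡ᵇ-true⁻ {z} {x} ex | filter-true p {x} {w} px | ≡ᵇ-true {x} refl | ey = s≤s z≤n
... | false | false = by mx my
  where
  by : x ∈ z ∷ w → y ∈ z ∷ w → pos (filterᵇ p (z ∷ w)) x < pos (filterᵇ p (z ∷ w)) y
  by (here refl) _ = true≢false (≡ᵇ-true {x} refl) ex
  by (there _) (here refl) = true≢false (≡ᵇ-true {y} refl) ey
  by (there mx) (there my) with p z
  ... | false = pos-filter p w mx my px py (≤-pred h)
  ... | true rewrite ex | ey = s≤s (pos-filter p w mx my px py (≤-pred h))

pos-total : ∀ {w x y} → x ∈ w → y ∈ w → x ≢ y → pos w x < pos w y ⊎ pos w y < pos w x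
pos-total {w} {x} {y} mx my n with <-cmp (pos w x) (pos w y)
... | tri< a _ _ = inj₁ a
... | tri≈ _ b _ = ⊥-elim (n (pos-inj mx my b))
... | tri> _ _ c = inj₂ c

pos-filter⁻ : ∀ (p : ℕ → Bool) {x y} w → x ∈ w → y ∈ w → p x ≡ true → p y ≡ true →
  pos (filterᵇ p w) x < pos (filterᵇ p w) y → pos w x < pos w y
pos-filter⁻ p {x} {y} w mx my px py h with <-cmp (pos w x) (pos w y)
... | tri< a _ _ = a
... | tri≈ _ b _ rewrite pos-inj mx my b = ⊥-elim (<-irrefl refl h)
... | tri> _ _ c = ⊥-elim (<-asym h (pos-filter p w my mx py px c))

pos-sorted : ∀ {w} → Unique w → AllPairs (λ x y → pos w x < pos w y) w
pos-sorted {[]} u = []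
pos-sorted {x ∷ w} (n ∷ u) = All.tabulate (λ {y} m → subst₂ _<_ (sym (pos-here x w)) (sym (pos-there w (All.lookup n m))) (s≤s z≤n))
  ∷ lift n (pos-sorted u)
  where
  lift : ∀ {ys} → All (x ≢_) ys → AllPairs (λ a b → pos w a < pos w b) ys → AllPairs (λ a b → pos (x ∷ w) a < pos (x ∷ w) b) ys
  lift [] [] = []
  lift (n ∷ ns) (a ∷ as) = go n ns a ∷ lift ns as
    where
    go : ∀ {z zs} → x ≢ z → All (x ≢_) zs → All (λ b → pos w z < pos w b) zs → All (λ b → pos (x ∷ w) z < pos (x ∷ w) b) zs
    go n [] [] = []
    go n (m ∷ ms) (a ∷ as) = subst₂ _<_ (sym (pos-there w n)) (sym (pos-there w m)) (s≤s a) ∷ go n ms as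

-- Occurrences and kernels

∈-range⁺ : ∀ {a b x} → a ≤ x → x < b → x ∈ range a b
∈-range⁺ {a} {b} {x} l h = subst (_∈ range a b) (m+[n∸m]≡n l) (∈-map⁺ (a +_) (∈-upTo⁺ (∸-monoˡ-< h l)))

∈-range⁻ : ∀ {a b x} → x ∈ range a b → a ≤ x × x < b
∈-range⁻ {a} {b} m with ∈-map⁻ (a +_) m
... | y , n , refl = m≤m+n a y , subst (a + y <_) (m+[n∸m]≡n (<⇒≤ (m∸n≢0⇒n<m {b} {a} (λ e → n≮0 (subst (y <_) e (∈-upTo⁻ n))))))
                                  (+-monoʳ-< a (∈-upTo⁻ n))

∈-concatMap⁺′ : ∀ {A B : Set} (h : A → List B) {x y xs} → x ∈ xs → y ∈ h x → y ∈ concatMap h xs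
∈-concatMap⁺′ h m n = ∈-concatMap⁺ h (lose m n)

∈-concatMap⁻′ : ∀ {A B : Set} (h : A → List B) {y} xs → y ∈ concatMap h xs → ∃ λ x → x ∈ xs × y ∈ h x
∈-concatMap⁻′ h xs m = find (∈-concatMap⁻ h {xs} m)

record Occ (w : List ℕ) (a c b : ℕ) : Set where
  constructor occ
  field
    a∈  : a ∈ w
    c∈  : c ∈ w
    b∈  : b ∈ w
    a-c : pos w a < pos w c
    c-b : pos w c < pos w b
    a<b : a < b
    b<c : b < c

  a<c : a < c
  a<c = <-trans a<b b<c

occ132⇒Occ : ∀ {w i j k} → Unique w → (i , j , k) ∈ occ132 w →
  (i < j × j < k × k < length w) × Occ w (at w i) (at w j) (at w k)
occ132⇒Occ {w} {i} {j} {k} u m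
  with ∈-filterᵇ⁻ _ (triples (length w)) m
... | m₁ , e with ∈-concatMap⁻′ _ (upTo (length w)) m₁
... | i , mi , m₂ with ∈-concatMap⁻′ _ (range (suc i) (length w)) m₂
... | j , mj , m₃ with ∈-map⁻ _ m₃
... | k , mk , refl with ∈-range⁻ {suc i} mj | ∈-range⁻ {suc j} mk | ∧-true⁻ e
... | i<j , j<n | j<k , k<n | e₁ , e₂ = (i<j , j<k , k<n) ,
  occ (at∈ w i<n) (at∈ w j<n) (at∈ w k<n)
      (subst₂ _<_ (sym (pos-at u i<n)) (sym (pos-at u j<n)) i<j)
      (subst₂ _<_ (sym (pos-at u j<n)) (sym (pos-at u k<n)) j<k)
      (<ᵇ-true⁻ e₁) (<ᵇ-true⁻ e₂)
  where i<n = <-trans i<j j<n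

Occ⇒occ132 : ∀ {w a c b} → Occ w a c b → (pos w a , pos w c , pos w b) ∈ occ132 w
Occ⇒occ132 {w} {a} {c} {b} (occ ma mc mb p q a<b b<c) =
  ∈-filterᵇ⁺ (∈-concatMap⁺′ _ (∈-upTo⁺ (pos< ma)) (∈-concatMap⁺′ _ (∈-range⁺ p (pos< mc)) (∈-map⁺ _ (∈-range⁺ q (pos< mb)))))
    (∧-true (<ᵇ-true (subst₂ _<_ (sym (at-pos ma)) (sym (at-pos mb)) a<b))
            (<ᵇ-true (subst₂ _<_ (sym (at-pos mb)) (sym (at-pos mc)) b<c)))

Touch Full : (ℕ → Set) → ℕ → ℕ → ℕ → Set
Touch Q a c b = Q a ⊎ Q c ⊎ Q b
Full  Q a c b = Q a × Q c × Q b

Closed : List ℕ → (ℕ → Set) → Set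
Closed w Q = ∀ {a c b} → Occ w a c b → Touch Q a c b → Full Q a c b

-- κ, the subword of w on the letters with mark true, is the connected component of
-- the letter M in the graph of entries and occurrences.
record Ker (M : ℕ) (w κ : List ℕ) : Set₁ where
  field
    mark   : ℕ → Bool
    sub    : κ ≡ filterᵇ mark w
    top    : M ∈ κ
    closed : Closed w (_∈ κ)
    least  : (Q : ℕ → Set) → Q M → Closed w Q → ∀ {x} → x ∈ κ → Q x

  ∈w : ∀ {x} → x ∈ κ → x ∈ w
  ∈w m = proj₁ (∈-filterᵇ⁻ mark w (subst (_ ∈_) sub m))

  mark⁺ : ∀ {x} → x ∈ κ → mark x ≡ true
  mark⁺ m = proj₂ (∈-filterᵇ⁻ mark w (subst (_ ∈_) sub m))

  mark⁻ : ∀ {x} → x ∈ w → mark x ≡ true → x ∈ κ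
  mark⁻ m e = subst (_ ∈_) (sym sub) (∈-filterᵇ⁺ m e)

  posκ : ∀ {x y} → x ∈ κ → y ∈ κ → pos w x < pos w y → pos κ x < pos κ y
  posκ m n h = subst (λ z → pos z _ < pos z _) (sym sub) (pos-filter mark w (∈w m) (∈w n) (mark⁺ m) (mark⁺ n) h)

  posκ⁻ : ∀ {x y} → x ∈ κ → y ∈ κ → pos κ x < pos κ y → pos w x < pos w y
  posκ⁻ m n h = pos-filter⁻ mark w (∈w m) (∈w n) (mark⁺ m) (mark⁺ n) (subst (λ z → pos z _ < pos z _) sub h)

  occκ : ∀ {a c b} → Occ κ a c b → Occ w a c b
  occκ (occ ma mc mb p q r s) = occ (∈w ma) (∈w mc) (∈w mb) (posκ⁻ ma mc p) (posκ⁻ mc mb q) r s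

  occκ⁻ : ∀ {a c b} → Full (_∈ κ) a c b → Occ w a c b → Occ κ a c b
  occκ⁻ (ma , mc , mb) (occ _ _ _ p q r s) = occ ma mc mb (posκ ma mc p) (posκ mc mb q) r s

  uniqueκ : Unique w → Unique κ
  uniqueκ u = subst Unique (sym sub) (filterᵇ-Unique mark u)

-- Each of the two words is itself a closed set containing `M`, so minimality of either one puts it
-- inside the other.
Ker-unique : ∀ {M w κ κ′} → Ker M w κ → Ker M w κ′ → κ ≡ κ′
Ker-unique {w = w} k k′ = K.sub ⊙ filter-cong w same ⊙ sym K′.sub
  where
  module K = Ker k
  module K′ = Ker k′
  same : ∀ {x} → x ∈ w → K.mark x ≡ K′.mark x
  same m = iff⇒≡ (λ e → K′.mark⁺ (K.least _ K′.top K′.closed (K.mark⁻ m e)))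
                 (λ e → K.mark⁺ (K′.least _ K.top K.closed (K′.mark⁻ m e)))

-- The occurrences inside `κ` alone connect it: a set closed for `κ` becomes closed for `w` after
-- intersection with `κ`, because an occurrence of `w` that touches `κ` lies in `κ`.
Ker-self : ∀ {M w κ} → Ker M w κ → Ker M κ κ
Ker-self {M} {w} {κ} k = record
  { mark = λ _ → true ; sub = sym (filter-all _ κ (λ _ → refl)) ; top = K.top
  ; closed = λ (occ ma mc mb _ _ _ _) _ → ma , mc , mb
  ; least = λ Q q c m → proj₁ (K.least (λ x → Q x × x ∈ κ) (q , K.top) (lemma Q c) m) }
  where
  module K = Ker k
  lemma : ∀ Q → Closed κ Q → Closed w (λ x → Q x × x ∈ κ)
  lemma Q c o t with K.closed o (drop₂ t)
    where
    drop₂ : ∀ {a c b} → Touch (λ x → Q x × x ∈ κ) a c b → Touch (_∈ κ) a c b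
    drop₂ (inj₁ (_ , m)) = inj₁ m
    drop₂ (inj₂ (inj₁ (_ , m))) = inj₂ (inj₁ m)
    drop₂ (inj₂ (inj₂ (_ , m))) = inj₂ (inj₂ m)
  ... | full@(ma , mc , mb) with c (K.occκ⁻ full o) (keep t)
    where
    keep : ∀ {a c b} → Touch (λ x → Q x × x ∈ κ) a c b → Touch Q a c b
    keep (inj₁ (q , _)) = inj₁ q
    keep (inj₂ (inj₁ (q , _))) = inj₂ (inj₁ q)
    keep (inj₂ (inj₂ (q , _))) = inj₂ (inj₂ q)
  ... | qa , qc , qb = (qa , ma) , (qc , mc) , (qb , mb)

Mono : (ℕ → ℕ) → List ℕ → Set
Mono g w = ∀ {x y} → x ∈ w → y ∈ w → x < y → g x < g y

Mono-inj : ∀ {g w} → Mono g w → ∀ {x y} → x ∈ w → y ∈ w → g x ≡ g y → x ≡ y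
Mono-inj h {x} {y} mx my e with <-cmp x y
... | tri< a _ _ = ⊥-elim (<-irrefl e (h mx my a))
... | tri≈ _ b _ = b
... | tri> _ _ c = ⊥-elim (<-irrefl (sym e) (h my mx c))

Mono-<⁻ : ∀ {g w} → Mono g w → ∀ {x y} → x ∈ w → y ∈ w → g x < g y → x < y
Mono-<⁻ h {x} {y} mx my e with <-cmp x y
... | tri< a _ _ = a
... | tri≈ _ refl _ = ⊥-elim (<-irrefl refl e)
... | tri> _ _ c = ⊥-elim (<-asym e (h my mx c))

Mono-<ᵇ : ∀ {g w} → Mono g w → ∀ {x y} → x ∈ w → y ∈ w → (g x <ᵇ g y) ≡ (x <ᵇ y)
Mono-<ᵇ h mx my = iff⇒≡ (λ e → <ᵇ-true (Mono-<⁻ h mx my (<ᵇ-true⁻ e))) (λ e → <ᵇ-true (h mx my (<ᵇ-true⁻ e)))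

Mono-pos : ∀ {g w} → Mono g w → ∀ {x} → x ∈ w → pos (map g w) (g x) ≡ pos w x
Mono-pos {g} {w} h m = pos-map g w (λ n e → Mono-inj h n m e)

Occ-map : ∀ {g w} → Mono g w → ∀ {a c b} → Occ w a c b → Occ (map g w) (g a) (g c) (g b)
Occ-map {g} h (occ ma mc mb p q r s) = occ (∈-map⁺ g ma) (∈-map⁺ g mc) (∈-map⁺ g mb)
  (subst₂ _<_ (sym (Mono-pos h ma)) (sym (Mono-pos h mc)) p)
  (subst₂ _<_ (sym (Mono-pos h mc)) (sym (Mono-pos h mb)) q) (h ma mb r) (h mb mc s)

data OccImage (g : ℕ → ℕ) (w : List ℕ) : ℕ → ℕ → ℕ → Set where
  image : ∀ {a c b} → Occ w a c b → OccImage g w (g a) (g c) (g b)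

Occ-map⁻ : ∀ {g w} → Mono g w → ∀ {a c b} → Occ (map g w) a c b → OccImage g w a c b
Occ-map⁻ {g} h (occ ma mc mb p q r s) with ∈-map⁻ g ma | ∈-map⁻ g mc | ∈-map⁻ g mb
... | a , na , refl | c , nc , refl | b , nb , refl = image (occ na nc nb
  (subst₂ _<_ (Mono-pos h na) (Mono-pos h nc) p) (subst₂ _<_ (Mono-pos h nc) (Mono-pos h nb) q)
  (Mono-<⁻ h na nb r) (Mono-<⁻ h nb nc s))

memb-map : ∀ {g w κ} → Mono g w → (∀ {x} → x ∈ κ → x ∈ w) → ∀ {x} → x ∈ w → g x ∈ map g κ → x ∈ κ
memb-map {g} h s m n with ∈-map⁻ g n
... | y , k , e = subst (_∈ _) (sym (Mono-inj h m (s k) e)) k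

Ker-map : ∀ {M w κ g} → Mono g w → Ker M w κ → Ker (g M) (map g w) (map g κ)
Ker-map {M} {w} {κ} {g} h k = record
  { mark = λ x → memb x (map g κ)
  ; sub = cong (map g) (K.sub ⊙ filter-cong w same) ⊙ sym (filter-map _ g w)
  ; top = ∈-map⁺ g K.top
  ; closed = clo
  ; least = λ Q q c m → lst Q q c m }
  where
  module K = Ker k
  same : ∀ {x} → x ∈ w → K.mark x ≡ memb (g x) (map g κ)
  same m = iff⇒≡ (λ e → memb-true (∈-map⁺ g (K.mark⁻ m e)))
                 (λ e → K.mark⁺ (memb-map h K.∈w m (memb-true⁻ (map g κ) e)))
  clo : Closed (map g w) (_∈ map g κ)
  clo o t with Occ-map⁻ h o
  clo o t | image o′@(occ ma mc mb _ _ _ _) with K.closed o′ (back t)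
    where
    back : Touch (_∈ map g κ) _ _ _ → Touch (_∈ κ) _ _ _
    back (inj₁ m) = inj₁ (memb-map h K.∈w ma m)
    back (inj₂ (inj₁ m)) = inj₂ (inj₁ (memb-map h K.∈w mc m))
    back (inj₂ (inj₂ m)) = inj₂ (inj₂ (memb-map h K.∈w mb m))
  ... | na , nc , nb = ∈-map⁺ g na , ∈-map⁺ g nc , ∈-map⁺ g nb
  lst : (Q : ℕ → Set) → Q (g M) → Closed (map g w) Q → ∀ {x} → x ∈ map g κ → Q x
  lst Q q c m with ∈-map⁻ g m
  ... | y , n , refl = K.least (Q ∘ g) q (λ o t → c (Occ-map h o) t) n

-- The growth procedure computes the component of the maximum

ClosedPos : List (ℕ × ℕ × ℕ) → (ℕ → Set) → Set
ClosedPos os Q = ∀ {i j k} → (i , j , k) ∈ os → Touch Q i j k → Full Q i j k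

grow-⊇ : ∀ os {S x} → x ∈ S → x ∈ growStep os S
grow-⊇ os m = ∈-++⁺ˡ m

Touch-memb : ∀ {i j k} S → Touch (_∈ S) i j k → memb i S ∨ memb j S ∨ memb k S ≡ true
Touch-memb {i} {j} {k} S (inj₁ m) = ∨-trueˡ (memb-true m)
Touch-memb {i} {j} {k} S (inj₂ (inj₁ m)) = ∨-trueʳ {memb i S} (∨-trueˡ (memb-true m))
Touch-memb {i} {j} {k} S (inj₂ (inj₂ m)) = ∨-trueʳ {memb i S} (∨-trueʳ {memb j S} (memb-true m))

memb-Touch : ∀ {i j k} S → memb i S ∨ memb j S ∨ memb k S ≡ true → Touch (_∈ S) i j k
memb-Touch {i} {j} {k} S h with ∨-true⁻ {memb i S} h
... | inj₁ e = inj₁ (memb-true⁻ S e)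
... | inj₂ e with ∨-true⁻ {memb j S} e
... | inj₁ e = inj₂ (inj₁ (memb-true⁻ S e))
... | inj₂ e = inj₂ (inj₂ (memb-true⁻ S e))

Touch-map : ∀ {A B C A′ B′ C′ : Set} → (A → A′) → (B → B′) → (C → C′) → A ⊎ B ⊎ C → A′ ⊎ B′ ⊎ C′
Touch-map f g h (inj₁ x) = inj₁ (f x)
Touch-map f g h (inj₂ (inj₁ x)) = inj₂ (inj₁ (g x))
Touch-map f g h (inj₂ (inj₂ x)) = inj₂ (inj₂ (h x))

∈-if : ∀ {A : Set} {x : A} {xs} b → x ∈ (if b then xs else []) → b ≡ true × x ∈ xs
∈-if true m = refl , m

if-∈ : ∀ {A : Set} {x : A} {xs b} → b ≡ true → x ∈ xs → x ∈ (if b then xs else [])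
if-∈ refl m = m

grow-hit : ∀ {os S i j k} → (i , j , k) ∈ os → Touch (_∈ S) i j k → Full (_∈ growStep os S) i j k
grow-hit {os} {S} {i} {j} {k} m t = put (here refl) , put (there (here refl)) , put (there (there (here refl)))
  where
  put : ∀ {x} → x ∈ i ∷ j ∷ k ∷ [] → x ∈ growStep os S
  put n = ∈-++⁺ʳ S (∈-concatMap⁺′ _ m (if-∈ (Touch-memb S t) n))

grow-least : ∀ {os S} {Q : ℕ → Set} → ClosedPos os Q → (∀ {x} → x ∈ S → Q x) → ∀ {x} → x ∈ growStep os S → Q x
grow-least {os} {S} {Q} c h m with ∈-++⁻ S m
... | inj₁ n = h n
... | inj₂ n with ∈-concatMap⁻′ _ os n
... | (i , j , k) , o , n′ with ∈-if (memb i S ∨ memb j S ∨ memb k S) n′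
... | e , n″ with c o (Touch-map h h h (memb-Touch {i} {j} {k} S e))
grow-least c h m | inj₂ n | (i , j , k) , o , n′ | e , here refl | a , b , d = a
grow-least c h m | inj₂ n | (i , j , k) , o , n′ | e , there (here refl) | a , b , d = b
grow-least c h m | inj₂ n | (i , j , k) , o , n′ | e , there (there (here refl)) | a , b , d = d

iter-least : ∀ {os S} {Q : ℕ → Set} n → ClosedPos os Q → (∀ {x} → x ∈ S → Q x) → ∀ {x} → x ∈ iter n (growStep os) S → Q x
iter-least zero c h = h
iter-least (suc n) c h = iter-least n c (grow-least c h)

iter-⊇ : ∀ os {S x} n → x ∈ S → x ∈ iter n (growStep os) S
iter-⊇ os zero m = m
iter-⊇ os (suc n) m = iter-⊇ os n (grow-⊇ os m)

-- A round either reaches a new position or leaves the reached positions unchanged. In the second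
-- case the set is closed and remains so; the first case cannot occur in all of `n` rounds, as there
-- are only `n` positions.
module Saturation (os : List (ℕ × ℕ × ℕ)) (n : ℕ) (bound : ∀ {i j k} → (i , j , k) ∈ os → i < n × j < n × k < n) where

  -- `growStep` appends without removing repetitions, so progress is measured by distinct positions
  -- and not by the length of the list.
  reached : List ℕ → ℕ
  reached S = countᵇ (λ x → memb x S) (upTo n)

  stable⇒closed : ∀ S → reached (growStep os S) ≤ reached S → ClosedPos os (_∈ S)
  stable⇒closed S h m t with bound m | grow-hit {os} {S} m t
  ... | bi , bj , bk | gi , gj , gk = old bi gi , old bj gj , old bk gk
    where
    old : ∀ {x} → x < n → x ∈ growStep os S → x ∈ S
    old {x} b g = bool-case (memb x S) (memb-true⁻ {x} S) λ e → ⊥-elim (<⇒≱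
      (count-strict (λ x → memb x S) (λ x → memb x (growStep os S)) (upTo n)
        (λ {y} _ e → memb-true {y} (grow-⊇ os (memb-true⁻ {y} S e))) (∈-upTo⁺ b) e (memb-true g)) h)

  closed-grow : ∀ S → ClosedPos os (_∈ S) → ClosedPos os (_∈ growStep os S)
  closed-grow S c m t = let g = grow-least {Q = _∈ S} c id ; a , b , d = c m (Touch-map g g g t)
                        in grow-⊇ os a , grow-⊇ os b , grow-⊇ os d

  closed-iter : ∀ j S → ClosedPos os (_∈ S) → ClosedPos os (_∈ iter j (growStep os) S)
  closed-iter zero    S c = c
  closed-iter (suc j) S c = closed-iter j (growStep os S) (closed-grow S c)

  closed⊎large : ∀ j S → ClosedPos os (_∈ iter j (growStep os) S) ⊎ reached S + j ≤ reached (iter j (growStep os) S)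
  closed⊎large zero S = inj₂ (≤-reflexive (+-identityʳ _))
  closed⊎large (suc j) S with reached (growStep os S) ≤? reached S
  ... | yes h = inj₁ (closed-iter j (growStep os S) (closed-grow S (stable⇒closed S h)))
  ... | no h with closed⊎large j (growStep os S)
  ... | inj₁ c = inj₁ c
  ... | inj₂ l = inj₂ (≤-trans (≤-trans (≤-reflexive (+-suc _ j)) (+-monoˡ-≤ j (≰⇒> h))) l)

  saturated : ∀ {p} → p < n → ClosedPos os (_∈ iter n (growStep os) (p ∷ []))
  saturated {p} h with closed⊎large n (p ∷ [])
  ... | inj₁ c = c
  -- The starting position is counted before the first round, so `n` productive rounds would reach
  -- at least `n + 1` of the `n` positions.
  ... | inj₂ l = ⊥-elim (<⇒≱ (≤-trans (+-monoˡ-≤ n one) l) (≤-trans (count≤length _ (upTo n)) (≤-reflexive (length-upTo n))))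
    where
    one : 1 ≤ reached (p ∷ [])
    one = subst (_< reached (p ∷ [])) (count-none (λ _ → false) (upTo n) (λ _ → refl))
      (count-strict (λ _ → false) (λ x → memb x (p ∷ [])) (upTo n) (λ _ ()) (∈-upTo⁺ h) refl (memb-true {p} {p ∷ []} (here refl)))

-- The search inside posMax is local to Defs and has no name there; the second
-- definition determines it by unification.
mutual
  posMaxFrom : List ℕ → ℕ → List ℕ → ℕ
  posMaxFrom = _

  posMax-unfold : ∀ x xs → posMax (x ∷ xs) ≡ (if x ≡ᵇ length xs then 0 else posMaxFrom (x ∷ xs) 1 xs)
  -- Replacing the whole word and the index 1 by variables leaves an equation between applications
  -- to distinct variables, which determines the unnamed function uniquely.
  posMax-unfold x xs with x ≡ᵇ length xs | x ∷ xs | suc zero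
  ... | true  | _ | _ = refl
  ... | false | w | i = refl

posMaxFrom-pos : ∀ w i xs → length w ∸ 1 ∈ xs → posMaxFrom w i xs ≡ i + pos xs (length w ∸ 1)
posMaxFrom-pos w i (x ∷ xs) m with x ≡ᵇ (length w ∸ 1) in e
... | true = sym (+-identityʳ i)
posMaxFrom-pos w i (x ∷ xs) (here refl) | false = true≢false (≡ᵇ-true {x} refl) e
posMaxFrom-pos w i (x ∷ xs) (there m) | false = posMaxFrom-pos w (suc i) xs m ⊙ sym (+-suc i _)

posMax-pos : ∀ w → length w ∸ 1 ∈ w → posMax w ≡ pos w (length w ∸ 1)
posMax-pos (x ∷ xs) m with x ≡ᵇ length xs in e
... | true = refl
posMax-pos (x ∷ xs) (here refl) | false = true≢false (≡ᵇ-true {x} refl) e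
posMax-pos (x ∷ xs) (there m) | false = posMaxFrom-pos (x ∷ xs) 1 xs m

map-at-upTo : ∀ w → map (at w) (upTo (length w)) ≡ w
map-at-upTo [] = refl
map-at-upTo (x ∷ w) = cong (map (at (x ∷ w))) (upTo-suc (length w)) ⊙
  cong (x ∷_) (sym (map-∘ (upTo (length w))) ⊙ map-at-upTo w)

-- Passes from positions, by which `kernel` is defined, to letters, by which `Ker` is stated; in a
-- word with distinct letters the two determine each other.
kernel-filter : ∀ {w} → Unique w → kernel w ≡ filterᵇ (λ x → memb (pos w x) (kernelPositions w)) w
kernel-filter {w} u = sym (cong (filterᵇ q) (sym (map-at-upTo w)) ⊙ filter-map q (at w) (upTo (length w)) ⊙
    cong (map (at w)) (filter-cong (upTo (length w)) (λ m → cong (λ p → memb p (kernelPositions w)) (pos-at u (∈-upTo⁻ m)))))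
  where q = λ x → memb (pos w x) (kernelPositions w)

-- Closure is saturation of the growth procedure. Minimality holds because growth from the maximum
-- never leaves a closed set.
kernel-Ker : ∀ {w} → IsPerm w → 0 < length w → Ker (length w ∸ 1) w (kernel w)
kernel-Ker {w} p@(u , b) h = record
  { mark = λ x → memb (pos w x) KP
  ; sub = kernel-filter u
  ; top = in-kernel M∈ (subst (_∈ KP) (posMax-pos w M∈) (iter-⊇ (occ132 w) (length w) (here refl)))
  ; closed = λ o t → clo o (sat (Occ⇒occ132 o) (Touch-map (proj₂ ∘ out) (proj₂ ∘ out) (proj₂ ∘ out) t))
  ; least = λ Q q c m → lst Q q c (out m) }
  where
  KP = kernelPositions w
  M = length w ∸ 1
  M∈ : M ∈ w
  M∈ = IsPerm-∈ p (∸-monoʳ-< {length w} (s≤s z≤n) h)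
  in-kernel : ∀ {x} → x ∈ w → pos w x ∈ KP → x ∈ kernel w
  in-kernel m n = subst (_ ∈_) (sym (kernel-filter u)) (∈-filterᵇ⁺ m (memb-true n))
  out : ∀ {x} → x ∈ kernel w → x ∈ w × pos w x ∈ KP
  out m = let a , e = ∈-filterᵇ⁻ _ w (subst (_ ∈_) (kernel-filter u) m) in a , memb-true⁻ KP e
  bound : ∀ {i j k} → (i , j , k) ∈ occ132 w → i < length w × j < length w × k < length w
  bound o = let (ij , jk , kn) , _ = occ132⇒Occ u o in <-trans ij (<-trans jk kn) , <-trans jk kn , kn
  posMax< : posMax w < length w
  posMax< = subst (_< length w) (sym (posMax-pos w M∈)) (pos< M∈)
  sat : ClosedPos (occ132 w) (_∈ KP)
  sat = Saturation.saturated (occ132 w) (length w) bound posMax<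
  clo : ∀ {a c b} → Occ w a c b → Full (_∈ KP) (pos w a) (pos w c) (pos w b) → Full (_∈ kernel w) a c b
  clo (occ ma mc mb _ _ _ _) (a , c , b) = in-kernel ma a , in-kernel mc c , in-kernel mb b
  lst : (Q : ℕ → Set) → Q M → Closed w Q → ∀ {x} → x ∈ w × pos w x ∈ KP → Q x
  lst Q q c (m , n) = subst Q (at-pos m) (iter-least {Q = Q ∘ at w} (length w)
    (λ o t → c (proj₂ (occ132⇒Occ u o)) t) (λ { (here refl) → subst Q (sym (cong (at w) (posMax-pos w M∈) ⊙ at-pos M∈)) q }) n)

-- Recursive counts of inversions and occurrences

pc : (ℕ → ℕ → Bool) → List ℕ → ℕ
pc Q []       = 0
pc Q (y ∷ ys) = countᵇ (Q y) ys + pc Q ys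

ic : List ℕ → ℕ
ic = pc (λ y z → z <ᵇ y)

-- The entries playing 3 and 2 together with a given 1 are the inversions among the
-- larger entries to its right.
tc : List ℕ → ℕ
tc []       = 0
tc (x ∷ xs) = ic (filterᵇ (x <ᵇ_) xs) + tc xs

count-concatMap : ∀ {A B : Set} (p : B → Bool) (h : A → List B) xs →
  countᵇ p (concatMap h xs) ≡ sum (map (λ x → countᵇ p (h x)) xs)
count-concatMap p h [] = refl
count-concatMap p h (x ∷ xs) = count-++ p (h x) (concatMap h xs) ⊙ cong (countᵇ p (h x) +_) (count-concatMap p h xs)

range-suc : ∀ a b → range (suc a) (suc b) ≡ map suc (range a b)
range-suc a b = map-∘ (upTo (b ∸ a))

count-at : ∀ (p : ℕ → Bool) w → countᵇ (p ∘ at w) (upTo (length w)) ≡ countᵇ p w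
count-at p w = sym (count-map p (at w) (upTo (length w))) ⊙ cong (countᵇ p) (map-at-upTo w)

sum-shift : ∀ (F : ℕ → ℕ) n → sum (map F (upTo (suc n))) ≡ F 0 + sum (map (F ∘ suc) (upTo n))
sum-shift F n = cong (sum ∘ map F) (upTo-suc n) ⊙ cong (λ z → F 0 + sum z) (sym (map-∘ (upTo n)))

sum-map-cong : ∀ {A : Set} {F G : A → ℕ} xs → (∀ {x} → x ∈ xs → F x ≡ G x) → sum (map F xs) ≡ sum (map G xs)
sum-map-cong xs h = cong sum (map-cong-∈ xs h)

pc-sum : ∀ Q w → sum (map (λ i → countᵇ (λ j → Q (at w i) (at w j)) (range (suc i) (length w))) (upTo (length w))) ≡ pc Q w
pc-sum Q [] = refl
pc-sum Q (x ∷ w) = sum-shift _ (length w) ⊙ cong₂ _+_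
  (count-map _ suc (upTo (length w)) ⊙ count-at (Q x) w)
  (sum-map-cong (upTo (length w)) (λ {i} _ → cong (countᵇ _) (range-suc (suc i) (length w)) ⊙ count-map _ suc (range (suc i) (length w))) ⊙ pc-sum Q w)

count-pairs : ∀ Q w → (p : ℕ × ℕ → Bool) → (∀ i j → p (i , j) ≡ Q (at w i) (at w j)) →
  countᵇ p (concatMap (λ i → map (λ j → (i , j)) (range (suc i) (length w))) (upTo (length w))) ≡ pc Q w
count-pairs Q w p h = count-concatMap p _ (upTo (length w)) ⊙
  sum-map-cong (upTo (length w)) (λ {i} _ → count-map p (i ,_) (range (suc i) (length w)) ⊙ count-cong (range (suc i) (length w)) (λ {j} _ → h i j)) ⊙ pc-sum Q w

-- The definition enumerates pairs of indices; the recursive form splits along concatenations, which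
-- is what the insertion of a block requires.
inv≡ic : ∀ w → inv w ≡ ic w
inv≡ic w = count-pairs _ w _ (λ _ _ → refl)

-- From `x < z < y` follows `x < y`, so testing the smaller letter alone already confines the pair
-- to the letters above `x`.
pc-filter : ∀ x w → pc (λ y z → (x <ᵇ z) ∧ (z <ᵇ y)) w ≡ ic (filterᵇ (x <ᵇ_) w)
pc-filter x [] = refl
pc-filter x (y ∷ w) with x <ᵇ y in e
... | true = cong₂ _+_ (sym (count-filter (_<ᵇ y) (x <ᵇ_) w)) (pc-filter x w)
... | false = cong₂ _+_ (count-none _ w (λ {z} _ → ≢true⇒false (λ k → let a , b = ∧-true⁻ {x <ᵇ z} k in
    true≢false (<ᵇ-true (<-trans (<ᵇ-true⁻ {x} {z} a) (<ᵇ-true⁻ {z} {y} b))) e))) (pc-filter x w)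

count-triples : ∀ w → (p : ℕ × ℕ × ℕ → Bool) → (∀ i j k → p (i , j , k) ≡ (at w i <ᵇ at w k) ∧ (at w k <ᵇ at w j)) →
  countᵇ p (triples (length w)) ≡ tc w
count-triples w p h = count-concatMap p _ (upTo (length w)) ⊙
    sum-map-cong (upTo (length w)) (λ {i} _ → count-concatMap p _ (range (suc i) (length w)) ⊙
      sum-map-cong (range (suc i) (length w)) (λ {j} _ → count-map p _ (range (suc j) (length w)) ⊙
        count-cong (range (suc j) (length w)) (λ {k} _ → h i j k))) ⊙ go w
  where
  go : ∀ w → sum (map (λ i → sum (map (λ j → countᵇ (λ k → (at w i <ᵇ at w k) ∧ (at w k <ᵇ at w j)) (range (suc j) (length w)))
                 (range (suc i) (length w)))) (upTo (length w))) ≡ tc w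
  go [] = refl
  go (x ∷ w) = sum-shift _ (length w) ⊙ cong₂ _+_
      (cong sum (sym (map-∘ (upTo (length w)))) ⊙ sum-map-cong (upTo (length w)) (λ {j} _ → inner 0 j) ⊙ pc-sum (λ y z → (x <ᵇ z) ∧ (z <ᵇ y)) w ⊙ pc-filter x w)
      (sum-map-cong (upTo (length w)) (λ {i} _ → cong (λ z → sum (map (G i) z)) (range-suc (suc i) (length w)) ⊙
         cong sum (sym (map-∘ (range (suc i) (length w)))) ⊙ sum-map-cong (range (suc i) (length w)) (λ {j} _ → inner (suc i) j)) ⊙ go w)
    where
    G : ℕ → ℕ → ℕ
    G i j = countᵇ (λ k → (at w i <ᵇ at (x ∷ w) k) ∧ (at (x ∷ w) k <ᵇ at (x ∷ w) j)) (range (suc j) (suc (length w)))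
    inner : ∀ i j → countᵇ (λ k → (at (x ∷ w) i <ᵇ at (x ∷ w) k) ∧ (at (x ∷ w) k <ᵇ at w j)) (range (suc (suc j)) (suc (length w)))
      ≡ countᵇ (λ k → (at (x ∷ w) i <ᵇ at w k) ∧ (at w k <ᵇ at w j)) (range (suc j) (length w))
    inner i j = cong (countᵇ _) (range-suc (suc j) (length w)) ⊙ count-map _ suc (range (suc j) (length w))

c132≡tc : ∀ w → c132 w ≡ tc w
c132≡tc w = count-triples w _ (λ _ _ _ → refl)

-- Inserting a block into a cell

lift : ℕ → ℕ → ℕ → ℕ
lift v k x = if x <ᵇ v then x else k + x

lift-lo : ∀ v k {x} → x < v → lift v k x ≡ x
lift-lo v k h rewrite <ᵇ-true h = refl

lift-hi : ∀ v k {x} → v ≤ x → lift v k x ≡ k + x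
lift-hi v k h rewrite <ᵇ-false h = refl

lift-cases : ∀ v k x → (x < v × lift v k x ≡ x) ⊎ (v ≤ x × lift v k x ≡ k + x)
lift-cases v k x with x <? v
... | yes h = inj₁ (h , lift-lo v k h)
... | no h = inj₂ (≮⇒≥ h , lift-hi v k (≮⇒≥ h))

lift-mono : ∀ v k {x y} → x < y → lift v k x < lift v k y
lift-mono v k {x} {y} h with lift-cases v k x | lift-cases v k y
... | inj₁ (_ , e) | inj₁ (_ , f) = subst₂ _<_ (sym e) (sym f) h
... | inj₁ (_ , e) | inj₂ (_ , f) = subst₂ _<_ (sym e) (sym f) (≤-trans h (m≤n+m y k))
... | inj₂ (a , e) | inj₁ (b , f) = ⊥-elim (<⇒≱ (<-trans h b) a)
... | inj₂ (_ , e) | inj₂ (_ , f) = subst₂ _<_ (sym e) (sym f) (+-monoʳ-< k h)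

lift-Mono : ∀ v k w → Mono (lift v k) w
lift-Mono v k w _ _ = lift-mono v k

lift-inj : ∀ v k {x y} → lift v k x ≡ lift v k y → x ≡ y
lift-inj v k {x} {y} e with <-cmp x y
... | tri< a _ _ = ⊥-elim (<-irrefl e (lift-mono v k a))
... | tri≈ _ b _ = b
... | tri> _ _ c = ⊥-elim (<-irrefl (sym e) (lift-mono v k c))

lift-<⁻ : ∀ v k {x y} → lift v k x < lift v k y → x < y
lift-<⁻ v k {x} {y} h with <-cmp x y
... | tri< a _ _ = a
... | tri≈ _ refl _ = ⊥-elim (<-irrefl refl h)
... | tri> _ _ c = ⊥-elim (<-asym h (lift-mono v k c))

≤-lift : ∀ v k x → x ≤ lift v k x
≤-lift v k x with lift-cases v k x
... | inj₁ (_ , e) = ≤-reflexive (sym e)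
... | inj₂ (_ , e) = subst (x ≤_) (sym e) (m≤n+m x k)

lift-≤ : ∀ v k x → lift v k x ≤ k + x
lift-≤ v k x with lift-cases v k x
... | inj₁ (_ , e) = subst (_≤ k + x) (sym e) (m≤n+m x k)
... | inj₂ (_ , e) = ≤-reflexive e

lift-lo⁻ : ∀ v k {x} → lift v k x < v + k → x < v
lift-lo⁻ v k {x} h with lift-cases v k x
... | inj₁ (a , _) = a
... | inj₂ (a , e) = ⊥-elim (<⇒≱ (subst (_< v + k) e h) (subst (_≤ k + x) (+-comm k v) (+-monoʳ-≤ k a)))

lift-hi⁻ : ∀ v k {x} → v ≤ lift v k x → v ≤ x
lift-hi⁻ v k {x} h with lift-cases v k x
... | inj₁ (a , e) = ⊥-elim (<⇒≱ a (subst (v ≤_) e h))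
... | inj₂ (a , _) = a

-- Cells still to be filled lie weakly below and weakly to the right of the current one. By this
-- lemma their row threshold survives the insertion, and by the next one their column threshold
-- moves by `k`.
lift-<ᵇˡ : ∀ v k {u} x → u ≤ v → (lift v k x <ᵇ u) ≡ (x <ᵇ u)
lift-<ᵇˡ v k {u} x h with lift-cases v k x
... | inj₁ (_ , e) rewrite e = refl
... | inj₂ (a , e) rewrite e = <ᵇ-false (≤-trans h (≤-trans a (m≤n+m x k))) ⊙ sym (<ᵇ-false (≤-trans h a))

lift-<ᵇʳ : ∀ v k {u} x → v ≤ u → (lift v k x <ᵇ u + k) ≡ (x <ᵇ u)
lift-<ᵇʳ v k {u} x h with lift-cases v k x
... | inj₁ (a , e) rewrite e = <ᵇ-true (≤-trans a (≤-trans h (m≤m+n u k))) ⊙ sym (<ᵇ-true (≤-trans a h))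
... | inj₂ (a , e) rewrite e | +-comm u k = iff⇒≡ (λ t → <ᵇ-true (+-cancelˡ-< k x u (<ᵇ-true⁻ t))) (λ t → <ᵇ-true (+-monoʳ-< k (<ᵇ-true⁻ {x} t)))

Mono-⊆ : ∀ {g w w′} → (∀ {x} → x ∈ w′ → x ∈ w) → Mono g w → Mono g w′
Mono-⊆ s h m n = h (s m) (s n)

std-map : ∀ g w → Mono g w → std (map g w) ≡ std w
std-map g w h = sym (map-∘ w) ⊙ map-cong-∈ w (λ {x} m → count-map (_<ᵇ g x) g w ⊙ count-cong w (λ n → Mono-<ᵇ h n m))

ic-map : ∀ g w → Mono g w → ic (map g w) ≡ ic w
ic-map g [] h = refl
ic-map g (x ∷ w) h = cong₂ _+_ (count-map (_<ᵇ g x) g w ⊙ count-cong w (λ n → Mono-<ᵇ h (there n) (here refl))) (ic-map g w (Mono-⊆ there h))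

tc-map : ∀ g w → Mono g w → tc (map g w) ≡ tc w
tc-map g [] h = refl
tc-map g (x ∷ w) h = cong₂ _+_ (cong ic (filter-map (g x <ᵇ_) g w ⊙ cong (map g) (filter-cong w (λ n → Mono-<ᵇ h (here refl) (there n))))
    ⊙ ic-map g (filterᵇ (x <ᵇ_) w) (Mono-⊆ (λ m → there (proj₁ (∈-filterᵇ⁻ (x <ᵇ_) w m))) h)) (tc-map g w (Mono-⊆ there h))

cross : List ℕ → List ℕ → ℕ
cross us vs = sum (map (λ x → countᵇ (_<ᵇ x) vs) us)

ic-++ : ∀ us vs → ic (us ++ vs) ≡ ic us + cross us vs + ic vs
ic-++ [] vs = refl
ic-++ (x ∷ us) vs = cong₂ _+_ (count-++ (_<ᵇ x) us vs) (ic-++ us vs) ⊙ solve 5 (λ a b c d e → (a :+ b) :+ ((c :+ d) :+ e) := ((a :+ c) :+ (b :+ d)) :+ e) refl (countᵇ (_<ᵇ x) us) (countᵇ (_<ᵇ x) vs) (ic us) (cross us vs) (ic vs)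

cross-const : ∀ us vs c → (∀ {x} → x ∈ us → countᵇ (_<ᵇ x) vs ≡ c) → cross us vs ≡ length us * c
cross-const [] vs c h = refl
cross-const (x ∷ us) vs c h = cong₂ _+_ (h (here refl)) (cross-const us vs c (h ∘ there))

cross-++ʳ : ∀ us vs ws → cross us (vs ++ ws) ≡ cross us vs + cross us ws
cross-++ʳ [] vs ws = refl
cross-++ʳ (x ∷ us) vs ws = cong₂ _+_ (count-++ (_<ᵇ x) vs ws) (cross-++ʳ us vs ws) ⊙
  solve 4 (λ a b c d → (a :+ b) :+ (c :+ d) := (a :+ c) :+ (b :+ d)) refl (countᵇ (_<ᵇ x) vs) (countᵇ (_<ᵇ x) ws) (cross us vs) (cross us ws)

-- For a letter `a` of the block, the larger letters behind the block increase and exceed every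
-- letter of the block. Hence the inversions above `a` and to its right all lie inside the block.
tc-block : ∀ α vs → (∀ {a} → a ∈ α → ic (filterᵇ (a <ᵇ_) vs) ≡ 0) →
  (∀ {a b y} → a ∈ α → b ∈ α → y ∈ vs → a < y → b < y) → tc (α ++ vs) ≡ tc vs + tc α
tc-block [] vs h₁ h₂ = sym (+-identityʳ _)
tc-block (a ∷ α) vs h₁ h₂ = cong₂ _+_ first (tc-block α vs (h₁ ∘ there) (λ m n → h₂ (there m) (there n)))
    ⊙ solve 3 (λ i c d → i :+ (c :+ d) := c :+ (i :+ d)) refl (ic (filterᵇ (a <ᵇ_) α)) (tc vs) (tc α)
  where
  first : ic (filterᵇ (a <ᵇ_) (α ++ vs)) ≡ ic (filterᵇ (a <ᵇ_) α)
  first = cong ic (filter-++ᵇ (a <ᵇ_) α vs) ⊙ ic-++ (filterᵇ (a <ᵇ_) α) (filterᵇ (a <ᵇ_) vs) ⊙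
    cong₂ (λ y z → ic (filterᵇ (a <ᵇ_) α) + y + z)
      (cross-const (filterᵇ (a <ᵇ_) α) (filterᵇ (a <ᵇ_) vs) 0 (λ {x} m → count-none (_<ᵇ x) (filterᵇ (a <ᵇ_) vs) (λ n →
         let n′ , l = ∈-filterᵇ⁻ (a <ᵇ_) vs n in <ᵇ-false (<⇒≤ (h₂ (here refl) (there (proj₁ (∈-filterᵇ⁻ (a <ᵇ_) α m))) n′ (<ᵇ-true⁻ l)))))
        ⊙ *-zeroʳ (length (filterᵇ (a <ᵇ_) α))) (h₁ (here refl)) ⊙ +-identityʳ _ ⊙ +-identityʳ _

-- A letter standing before the block is not smaller than any letter of it, so the block disappears
-- when one filters for letters larger than it.
tc-insert : ∀ us α vs → (∀ {x a} → x ∈ us → a ∈ α → a ≤ x) → (∀ {a} → a ∈ α → ic (filterᵇ (a <ᵇ_) vs) ≡ 0) →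
  (∀ {a b y} → a ∈ α → b ∈ α → y ∈ vs → a < y → b < y) → tc (us ++ α ++ vs) ≡ tc (us ++ vs) + tc α
tc-insert [] α vs h₀ h₁ h₂ = tc-block α vs h₁ h₂
tc-insert (x ∷ us) α vs h₀ h₁ h₂ = cong₂ _+_ (cong ic drop-block) (tc-insert us α vs (h₀ ∘ there) h₁ h₂)
    ⊙ sym (+-assoc (ic (filterᵇ (x <ᵇ_) (us ++ vs))) (tc (us ++ vs)) (tc α))
  where
  p = x <ᵇ_
  drop-block : filterᵇ p (us ++ α ++ vs) ≡ filterᵇ p (us ++ vs)
  drop-block = filter-++ᵇ p us (α ++ vs) ⊙ cong (filterᵇ p us ++_) (filter-++ᵇ p α vs ⊙
    cong (_++ filterᵇ p vs) (filter-none p α (λ m → <ᵇ-false (h₀ (here refl) m)))) ⊙ sym (filter-++ᵇ p us vs)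

AllPairs-map-∈ : ∀ {A : Set} {R S : A → A → Set} {xs} → (∀ {x y} → x ∈ xs → y ∈ xs → R x y → S x y) → AllPairs R xs → AllPairs S xs
AllPairs-map-∈ h [] = []
AllPairs-map-∈ h (a ∷ as) = All.tabulate (λ m → h (here refl) (there m) (All.lookup a m)) ∷ AllPairs-map-∈ (λ m n → h (there m) (there n)) as

ic-sorted : ∀ {w} → AllPairs _<_ w → ic w ≡ 0
ic-sorted [] = refl
ic-sorted {x ∷ w} (a ∷ as) = cong₂ _+_ (count-none (_<ᵇ x) w (λ m → <ᵇ-false (<⇒≤ (All.lookup a m)))) (ic-sorted as)

-- The block α occupies positions p, p+1, … and values v, v+1, …; an entry of w with
-- position q and value x moves to position lift p k q and value lift v k x, k = length α.
insB : ℕ → ℕ → List ℕ → List ℕ → List ℕ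
insB p v α w = map (lift v (length α)) (take p w) ++ map (v +_) α ++ map (lift v (length α)) (drop p w)

-- No entry lies to the lower left of the corner (p , v) and the entries to its upper
-- right increase: then no entry of w forms an occurrence with an entry of the block.
record Feas (w : List ℕ) (p v : ℕ) : Set where
  field
    LL : ∀ {x} → x ∈ w → pos w x < p → v ≤ x
    UR : ∀ {x y} → x ∈ w → y ∈ w → v ≤ x → v ≤ y → p ≤ pos w x → pos w x < pos w y → x < y

∈-take : ∀ {x} p w → x ∈ take p w → x ∈ w × pos w x < p
∈-take {x} (suc p) (y ∷ w) m with y ≡ᵇ x in e
... | true = here (sym (≡ᵇ-true⁻ e)) , s≤s z≤n
∈-take {x} (suc p) (y ∷ w) (here refl) | false = true≢false (≡ᵇ-true {x} refl) e
∈-take {x} (suc p) (y ∷ w) (there m)   | false = let a , b = ∈-take p w m in there a , s≤s b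

∈-drop : ∀ {x} p w → Unique w → x ∈ drop p w → x ∈ w × p ≤ pos w x
∈-drop zero w u m = m , z≤n
∈-drop (suc p) (y ∷ w) (n ∷ u) m = let a , b = ∈-drop p w u m in
  there a , subst (suc p ≤_) (sym (pos-there w (All.lookup n a))) (s≤s b)

take⁻ : ∀ {x} p w → x ∈ w → pos w x < p → x ∈ take p w
take⁻ {x} (suc p) (y ∷ w) m h with y ≡ᵇ x in e
... | true = here (sym (≡ᵇ-true⁻ e))
take⁻ {x} (suc p) (y ∷ w) (here refl) h | false = true≢false (≡ᵇ-true {x} refl) e
take⁻ {x} (suc p) (y ∷ w) (there m) (s≤s h) | false = there (take⁻ p w m h)

drop⁻ : ∀ {x} p w → x ∈ w → p ≤ pos w x → x ∈ drop p w
drop⁻ {x} zero w m h = m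
drop⁻ {x} (suc p) (y ∷ w) m h with y ≡ᵇ x in e
drop⁻ {x} (suc p) (y ∷ w) m () | true
drop⁻ {x} (suc p) (y ∷ w) (here refl) h | false = true≢false (≡ᵇ-true {x} refl) e
drop⁻ {x} (suc p) (y ∷ w) (there m) (s≤s h) | false = drop⁻ p w m h

length-insB : ∀ p v α w → length (insB p v α w) ≡ length w + length α
length-insB p v α w = length-++ (map g (take p w)) ⊙ cong₂ _+_ (length-map g (take p w)) (length-++ (map (v +_) α) ⊙
   cong₂ _+_ (length-map (v +_) α) (length-map g (drop p w))) ⊙
   solve 3 (λ a b c → a :+ (b :+ c) := (a :+ c) :+ b) refl (length (take p w)) (length α) (length (drop p w)) ⊙
   cong (_+ length α) (sym (length-++ (take p w)) ⊙ cong length (take++drop≡id p w))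
  where g = lift v (length α)

count-insB : ∀ (q : ℕ → Bool) p v α w → countᵇ q (insB p v α w) ≡ countᵇ q (map (lift v (length α)) w) + countᵇ q (map (v +_) α)
count-insB q p v α w = count-++ q us (αs ++ vs) ⊙ cong (countᵇ q us +_) (count-++ q αs vs) ⊙
    solve 3 (λ a b c → a :+ (b :+ c) := (a :+ c) :+ b) refl (countᵇ q us) (countᵇ q αs) (countᵇ q vs) ⊙
    cong (_+ countᵇ q αs) (sym (count-++ q us vs) ⊙ cong (countᵇ q) (sym (map-++ g (take p w) (drop p w)) ⊙ cong (map g) (take++drop≡id p w)))
  where
  g = lift v (length α)
  us = map g (take p w)
  αs = map (v +_) α
  vs = map g (drop p w)

module Insertion {w α : List ℕ} (pw : IsPerm w) (pα : IsPerm α) {p v : ℕ} (p≤ : p ≤ length w) where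
  private
    k = length α
    g = lift v k
    us = take p w
    vs = drop p w
    αs = map (v +_) α
    W = insB p v α w
    split : us ++ vs ≡ w
    split = take++drop≡id p w
    uu : Unique (us ++ vs)
    uu = subst Unique (sym split) (proj₁ pw)
    len-us : length us ≡ p
    len-us = length-take p w ⊙ m≤n⇒m⊓n≡m p≤

  data Letter : ℕ → Set where
    old : ∀ {x} → x ∈ w → Letter (g x)
    new : ∀ {a} → a ∈ α → Letter (v + a)

  old∈ : ∀ {x} → x ∈ w → g x ∈ W
  old∈ {x} m with ∈-++⁻ us (subst (x ∈_) (sym split) m)
  ... | inj₁ n = ∈-++⁺ˡ (∈-map⁺ g n)
  ... | inj₂ n = ∈-++⁺ʳ (map g us) (∈-++⁺ʳ αs (∈-map⁺ g n))

  new∈ : ∀ {a} → a ∈ α → v + a ∈ W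
  new∈ m = ∈-++⁺ʳ (map g us) (∈-++⁺ˡ (∈-map⁺ (v +_) m))

  letter : ∀ {z} → z ∈ W → Letter z
  letter m with ∈-++⁻ (map g us) m
  ... | inj₁ n with ∈-map⁻ g n
  ... | x , n′ , refl = old (subst (x ∈_) split (∈-++⁺ˡ n′))
  letter m | inj₂ n with ∈-++⁻ αs n
  ... | inj₁ n′ with ∈-map⁻ (v +_) n′
  ... | a , n″ , refl = new n″
  letter m | inj₂ n | inj₂ n′ with ∈-map⁻ g n′
  ... | x , n″ , refl = old (subst (x ∈_) split (∈-++⁺ʳ us n″))

  new< : ∀ {a} → a ∈ α → v + a < v + k
  new< m = +-monoʳ-< v (proj₂ pα m)

  old≢new : ∀ {x a} → a ∈ α → g x ≡ v + a → ⊥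
  old≢new {x} {a} m e = <⇒≱ (lift-lo⁻ v k {x} (subst (_< v + k) (sym e) (new< m)))
    (lift-hi⁻ v k (subst (v ≤_) (sym e) (m≤m+n v a)))

  pos-new : ∀ {a} → a ∈ α → pos W (v + a) ≡ p + pos α a
  pos-new {a} m = pos-++ʳ (map g us) (αs ++ map g vs) not-us ⊙ cong₂ _+_ (length-map g us ⊙ len-us)
      (pos-++ˡ αs (map g vs) (∈-map⁺ (v +_) m) ⊙ pos-map (v +_) α (λ _ → +-cancelˡ-≡ v _ _))
    where
    not-us : v + a ∉ map g us
    not-us n with ∈-map⁻ g n
    ... | x , _ , e = old≢new m (sym e)

  pos-old : ∀ {x} → x ∈ w → pos W (g x) ≡ lift p k (pos w x)
  pos-old {x} m with ∈-++⁻ us (subst (x ∈_) (sym split) m)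
  ... | inj₁ n = pos-++ˡ (map g us) (αs ++ map g vs) (∈-map⁺ g n) ⊙ pos-map g us (λ _ → lift-inj v k) ⊙
      sym (cong (lift p k) eq ⊙ lift-lo p k (subst (pos us x <_) len-us (pos< n)))
    where
    eq : pos w x ≡ pos us x
    eq = cong (λ z → pos z x) (sym split) ⊙ pos-++ˡ us vs n
  ... | inj₂ n = pos-++ʳ (map g us) (αs ++ map g vs) not-us ⊙ cong₂ _+_ (length-map g us ⊙ len-us) (pos-++ʳ αs (map g vs) not-αs ⊙
       cong₂ _+_ (length-map (v +_) α) (pos-map g vs (λ _ → lift-inj v k))) ⊙
      solve 3 (λ a b c → a :+ (b :+ c) := b :+ (a :+ c)) refl p k (pos vs x) ⊙
      sym (cong (lift p k) eq ⊙ lift-hi p k (m≤m+n p (pos vs x)))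
    where
    x∉us : x ∉ us
    x∉us l = proj₂ (proj₂ (++-Unique⁻ us uu)) l n
    not-us : g x ∉ map g us
    not-us l with ∈-map⁻ g l
    ... | y , l′ , e = x∉us (subst (_∈ us) (sym (lift-inj v k {x} {y} e)) l′)
    not-αs : g x ∉ αs
    not-αs l with ∈-map⁻ (v +_) l
    ... | a , l′ , e = old≢new l′ e
    eq : pos w x ≡ p + pos vs x
    eq = cong (λ z → pos z x) (sym split) ⊙ pos-++ʳ us vs x∉us ⊙ cong (_+ pos vs x) len-us

  pos-new< : ∀ {a} → a ∈ α → pos W (v + a) < p + k
  pos-new< m = subst (_< p + k) (sym (pos-new m)) (+-monoʳ-< p (pos< m))

  perm : v ≤ length w → IsPerm W
  perm v≤ = Unique-++ (Unique-map g (λ _ _ → lift-inj v k) (proj₁ U)) (Unique-++ (Unique-map (v +_) (λ _ _ → +-cancelˡ-≡ v _ _) (proj₁ pα))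
      (Unique-map g (λ _ _ → lift-inj v k) (proj₁ (proj₂ U))) d₂) d₁ , bd
    where
    U = ++-Unique⁻ us uu
    d₂ : ∀ {z} → z ∈ αs → z ∈ map g vs → ⊥
    d₂ m n with ∈-map⁻ (v +_) m | ∈-map⁻ g n
    ... | a , m′ , refl | x , _ , e = old≢new m′ (sym e)
    d₁ : ∀ {z} → z ∈ map g us → z ∈ αs ++ map g vs → ⊥
    d₁ m n with ∈-map⁻ g m | ∈-++⁻ αs n
    ... | x , m′ , refl | inj₁ l with ∈-map⁻ (v +_) l
    ... | a , l′ , e = old≢new l′ e
    d₁ m n | x , m′ , refl | inj₂ l with ∈-map⁻ g l
    ... | y , l′ , e = proj₂ (proj₂ U) m′ (subst (_∈ vs) (sym (lift-inj v k {x} {y} e)) l′)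
    bd : ∀ {z} → z ∈ W → z < length W
    bd m with letter m
    ... | old {x} n = subst (g x <_) (+-comm k _ ⊙ sym (length-insB p v α w)) (≤-<-trans (lift-≤ v k x) (+-monoʳ-< k (proj₂ pw n)))
    ... | new n = subst (_ <_) (sym (length-insB p v α w)) (<-≤-trans (new< n) (+-monoˡ-≤ k v≤))

  before-new : ∀ {x a} → x ∈ w → a ∈ α → pos W (g x) < pos W (v + a) → pos w x < p
  before-new m n h = lift-lo⁻ p k (subst (_< p + k) (pos-old m) (<-trans h (pos-new< n)))

  after-new : ∀ {x a} → x ∈ w → a ∈ α → pos W (v + a) < pos W (g x) → p ≤ pos w x
  after-new {x} {a} m n h = lift-hi⁻ p k (≤-trans (m≤m+n p (pos α a)) (<⇒≤ (subst₂ _<_ (pos-new n) (pos-old m) h)))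

  above-new : ∀ {x a} → v + a < g x → v ≤ x
  above-new {x} {a} h = lift-hi⁻ v k (≤-trans (m≤m+n v a) (<⇒≤ h))

  hi> : ∀ {x a} → v ≤ x → a ∈ α → v + a < g x
  hi> {x} h m = <-≤-trans (new< m) (subst (v + k ≤_) (+-comm x k ⊙ sym (lift-hi v k h)) (+-monoˡ-≤ k h))

  pos-<⁻ : ∀ {x y} → x ∈ w → y ∈ w → pos W (g x) < pos W (g y) → pos w x < pos w y
  pos-<⁻ m n h = lift-<⁻ p k (subst₂ _<_ (pos-old m) (pos-old n) h)

  pos-<⁺ : ∀ {x y} → x ∈ w → y ∈ w → pos w x < pos w y → pos W (g x) < pos W (g y)
  pos-<⁺ m n h = subst₂ _<_ (sym (pos-old m)) (sym (pos-old n)) (lift-mono p k h)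

  module _ (F : Feas w p v) where
    open Feas F

    -- An old letter left of a new one is larger by `LL`, so in a mixed occurrence the 1 is new. A
    -- new 3 then fails because an old 2 above one new letter is above all of them; an old 3 before
    -- a new 2 would stand inside the contiguous block; an old 3 and an old 2 would be a descent to
    -- the upper right, against `UR`.
    Occ-old⊎new : ∀ {a c b} → Occ W a c b → OccImage g w a c b ⊎ Full (_∈ αs) a c b
    Occ-old⊎new (occ ma mc mb p₁ p₂ r s) with letter ma | letter mc | letter mb
    ... | old na | old nc | old nb = inj₁ (image (occ na nc nb (pos-<⁻ na nc p₁) (pos-<⁻ nc nb p₂) (lift-<⁻ v k r) (lift-<⁻ v k s)))
    ... | new na | new nc | new nb = inj₂ (∈-map⁺ (v +_) na , ∈-map⁺ (v +_) nc , ∈-map⁺ (v +_) nb)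
    ... | old na | new nc | _ = ⊥-elim (<-asym (<-trans r s) (hi> (LL na (before-new na nc p₁)) nc))
    ... | old na | old nc | new nb = ⊥-elim (<-asym r (hi> (LL na (before-new na nb (<-trans p₁ p₂))) nb))
    ... | new na | new nc | old nb = ⊥-elim (<-asym s (hi> (above-new r) nc))
    ... | new na | old nc | new nb = ⊥-elim (<⇒≱ (before-new nc nb p₂) (after-new nc na p₁))
    ... | new na | old nc | old nb = ⊥-elim (<-asym s (lift-mono v k (UR nc nb (above-new (<-trans r s)) (above-new r) (after-new nc na p₁) (pos-<⁻ nc nb p₂))))

    occ-old : ∀ {a c b} → Occ (map g w) a c b → Occ W a c b
    occ-old o with Occ-map⁻ (lift-Mono v k w) o
    ... | image (occ ma mc mb p₁ p₂ r s) = occ (old∈ ma) (old∈ mc) (old∈ mb) (pos-<⁺ ma mc p₁) (pos-<⁺ mc mb p₂) (lift-mono v k r) (lift-mono v k s)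

    -- As no occurrence mixes old and new letters, the block cannot attach itself to the component;
    -- and every occurrence of `w` survives, so the component does not fall apart.
    Ker-insB : ∀ {M κ} → Ker M w κ → Ker (g M) W (map g κ)
    Ker-insB {M} {κ} K = record { mark = K′.mark ; sub = sub ; top = K′.top ; closed = clo
        ; least = λ Q q c → K′.least Q q (λ o → c (occ-old o)) }
      where
      module K = Ker K
      module K′ = Ker (Ker-map (lift-Mono v k w) K)
      not-new : ∀ {z} → z ∈ αs → z ∈ map g κ → ⊥
      not-new m n with ∈-map⁻ (v +_) m | ∈-map⁻ g n
      ... | a , m′ , refl | x , _ , e = old≢new m′ (sym e)
      sub : map g κ ≡ filterᵇ K′.mark W
      sub = K′.sub ⊙ cong (filterᵇ K′.mark) (cong (map g) (sym split) ⊙ map-++ g us vs) ⊙ filter-++ᵇ K′.mark (map g us) (map g vs) ⊙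
        sym (filter-++ᵇ K′.mark (map g us) (αs ++ map g vs) ⊙ cong (filterᵇ K′.mark (map g us) ++_) (filter-++ᵇ K′.mark αs (map g vs) ⊙
          cong (_++ filterᵇ K′.mark (map g vs)) (filter-none K′.mark αs (λ {z} m → memb-false {z} (map g κ) (not-new m)))))
      clo : Closed W (_∈ map g κ)
      clo o t with Occ-old⊎new o
      ... | inj₁ (image o′) = K′.closed (Occ-map (lift-Mono v k w) o′) t
      clo o (inj₁ m) | inj₂ (a , c , b) = ⊥-elim (not-new a m)
      clo o (inj₂ (inj₁ m)) | inj₂ (a , c , b) = ⊥-elim (not-new c m)
      clo o (inj₂ (inj₂ m)) | inj₂ (a , c , b) = ⊥-elim (not-new b m)

    LL′ : ∀ {x} → x ∈ us → v ≤ x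
    LL′ m = let a , b = ∈-take p w m in LL a b

    c132-insB : c132 W ≡ c132 w + c132 α
    c132-insB = c132≡tc W ⊙ tc-insert (map g us) αs (map g vs) h₀ h₁ h₂ ⊙
        cong₂ _+_ (cong tc (sym (map-++ g us vs) ⊙ cong (map g) split) ⊙ tc-map g w (lift-Mono v k w) ⊙ sym (c132≡tc w))
                  (tc-map (v +_) α (λ _ _ → +-monoʳ-< v) ⊙ sym (c132≡tc α))
      where
      h₀ : ∀ {x a} → x ∈ map g us → a ∈ αs → a ≤ x
      h₀ m n with ∈-map⁻ g m | ∈-map⁻ (v +_) n
      ... | x , m′ , refl | a , n′ , refl = <⇒≤ (hi> (LL′ m′) n′)
      h₁ : ∀ {a} → a ∈ αs → ic (filterᵇ (a <ᵇ_) (map g vs)) ≡ 0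
      h₁ m with ∈-map⁻ (v +_) m
      ... | a , m′ , refl = cong ic (filter-map (v + a <ᵇ_) g vs) ⊙ ic-map g _ (lift-Mono v k (filterᵇ (λ z → v + a <ᵇ g z) vs)) ⊙ ic-sorted (AllPairs-map-∈ inc
             (APP.filter⁺ _ (APP.drop⁺ p (pos-sorted (proj₁ pw)))))
        where
        inc : ∀ {x y} → x ∈ filterᵇ (λ z → v + a <ᵇ g z) vs → y ∈ filterᵇ (λ z → v + a <ᵇ g z) vs → pos w x < pos w y → x < y
        inc {x} {y} mx my h = let nx , ex = ∈-filterᵇ⁻ (λ z → v + a <ᵇ g z) vs mx ; ny , ey = ∈-filterᵇ⁻ (λ z → v + a <ᵇ g z) vs my
                                  wx , px = ∈-drop p w (proj₁ pw) nx ; wy , _ = ∈-drop p w (proj₁ pw) ny in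
          UR wx wy (above-new {x} {a} (<ᵇ-true⁻ ex)) (above-new {y} {a} (<ᵇ-true⁻ ey)) px h
      h₂ : ∀ {a b y} → a ∈ αs → b ∈ αs → y ∈ map g vs → a < y → b < y
      h₂ m n l h with ∈-map⁻ (v +_) m | ∈-map⁻ (v +_) n | ∈-map⁻ g l
      ... | a , m′ , refl | b , n′ , refl | y , l′ , refl = hi> (above-new {y} {a} h) n′

    -- The `p` letters before the block are all above it, hence the `v` letters below it all stand
    -- behind it. So each of the `k` new letters forms `p + v` inversions with old ones.
    inv-insB : v ≤ length w → inv W ≡ inv w + inv α + k * (p + v)
    inv-insB v≤ = inv≡ic W ⊙ ic-++ (map g us) (αs ++ map g vs) ⊙
        cong₂ (λ y z → ic (map g us) + y + z) (cross-++ʳ (map g us) αs (map g vs)) (ic-++ αs (map g vs)) ⊙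
        cong₂ (λ y z → ic (map g us) + (y + cross (map g us) (map g vs)) + (ic αs + z + ic (map g vs)))
          (cross-const (map g us) αs k above ⊙ cong (_* k) (length-map g us ⊙ len-us))
          (cross-const αs (map g vs) v below ⊙ cong (_* v) (length-map (v +_) α)) ⊙
        solve 7 (λ a p k c i v b → a :+ (p :* k :+ c) :+ (i :+ k :* v :+ b) := a :+ c :+ b :+ i :+ k :* (p :+ v)) refl
          (ic (map g us)) p k (cross (map g us) (map g vs)) (ic αs) v (ic (map g vs)) ⊙
        cong₂ (λ y z → y + z + k * (p + v))
          (sym (ic-++ (map g us) (map g vs)) ⊙ cong ic (sym (map-++ g us vs) ⊙ cong (map g) split) ⊙ ic-map g w (lift-Mono v k w) ⊙ sym (inv≡ic w))
          (ic-map (v +_) α (λ _ _ → +-monoʳ-< v) ⊙ sym (inv≡ic α))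
      where
      above : ∀ {x} → x ∈ map g us → countᵇ (_<ᵇ x) αs ≡ k
      above m with ∈-map⁻ g m
      ... | x , m′ , refl = count-all (_<ᵇ g x) αs le ⊙ length-map (v +_) α
        where
        le : ∀ {z} → z ∈ αs → (z <ᵇ g x) ≡ true
        le n with ∈-map⁻ (v +_) n
        ... | a , n′ , refl = <ᵇ-true (hi> (LL′ m′) n′)
      below : ∀ {x} → x ∈ αs → countᵇ (_<ᵇ x) (map g vs) ≡ v
      below m with ∈-map⁻ (v +_) m
      ... | a , m′ , refl = count-map (_<ᵇ (v + a)) g vs ⊙ count-cong vs (λ {y} _ → same y) ⊙
             sym (sym (count-<-perm pw v≤) ⊙ cong (countᵇ (_<ᵇ v)) (sym split) ⊙ count-++ (_<ᵇ v) us vs ⊙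
                  cong (_+ countᵇ (_<ᵇ v) vs) (count-none (_<ᵇ v) us (λ n → <ᵇ-false (LL′ n))))
        where
        same : ∀ y → (g y <ᵇ v + a) ≡ (y <ᵇ v)
        same y = iff⇒≡ (λ e → <ᵇ-true (lift-lo⁻ v k (<-trans (<ᵇ-true⁻ e) (new< m′))))
                       (λ e → <ᵇ-true (subst (_< v + a) (sym (lift-lo v k {y} (<ᵇ-true⁻ {y} e))) (<-≤-trans (<ᵇ-true⁻ {y} e) (m≤m+n v a))))

  -- Seen from a corner further down and to the right, the whole block lies to the upper left, the
  -- quadrant about which `Feas` says nothing.
  Feas-insB : ∀ {p₂ v₂} → Feas w p₂ v₂ → p ≤ p₂ → v₂ ≤ v → Feas W (p₂ + k) v₂
  Feas-insB {p₂} {v₂} F le ge = record { LL = ll ; UR = ur }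
    where
    open Feas F
    ll : ∀ {z} → z ∈ W → pos W z < p₂ + k → v₂ ≤ z
    ll m h with letter m
    ... | new {a} n = ≤-trans ge (m≤m+n v a)
    ... | old {x} n = ≤-trans (LL n (<ᵇ-true⁻ (sym (lift-<ᵇʳ p k (pos w x) le) ⊙ <ᵇ-true (subst (_< p₂ + k) (pos-old n) h)))) (≤-lift v k x)
    low : ∀ {x} → v₂ ≤ g x → v₂ ≤ x
    low {x} h = <ᵇ-false⁻ (sym (lift-<ᵇˡ v k x ge) ⊙ <ᵇ-false h)
    right : ∀ {x} → x ∈ w → p₂ + k ≤ pos W (g x) → p₂ ≤ pos w x
    right {x} n h = <ᵇ-false⁻ (sym (lift-<ᵇʳ p k (pos w x) le) ⊙ <ᵇ-false (subst (p₂ + k ≤_) (pos-old n) h))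
    ur : ∀ {x y} → x ∈ W → y ∈ W → v₂ ≤ x → v₂ ≤ y → p₂ + k ≤ pos W x → pos W x < pos W y → x < y
    ur mx my hx hy px h with letter mx | letter my
    ... | new n | _ = ⊥-elim (<⇒≱ (<-≤-trans (pos-new< n) (+-monoˡ-≤ k le)) px)
    ... | old _ | new n = ⊥-elim (<⇒≱ (<-≤-trans (pos-new< n) (+-monoˡ-≤ k le)) (<⇒≤ (≤-<-trans px h)))
    ... | old n | old n′ = lift-mono v k (UR n n′ (low hx) (low hy) (right n px) (pos-<⁻ n n′ h))

-- Cells and their successive filling

Cell : Set
Cell = ℕ × ℕ

-- Cells are read off the two coordinates of an entry relative to the kernel letters κ:
-- how many are smaller and how many stand to the left.
rk : List ℕ → ℕ → ℕ
rk κ x = countᵇ (_<ᵇ x) κ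

lf : List ℕ → List ℕ → ℕ → ℕ
lf w κ x = countᵇ (λ y → pos w y <ᵇ x) κ

ceq : Cell → Cell → Bool
ceq (m , l) (m′ , l′) = (m ≡ᵇ m′) ∧ (l ≡ᵇ l′)

cellOf : List ℕ → List ℕ → ℕ → Cell
cellOf w κ x = suc (rk κ x) , suc (lf w κ (pos w x))

inCell : List ℕ → List ℕ → Cell → ℕ → Bool
inCell w κ c x = not (memb x κ) ∧ ceq (cellOf w κ x) c

csize : List ℕ → List ℕ → Cell → ℕ
csize w κ c = countᵇ (inCell w κ c) w

ceq-refl : ∀ c → ceq c c ≡ true
ceq-refl (m , l) = ∧-true (≡ᵇ-true {m} refl) (≡ᵇ-true {l} refl)

ceq-true⁻ : ∀ {c d} → ceq c d ≡ true → c ≡ d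
ceq-true⁻ {m , l} {m′ , l′} h = let a , b = ∧-true⁻ {m ≡ᵇ m′} h in cong₂ _,_ (≡ᵇ-true⁻ a) (≡ᵇ-true⁻ b)

ceq-false : ∀ {c d} → c ≢ d → ceq c d ≡ false
ceq-false {c} {d} h = ≢true⇒false (λ t → h (ceq-true⁻ {c} {d} t))

sizeAt : Cell → List Cell → List (List ℕ) → ℕ
sizeAt c (d ∷ cs) (α ∷ αs) = (if ceq d c then length α else 0) + sizeAt c cs αs
sizeAt c _ _ = 0

module _ {w α : List ℕ} (pw : IsPerm w) (pα : IsPerm α) {p v : ℕ} (p≤ : p ≤ length w) where
  private
    k = length α
    g = lift v k
    W = insB p v α w
    module I = Insertion pw pα {p} {v} p≤

  -- Old entries keep their order relative to the kernel letters, hence their cells. A new entry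
  -- sees below it the kernel letters below `v`, and to its left those before position `p`.
  csize-insB : ∀ {κ} → (∀ {x} → x ∈ κ → x ∈ w) → ∀ c →
    csize W (map g κ) c ≡ csize w κ c + (if ceq (suc (rk κ v) , suc (lf w κ p)) c then k else 0)
  csize-insB {κ} s c = count-insB (inCell W (map g κ) c) p v α w ⊙ cong₂ _+_
       (count-map (inCell W (map g κ) c) g w ⊙ count-cong w old)
       (count-map (inCell W (map g κ) c) (v +_) α ⊙ count-cong α new ⊙ const _)
    where
    old : ∀ {x} → x ∈ w → inCell W (map g κ) c (g x) ≡ inCell w κ c x
    old {x} m = cong₂ _∧_ (cong not (iff⇒≡ (λ t → memb-true {x} (memb-map (lift-Mono v k w) s m (memb-true⁻ (map g κ) t)))
                                          (λ t → memb-true {g x} (∈-map⁺ g (memb-true⁻ κ t)))))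
      (cong₂ (λ y z → ceq (suc y , suc z) c)
        (count-map (_<ᵇ g x) g κ ⊙ count-cong κ (λ n → Mono-<ᵇ (lift-Mono v k w) (s n) m))
        (count-map (λ y → pos W y <ᵇ pos W (g x)) g κ ⊙ count-cong κ (λ n →
          iff⇒≡ (λ t → <ᵇ-true (I.pos-<⁻ (s n) m (<ᵇ-true⁻ t))) (λ t → <ᵇ-true (I.pos-<⁺ (s n) m (<ᵇ-true⁻ t))))))
    new : ∀ {a} → a ∈ α → inCell W (map g κ) c (v + a) ≡ ceq (suc (rk κ v) , suc (lf w κ p)) c
    new {a} m = cong₂ _∧_ (cong not (memb-false {v + a} (map g κ) out))
      (cong₂ (λ y z → ceq (suc y , suc z) c)
        (count-map (_<ᵇ v + a) g κ ⊙ count-cong κ (λ {x} _ → iff⇒≡ (λ t → <ᵇ-true (lift-lo⁻ v k (<-trans (<ᵇ-true⁻ t) (I.new< m))))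
            (λ t → <ᵇ-true (subst (_< v + a) (sym (lift-lo v k {x} (<ᵇ-true⁻ {x} t))) (<-≤-trans (<ᵇ-true⁻ {x} t) (m≤m+n v a))))))
        (count-map (λ y → pos W y <ᵇ pos W (v + a)) g κ ⊙ count-cong κ (λ {x} n → cong₂ _<ᵇ_ (I.pos-old (s n)) (I.pos-new m) ⊙
          iff⇒≡ (λ t → <ᵇ-true (lift-lo⁻ p k (<-trans (<ᵇ-true⁻ t) (+-monoʳ-< p (pos< m)))))
            (λ t → <ᵇ-true (subst (_< p + pos α a) (sym (lift-lo p k {pos w x} (<ᵇ-true⁻ {pos w x} t))) (<-≤-trans (<ᵇ-true⁻ {pos w x} t) (m≤m+n p (pos α a))))))))
      where
      out : v + a ∉ map g κ
      out n with ∈-map⁻ g n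
      ... | x , _ , eq = I.old≢new m (sym eq)
    const : ∀ b → countᵇ (λ _ → b) α ≡ (if b then k else 0)
    const true  = count-all (λ _ → true) α (λ _ → refl)
    const false = count-none (λ _ → false) α (λ _ → refl)

-- Fills the cells in the order ≺; earlier blocks, N entries in all, lie to the upper
-- left of the current cell, hence shift its column but not its row.
asm : List ℕ → ℕ → List Cell → List (List ℕ) → List ℕ
asm w N ((m , l) ∷ cs) (α ∷ αs) = asm (insB (l ∸ 1 + N) (m ∸ 1) α w) (N + length α) cs αs
asm w N _ _ = w

-- The invariant of a cell still to be filled when `N` entries have been placed: its corner is at
-- position `l - 1 + N` and value `m - 1`. The last two fields say that this corner still belongs to
-- the cell `(m , l)` with respect to the kernel letters.
record Slot (w κ : List ℕ) (N : ℕ) (c : Cell) : Set where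
  field
    m≥1 : 1 ≤ proj₁ c
    l≥1 : 1 ≤ proj₂ c
    p≤  : proj₂ c ∸ 1 + N ≤ length w
    v<  : proj₁ c ∸ 1 < length w
    feas : Feas w (proj₂ c ∸ 1 + N) (proj₁ c ∸ 1)
    rk≡ : rk κ (proj₁ c ∸ 1) ≡ proj₁ c ∸ 1
    lf≡ : lf w κ (proj₂ c ∸ 1 + N) ≡ proj₂ c ∸ 1

_≼_ : Cell → Cell → Set
(m , l) ≼ (m′ , l′) = m′ ≤ m × l ≤ l′

Slot-step : ∀ {w κ N c d α} → IsPerm w → IsPerm α → (∀ {x} → x ∈ κ → x ∈ w) → Slot w κ N c → c ≼ d → Slot w κ N d →
  Slot (insB (proj₂ c ∸ 1 + N) (proj₁ c ∸ 1) α w) (map (lift (proj₁ c ∸ 1) (length α)) κ) (N + length α) d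
Slot-step {w} {κ} {N} {c} {d} {α} pw pα s C (ge , le) D = record
  { m≥1 = D.m≥1 ; l≥1 = D.l≥1
  ; p≤ = subst₂ _≤_ assoc (sym (length-insB p v α w)) (+-monoˡ-≤ k D.p≤)
  ; v< = subst (proj₁ d ∸ 1 <_) (sym (length-insB p v α w)) (<-≤-trans D.v< (m≤m+n _ k))
  ; feas = subst (λ z → Feas W z (proj₁ d ∸ 1)) assoc (I.Feas-insB D.feas p≤p₂ v₂≤v)
  ; rk≡ = count-map (_<ᵇ (proj₁ d ∸ 1)) g κ ⊙ count-cong κ (λ {x} _ → lift-<ᵇˡ v k x v₂≤v) ⊙ D.rk≡
  ; lf≡ = cong (lf W (map g κ)) (sym assoc) ⊙ count-map (λ y → pos W y <ᵇ p₂ + k) g κ ⊙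
      count-cong κ (λ {x} n → cong (_<ᵇ p₂ + k) (I.pos-old (s n)) ⊙ lift-<ᵇʳ p k (pos w x) p≤p₂) ⊙ D.lf≡ }
  where
  module C = Slot C
  module D = Slot D
  p = proj₂ c ∸ 1 + N
  v = proj₁ c ∸ 1
  p₂ = proj₂ d ∸ 1 + N
  k = length α
  g = lift v k
  W = insB p v α w
  module I = Insertion pw pα {p} {v} C.p≤
  p≤p₂ : p ≤ p₂
  p≤p₂ = +-monoˡ-≤ N (∸-monoˡ-≤ 1 le)
  v₂≤v : proj₁ d ∸ 1 ≤ v
  v₂≤v = ∸-monoˡ-≤ 1 ge
  assoc : p₂ + k ≡ proj₂ d ∸ 1 + (N + k)
  assoc = +-assoc (proj₂ d ∸ 1) N k

-- The inversions that a block forms with the kernel and with earlier blocks.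
crossSum : ℕ → List Cell → List (List ℕ) → ℕ
crossSum N ((m , l) ∷ cs) (α ∷ αs) = length α * (l ∸ 1 + N + (m ∸ 1)) + crossSum (N + length α) cs αs
crossSum N _ _ = 0

sumBy : (List ℕ → ℕ) → List (List ℕ) → ℕ
sumBy h αs = sum (map h αs)

record Assembled (w κ : List ℕ) (N : ℕ) (cs : List Cell) (αs : List (List ℕ)) (W : List ℕ) : Set₁ where
  field
    perm : IsPerm W
    len  : length W ≡ length w + sumBy length αs
    {κ′} : List ℕ
    ker  : Ker (length W ∸ 1) W κ′
    shp  : std κ′ ≡ std κ
    c≡   : c132 W ≡ c132 w + sumBy c132 αs
    inv≡ : inv W ≡ inv w + sumBy inv αs + crossSum N cs αs
    -- Makes the block sizes visible in the assembled word and its kernel; injectivity of the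
    -- construction rests on this field.
    csz  : ∀ c → csize W κ′ c ≡ csize w κ c + sizeAt c cs αs

assemble : ∀ {w κ N} cs αs → IsPerm w → 0 < length w → Ker (length w ∸ 1) w κ → All (Slot w κ N) cs → AllPairs _≼_ cs →
  All IsPerm αs → length αs ≡ length cs → Assembled w κ N cs αs (asm w N cs αs)
assemble {w} {κ} [] [] pw nz K _ _ _ _ = record { perm = pw ; len = sym (+-identityʳ _) ; ker = K ; shp = refl
  ; c≡ = sym (+-identityʳ _) ; inv≡ = sym (+-identityʳ _ ⊙ +-identityʳ _) ; csz = λ c → sym (+-identityʳ _) }
assemble {w} {κ} {N} (c@(m , l) ∷ cs) (α ∷ αs) pw nz K (S ∷ Ss) (h ∷ hs) (pα ∷ pαs) e = record
  { perm = R.perm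
  ; len = R.len ⊙ cong (_+ sumBy length αs) (length-insB p v α w) ⊙ +-assoc (length w) k _
  ; ker = R.ker
  ; shp = R.shp ⊙ std-map g κ (lift-Mono v k κ)
  ; c≡ = R.c≡ ⊙ cong (_+ sumBy c132 αs) (I.c132-insB S.feas) ⊙ +-assoc (c132 w) (c132 α) _
  ; inv≡ = R.inv≡ ⊙ cong (λ z → z + sumBy inv αs + crossSum (N + k) cs αs) (I.inv-insB S.feas (<⇒≤ S.v<)) ⊙
      solve 5 (λ a b c d x → a :+ b :+ c :+ d :+ x := a :+ (b :+ d) :+ (c :+ x)) refl (inv w) (inv α) (k * (p + v)) (sumBy inv αs) (crossSum (N + k) cs αs)
  ; csz = λ d → R.csz d ⊙ cong (_+ sizeAt d cs αs) (csize-insB pw pα S.p≤ (Ker.∈w K) d ⊙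
       cong (λ z → csize w κ d + (if ceq z d then k else 0)) (cong₂ _,_ (cong suc S.rk≡ ⊙ m+[n∸m]≡n S.m≥1) (cong suc S.lf≡ ⊙ m+[n∸m]≡n S.l≥1))) ⊙
       +-assoc (csize w κ d) _ _ }
  where
  module S = Slot S
  p = l ∸ 1 + N
  v = m ∸ 1
  k = length α
  g = lift v k
  W = insB p v α w
  module I = Insertion pw pα {p} {v} S.p≤
  -- No cell lies above the maximum, so the gap opens at or below it; the maximum moves up by `k`
  -- and is again the largest value.
  top : g (length w ∸ 1) ≡ length W ∸ 1
  top = lift-hi v k (<⇒≤pred S.v<) ⊙ sym (+-∸-assoc k nz) ⊙ cong (_∸ 1) (+-comm k (length w) ⊙ sym (length-insB p v α w))
  steps : ∀ {ds} → All (c ≼_) ds → All (Slot w κ N) ds → All (Slot W (map g κ) (N + k)) ds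
  steps [] [] = []
  steps (o ∷ os) (D ∷ Ds) = Slot-step pw pα (Ker.∈w K) S o D ∷ steps os Ds
  module R = Assembled (assemble {W} {map g κ} {N + k} cs αs (I.perm (<⇒≤ S.v<)) (subst (0 <_) (sym (length-insB p v α w)) (≤-trans nz (m≤m+n _ k)))
    (subst (λ z → Ker z W (map g κ)) top (I.Ker-insB S.feas K)) (steps h Ss) hs pαs (suc-injective e))

-- Recovering the blocks from the assembled word

++-cancel-length : ∀ {A : Set} (xs ys : List A) {us vs} → length xs ≡ length ys → xs ++ us ≡ ys ++ vs → xs ≡ ys × us ≡ vs
++-cancel-length [] [] l e = refl , e
++-cancel-length (x ∷ xs) (y ∷ ys) l e = let a , b = ++-cancel-length xs ys (suc-injective l) (∷-injectiveʳ e)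
  in cong₂ _∷_ (∷-injectiveˡ e) a , b

insB-injective : ∀ p v α β w w′ → length α ≡ length β → length w ≡ length w′ → insB p v α w ≡ insB p v β w′ → α ≡ β × w ≡ w′
insB-injective p v α β w w′ lα lw e = map-injective (+-cancelˡ-≡ v _ _) e₂ ,
   (sym (take++drop≡id p w) ⊙ cong₂ _++_ (map-injective (lift-inj v k) e₁) (map-injective (lift-inj v k) e₃) ⊙ take++drop≡id p w′)
  where
  k = length β
  us = map (lift v k) (take p w)
  us′ = map (lift v k) (take p w′)
  eq : us ++ map (v +_) α ++ map (lift v k) (drop p w) ≡ insB p v β w′
  eq = cong (λ z → map (lift v z) (take p w) ++ map (v +_) α ++ map (lift v z) (drop p w)) (sym lα) ⊙ e
  split₁ = ++-cancel-length us us′ (length-map _ (take p w) ⊙ length-take p w ⊙ cong (p ⊓_) lw ⊙ sym (length-map _ (take p w′) ⊙ length-take p w′)) eq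
  split₂ = ++-cancel-length (map (v +_) α) (map (v +_) β) (length-map _ α ⊙ lα ⊙ sym (length-map _ β)) (proj₂ split₁)
  e₁ = proj₁ split₁
  e₂ = proj₁ split₂
  e₃ = proj₂ split₂

-- The insertion points depend on the lengths of the blocks alone. With equal lengths both sides
-- undo the same insertions, the last one first.
asm-injective : ∀ {N} cs αs βs {w w′} → length αs ≡ length cs → map length αs ≡ map length βs → length w ≡ length w′ →
  asm w N cs αs ≡ asm w′ N cs βs → αs ≡ βs × w ≡ w′
asm-injective [] [] [] _ _ lw e = refl , e
asm-injective {N} ((m , l) ∷ cs) (α ∷ αs) (β ∷ βs) {w} {w′} h ls lw e
  with asm-injective {N + length α} cs αs βs (suc-injective h) (∷-injectiveʳ ls)
    (length-insB (l ∸ 1 + N) (m ∸ 1) α w ⊙ cong₂ _+_ lw (∷-injectiveˡ ls) ⊙ sym (length-insB (l ∸ 1 + N) (m ∸ 1) β w′))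
    (e ⊙ cong (λ z → asm (insB (l ∸ 1 + N) (m ∸ 1) β w′) (N + z) cs βs) (sym (∷-injectiveˡ ls)))
... | e₁ , e₂ with insB-injective (l ∸ 1 + N) (m ∸ 1) α β w w′ (∷-injectiveˡ ls) lw e₂
... | e₃ , e₄ = cong₂ _∷_ e₃ e₁ , e₄

sizeAt-∉ : ∀ c cs αs → c ∉ cs → sizeAt c cs αs ≡ 0
sizeAt-∉ c [] αs h = refl
sizeAt-∉ c (d ∷ cs) [] h = refl
sizeAt-∉ c (d ∷ cs) (α ∷ αs) h rewrite ceq-false {d} {c} (λ t → h (here (sym t))) = sizeAt-∉ c cs αs (h ∘ there)

-- The cells are distinct, so `sizeAt` at a cell is the length of the one block placed there.
sizeAt-determines : ∀ cs αs βs → Unique cs → length αs ≡ length cs → length βs ≡ length cs →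
  (∀ {c} → c ∈ cs → sizeAt c cs αs ≡ sizeAt c cs βs) → map length αs ≡ map length βs
sizeAt-determines [] [] [] u _ _ h = refl
sizeAt-determines (c ∷ cs) (α ∷ αs) (β ∷ βs) (n ∷ u) la lb h = cong₂ _∷_ first
    (sizeAt-determines cs αs βs u (suc-injective la) (suc-injective lb) rest)
  where
  c∉ : c ∉ cs
  c∉ m = All.lookup n m refl
  first : length α ≡ length β
  first with h (here refl)
  ... | q rewrite ceq-refl c | sizeAt-∉ c cs αs c∉ | sizeAt-∉ c cs βs c∉ = sym (+-identityʳ _) ⊙ q ⊙ +-identityʳ _
  rest : ∀ {d} → d ∈ cs → sizeAt d cs αs ≡ sizeAt d cs βs
  rest {d} m with h (there m)
  ... | q rewrite ceq-false {c} {d} (λ t → c∉ (subst (_∈ cs) (sym t) m)) = q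

-- Feasible cells of a kernel permutation

-- Formulated so as to cover two situations: a point inserted into a cell that passes the
-- infeasibility test, and an entry of a permutation outside its kernel. The hypotheses forbid `y`
-- to play the 1, the 3 and the 2 with two letters of `κ`; `connected` is induction along the
-- occurrences inside `κ`.
module LowerLeft {w κ : List ℕ} {y M : ℕ} (y∈ : y ∈ w) (y∉ : y ∉ κ) (sub : ∀ {x} → x ∈ κ → x ∈ w) (y<M : y < M)
  (n₁ : ∀ {c b} → c ∈ κ → b ∈ κ → Occ w y c b → ⊥)
  (n₂ : ∀ {a b} → a ∈ κ → b ∈ κ → Occ w a y b → ⊥)
  (n₃ : ∀ {a c} → a ∈ κ → c ∈ κ → Occ w a c y → ⊥)
  (connected : (Q : ℕ → Set) → Q M → (∀ {a c b} → Full (_∈ κ) a c b → Occ w a c b → Touch Q a c b → Full Q a c b) →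
     ∀ {x} → x ∈ κ → Q x) where

  private
    ≢y : ∀ {x} → x ∈ κ → x ≢ y
    ≢y m refl = y∉ m

    Q : ℕ → Set
    Q z = pos w z < pos w y → y < z

    clash : ∀ {z} → Q z → pos w z < pos w y → z < y → ⊥
    clash q p l = <-asym l (q p)

    -- An occurrence whose smallest entry is below and to the left of y lies
    -- there completely, and otherwise it has no entry there.
    closed : ∀ {a c b} → Full (_∈ κ) a c b → Occ w a c b → Touch Q a c b → Full Q a c b
    closed {a} {c} {b} (ma , mc , mb) o@(occ wa wc wb p q r s) t with pos-total wa y∈ (≢y ma) | <-cmp a y
    ... | inj₂ h | _ = (λ l → ⊥-elim (<-asym h l)) , (λ l → ⊥-elim (<-asym (<-trans h p) l)) , (λ l → ⊥-elim (<-asym (<-trans h (<-trans p q)) l))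
    ... | inj₁ _ | tri> _ _ h = (λ _ → h) , (λ _ → <-trans h (Occ.a<c o)) , (λ _ → <-trans h r)
    ... | inj₁ _ | tri≈ _ h _ = ⊥-elim (≢y ma h)
    ... | inj₁ h | tri< a<y _ _ with pos-total wc y∈ (≢y mc) | pos-total wb y∈ (≢y mb) | <-cmp c y | <-cmp b y
    ... | _ | _ | tri≈ _ e _ | _ = ⊥-elim (≢y mc e)
    ... | _ | _ | _ | tri≈ _ e _ = ⊥-elim (≢y mb e)
    ... | inj₁ k | _ | tri> _ _ y<c | _ = ⊥-elim (n₃ ma mc (occ wa wc y∈ p k a<y y<c))
    ... | inj₁ k | inj₂ k′ | tri< c<y _ _ | _ = ⊥-elim (n₂ ma mb (occ wa y∈ wb h k′ r (<-trans s c<y)))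
    ... | inj₂ k | _ | _ | tri< b<y _ _ = ⊥-elim (n₂ ma mb (occ wa y∈ wb h (<-trans k q) r b<y))
    ... | inj₂ k | _ | _ | tri> _ _ y<b = ⊥-elim (n₁ mc mb (occ y∈ wc wb k q y<b s))
    ... | inj₁ k | inj₁ k′ | tri< c<y _ _ | _ = ⊥-elim (none t)
      where
      none : Touch Q a c b → ⊥
      none (inj₁ x) = clash x h a<y
      none (inj₂ (inj₁ x)) = clash x k c<y
      none (inj₂ (inj₂ x)) = clash x k′ (<-trans s c<y)

  lower-left-empty : ∀ {x} → x ∈ κ → pos w x < pos w y → y < x
  lower-left-empty m = connected Q (λ _ → y<M) closed m

  upper-right-increasing : ∀ {x z} → x ∈ κ → z ∈ κ → y < x → y < z → pos w y < pos w x → pos w x < pos w z → x < z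
  upper-right-increasing {x} {z} mx mz hx hz p q with <-cmp x z
  ... | tri< h _ _ = h
  ... | tri≈ _ refl _ = ⊥-elim (<-irrefl refl q)
  ... | tri> _ _ h = ⊥-elim (n₁ mx mz (occ y∈ (sub mx) (sub mz) p q hz h))

-- The infeasibility test as the insertion of a single letter

at-map : ∀ (φ : ℕ → ℕ) {i} w → i < length w → at (map φ w) i ≡ φ (at w i)
at-map φ {zero} (x ∷ w) h = refl
at-map φ {suc i} (x ∷ w) (s≤s h) = at-map φ w h

∈-triples : ∀ {n i j k} → (i , j , k) ∈ triples n → i < n × j < n × k < n
∈-triples {n} m with ∈-concatMap⁻′ _ (upTo n) m
... | i , mi , m₂ with ∈-concatMap⁻′ _ (range (suc i) n) m₂
... | j , mj , m₃ with ∈-map⁻ _ m₃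
... | k , mk , refl = ∈-upTo⁻ mi , proj₂ (∈-range⁻ {suc i} mj) , proj₂ (∈-range⁻ {suc j} mk)

occ132-map : ∀ φ w → Mono φ w → occ132 (map φ w) ≡ occ132 w
occ132-map φ w h rewrite length-map φ w = filter-cong (triples (length w)) λ { {i , j , k} m → same m }
  where
  same : ∀ {i j k} → (i , j , k) ∈ triples (length w) →
    ((at (map φ w) i <ᵇ at (map φ w) k) ∧ (at (map φ w) k <ᵇ at (map φ w) j)) ≡ ((at w i <ᵇ at w k) ∧ (at w k <ᵇ at w j))
  same m with ∈-triples m
  ... | i< , j< , k< rewrite at-map φ w i< | at-map φ w j< | at-map φ w k< =
    cong₂ _∧_ (Mono-<ᵇ h (at∈ w i<) (at∈ w k<)) (Mono-<ᵇ h (at∈ w k<) (at∈ w j<))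

-- The order isomorphism from insB p v [0] ρ to the doubled word insertCell ρ (v+1) (p+1).
double : ℕ → ℕ → ℕ
double v z = if z <ᵇ v then 2 * suc z else (if z ≡ᵇ v then suc (2 * v) else 2 * z)

double-cases : ∀ v z → (z < v × double v z ≡ 2 * suc z) ⊎ (z ≡ v × double v z ≡ suc (2 * v)) ⊎ (v < z × double v z ≡ 2 * z)
double-cases v z with <-cmp z v
... | tri< h _ _ rewrite <ᵇ-true h = inj₁ (h , refl)
... | tri≈ _ refl _ rewrite <ᵇ-false (≤-refl {z}) | ≡ᵇ-true {z} refl = inj₂ (inj₁ (refl , refl))
... | tri> _ n h rewrite <ᵇ-false (<⇒≤ h) | ≡ᵇ-false n = inj₂ (inj₂ (h , refl))

double-mono : ∀ v {x y} → x < y → double v x < double v y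
double-mono v {x} {y} h with double-cases v x | double-cases v y
... | inj₁ (a , e₁) | inj₁ (b , e₂) rewrite e₁ | e₂ = *-monoʳ-< 2 (s≤s h)
... | inj₁ (a , e₁) | inj₂ (inj₁ (b , e₂)) rewrite e₁ | e₂ = s≤s (*-monoʳ-≤ 2 a)
... | inj₁ (a , e₁) | inj₂ (inj₂ (b , e₂)) rewrite e₁ | e₂ = *-monoʳ-< 2 (≤-<-trans a b)
... | inj₂ (inj₁ (refl , e₁)) | inj₁ (b , e₂) = ⊥-elim (<-asym h b)
... | inj₂ (inj₁ (refl , e₁)) | inj₂ (inj₁ (refl , e₂)) = ⊥-elim (<-irrefl refl h)
... | inj₂ (inj₁ (refl , e₁)) | inj₂ (inj₂ (b , e₂)) rewrite e₁ | e₂ =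
      ≤-trans (≤-reflexive (cong suc (sym (+-suc x (x + 0))))) (*-monoʳ-≤ 2 b)
... | inj₂ (inj₂ (a , e₁)) | inj₁ (b , e₂) = ⊥-elim (<-asym (<-trans a h) b)
... | inj₂ (inj₂ (a , e₁)) | inj₂ (inj₁ (refl , e₂)) = ⊥-elim (<-asym a h)
... | inj₂ (inj₂ (a , e₁)) | inj₂ (inj₂ (b , e₂)) rewrite e₁ | e₂ = *-monoʳ-< 2 h

double-lift : ∀ v x → double v (lift v 1 x) ≡ 2 * suc x
double-lift v x with lift-cases v 1 x
... | inj₁ (h , eq) rewrite eq | <ᵇ-true h = refl
... | inj₂ (h , eq) rewrite eq | <ᵇ-false (m≤n⇒m≤1+n h) | ≡ᵇ-false (λ (t : suc x ≡ v) → <-irrefl (sym t) (s≤s h)) = refl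

double-at : ∀ v → double v (v + 0) ≡ suc (2 * v)
double-at v rewrite +-identityʳ v | <ᵇ-false (≤-refl {v}) | ≡ᵇ-true {v} refl = refl

insertCell-insB : ∀ ρ v p → insertCell ρ (suc v) (suc p) ≡ map (double v) (insB p v (0 ∷ []) ρ)
insertCell-insB ρ v p = sym (map-++ (double v) (map g (take p ρ)) _ ⊙
   cong₂ _++_ (part (take p ρ) ⊙ sym (take-map {f = h} p ρ)) (cong₂ _∷_ (double-at v ⊙ sym (+-suc v (v + 0))) (part (drop p ρ) ⊙ sym (drop-map {f = h} p ρ))))
  where
  g = lift v 1
  h = λ x → 2 * suc x
  part : ∀ xs → map (double v) (map g xs) ≡ map h xs
  part xs = sym (map-∘ xs) ⊙ map-cong (double-lift v) xs

any-true⁻ : ∀ {A : Set} (q : A → Bool) xs → any q xs ≡ true → ∃ λ x → x ∈ xs × q x ≡ true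
any-true⁻ q (x ∷ xs) h with q x in eq
... | true = x , here refl , eq
... | false = let y , m , t = any-true⁻ q xs h in y , there m , t

any-true : ∀ {A : Set} (q : A → Bool) {xs x} → x ∈ xs → q x ≡ true → any q xs ≡ true
any-true q (here refl) h = ∨-trueˡ h
any-true q {y ∷ _} (there m) h = ∨-trueʳ {q y} (any-true q m h)

map-pos : ∀ {w} → Unique w → map (pos w) w ≡ upTo (length w)
map-pos {w} u = cong (map (pos w)) (sym (map-at-upTo w)) ⊙ sym (map-∘ (upTo (length w))) ⊙
  map-cong-∈ (upTo (length w)) (λ m → pos-at u (∈-upTo⁻ m)) ⊙ map-id _

count-pos< : ∀ {w p} → Unique w → p ≤ length w → lf w w p ≡ p
count-pos< {w} {p} u h = sym (count-map (_<ᵇ p) (pos w) w) ⊙ cong (countᵇ (_<ᵇ p)) (map-pos u) ⊙ count-<-upTo _ p h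

-- Kernel permutations described intrinsically: the component of the maximum is everything.
-- `Ker-shape` shows that every kernel shape is of this kind, and `pad` realises each such
-- permutation as a shape.
record KP (ρ : List ℕ) : Set₁ where
  field
    perm : IsPerm ρ
    nonempty : 0 < length ρ
    ker : Ker (length ρ ∸ 1) ρ ρ

single : IsPerm (0 ∷ [])
single = ([] ∷ []) , λ { (here refl) → s≤s z≤n }

module Feasibility {ρ : List ℕ} (pρ : IsPerm ρ) {p v : ℕ} (p≤ : p ≤ length ρ) (v< : v < length ρ) where
  private
    g = lift v 1
    W = insB p v (0 ∷ []) ρ
    module I = Insertion pρ single {p} {v} p≤
    uW : Unique W
    uW = proj₁ (I.perm (<⇒≤ v<))
    y = v + 0
    y∈ : y ∈ W
    y∈ = I.new∈ (here refl)
    posy : pos W y ≡ p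
    posy = I.pos-new (here refl) ⊙ +-identityʳ p
    hit : ℕ × ℕ × ℕ → Bool
    hit (i , j , k) = (i ≡ᵇ p) ∨ (j ≡ᵇ p) ∨ (k ≡ᵇ p)
    occs : occ132 (insertCell ρ (suc v) (suc p)) ≡ occ132 W
    occs = cong occ132 (insertCell-insB ρ v p) ⊙ occ132-map (double v) W (λ _ _ → double-mono v)
    unfold : infeasible ρ (suc v) (suc p) ≡ any hit (occ132 W)
    unfold = cong (any hit) occs

  feasible : Feas ρ p v → infeasible ρ (suc v) (suc p) ≡ false
  feasible F = unfold ⊙ ≢true⇒false λ t → bad (any-true⁻ hit (occ132 W) t)
    where
    at≡ : ∀ {i} → i ≡ p → at W i ≡ y
    at≡ refl = cong (at W) (sym posy) ⊙ at-pos y∈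
    bad : (∃ λ x → x ∈ occ132 W × hit x ≡ true) → ⊥
    bad ((i , j , k) , m , t) with occ132⇒Occ uW m
    ... | _ , o with I.Occ-old⊎new F o
    -- The block has one letter, so an occurrence inside it would use this letter twice.
    ... | inj₂ (here e₁ , here e₂ , _) = <-irrefl (cong (pos W) (e₁ ⊙ sym e₂)) (Occ.a-c o)
    ... | inj₁ im = absurd (∨-true⁻ t)
      where
      notnew : ∀ {a c b} → OccImage g ρ a c b → Touch (_≡ y) a c b → ⊥
      notnew (image {a} {c} {b} o) (inj₁ q) = I.old≢new {a} (here refl) q
      notnew (image {a} {c} {b} o) (inj₂ (inj₁ q)) = I.old≢new {c} (here refl) q
      notnew (image {a} {c} {b} o) (inj₂ (inj₂ q)) = I.old≢new {b} (here refl) q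
      absurd : (i ≡ᵇ p) ≡ true ⊎ ((j ≡ᵇ p) ∨ (k ≡ᵇ p)) ≡ true → ⊥
      absurd (inj₁ q) = notnew im (inj₁ (at≡ (≡ᵇ-true⁻ q)))
      absurd (inj₂ q) with ∨-true⁻ q
      ... | inj₁ q = notnew im (inj₂ (inj₁ (at≡ (≡ᵇ-true⁻ q))))
      ... | inj₂ q = notnew im (inj₂ (inj₂ (at≡ (≡ᵇ-true⁻ q))))

  -- The test sees only occurrences through the inserted point. That their absence clears the whole
  -- lower left quadrant depends on the connectedness of `ρ`, which enters through `LowerLeft`.
  feasible⁻ : Ker (length ρ ∸ 1) ρ ρ → infeasible ρ (suc v) (suc p) ≡ false → Feas ρ p v
  feasible⁻ K h = record
      { LL = λ {x} m q → I.above-new {x} {0} (L.lower-left-empty (∈-map⁺ g m) (subst₂ _<_ (sym (I.pos-old m ⊙ lift-lo p 1 q)) (sym posy) q))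
      ; UR = λ {x} {z} m n hx hz q r → lift-<⁻ v 1 (L.upper-right-increasing (∈-map⁺ g m) (∈-map⁺ g n) (I.hi> hx (here refl)) (I.hi> hz (here refl))
           (subst₂ _<_ (sym posy) (sym (I.pos-old m ⊙ lift-hi p 1 q)) (s≤s q)) (I.pos-<⁺ m n r)) }
    where
    K′ = Ker-map (lift-Mono v 1 ρ) K
    κ = map g ρ
    none : ∀ {a c b} → Occ W a c b → Touch (_≡ y) a c b → ⊥
    none {a} {c} {b} o t = true≢false (any-true hit (Occ⇒occ132 o) (ht t)) (sym unfold ⊙ h)
      where
      ht : Touch (_≡ y) a c b → hit (pos W a , pos W c , pos W b) ≡ true
      ht (inj₁ refl) = ∨-trueˡ (≡ᵇ-true posy)
      ht (inj₂ (inj₁ refl)) = ∨-trueʳ {pos W a ≡ᵇ p} (∨-trueˡ (≡ᵇ-true posy))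
      ht (inj₂ (inj₂ refl)) = ∨-trueʳ {pos W a ≡ᵇ p} (∨-trueʳ {pos W c ≡ᵇ p} (≡ᵇ-true posy))
    y∉ : y ∉ κ
    y∉ m with ∈-map⁻ g m
    ... | x , _ , q = I.old≢new {x} (here refl) (sym q)
    sub : ∀ {x} → x ∈ κ → x ∈ W
    sub m with ∈-map⁻ g m
    ... | x , n , refl = I.old∈ n
    y<M : y < g (length ρ ∸ 1)
    y<M = I.hi> (<⇒≤pred v<) (here refl)
    connect : (Q : ℕ → Set) → Q (g (length ρ ∸ 1)) → (∀ {a c b} → Full (_∈ κ) a c b → Occ W a c b → Touch Q a c b → Full Q a c b) →
      ∀ {x} → x ∈ κ → Q x
    connect Q q c m = Ker.least K′ Q q (λ o t → c (Occ.a∈ o , Occ.c∈ o , Occ.b∈ o) (up o) t) m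
      where
      up : ∀ {a c b} → Occ κ a c b → Occ W a c b
      up o with Occ-map⁻ (lift-Mono v 1 ρ) o
      ... | image (occ ma mc mb p₁ p₂ r s) = occ (I.old∈ ma) (I.old∈ mc) (I.old∈ mb) (I.pos-<⁺ ma mc p₁) (I.pos-<⁺ mc mb p₂) (lift-mono v 1 r) (lift-mono v 1 s)
    module L = LowerLeft {W} {κ} {y} {g (length ρ ∸ 1)} y∈ y∉ sub y<M (λ _ _ o → none o (inj₁ refl)) (λ _ _ o → none o (inj₂ (inj₁ refl)))
      (λ _ _ o → none o (inj₂ (inj₂ refl))) connect

∈-feasibleCells⁻ : ∀ {ρ m l} → (m , l) ∈ feasibleCells ρ → (1 ≤ m × m ≤ length ρ) × (1 ≤ l × l ≤ suc (length ρ)) × infeasible ρ m l ≡ false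
∈-feasibleCells⁻ {ρ} n with ∈-filterᵇ⁻ _ (concatMap (λ m → map (m ,_) (range 1 (suc (suc (sz ρ))))) (reverse (range 1 (suc (sz ρ))))) n
... | n₁ , t with ∈-concatMap⁻′ _ (reverse (range 1 (suc (sz ρ)))) n₁
... | m , nm , n₂ with ∈-map⁻ _ n₂
... | l , nl , refl = let a , b = ∈-range⁻ {1} (PP.∈-resp-↭ (PP.↭-reverse (range 1 (suc (sz ρ)))) nm) ; c , d = ∈-range⁻ {1} nl in
   (a , ≤-pred b) , (c , ≤-pred d) , not-true⁻ t

∈-feasibleCells⁺ : ∀ {ρ m l} → 1 ≤ m → m ≤ length ρ → 1 ≤ l → l ≤ suc (length ρ) → infeasible ρ m l ≡ false → (m , l) ∈ feasibleCells ρ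
∈-feasibleCells⁺ {ρ} {m} {l} a b c d h = ∈-filterᵇ⁺ (∈-concatMap⁺′ (λ m → map (m ,_) (range 1 (suc (suc (sz ρ)))))
   (PP.∈-resp-↭ (↭-sym (PP.↭-reverse (range 1 (suc (sz ρ))))) (∈-range⁺ {1} a (s≤s b))) (∈-map⁺ _ (∈-range⁺ {1} c (s≤s d)))) (cong not h)

-- The lexicographic order of the listing, which holds for all cells of the grid. Only feasibility
-- strengthens it to `_≼_`, in `cells-chain`.
_◁_ : Cell → Cell → Set
(m , l) ◁ (m′ , l′) = m′ < m ⊎ (m ≡ m′ × l < l′)

AllPairs-reverse : ∀ {xs : List ℕ} → AllPairs _<_ xs → AllPairs (λ x y → y < x) (reverse xs)
AllPairs-reverse [] = []
AllPairs-reverse {x ∷ xs} (a ∷ as) = subst (AllPairs _) (sym (unfold-reverse x xs))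
  (APP.++⁺ (AllPairs-reverse as) ([] ∷ []) (All.tabulate (λ m → All.lookup a (PP.∈-resp-↭ (PP.↭-reverse xs) m) ∷ [])))

range-sorted : ∀ a b → AllPairs _<_ (range a b)
range-sorted a b = APP.map⁺ (APP.applyUpTo⁺₁ id (b ∸ a) (λ i<j _ → +-monoʳ-< a i<j))

grid-sorted : ∀ ms ls → AllPairs (λ x y → y < x) ms → AllPairs _<_ ls → AllPairs _◁_ (concatMap (λ m → map (m ,_) ls) ms)
grid-sorted [] ls _ _ = []
grid-sorted (m ∷ ms) ls (a ∷ as) b = APP.++⁺ (APP.map⁺ (AP.map (λ h → inj₂ (refl , h)) b)) (grid-sorted ms ls as b)
    (All.tabulate (λ i → All.tabulate (λ j → lt i j)))
  where
  lt : ∀ {c d} → c ∈ map (m ,_) ls → d ∈ concatMap (λ m → map (m ,_) ls) ms → c ◁ d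
  lt i j with ∈-map⁻ _ i | ∈-concatMap⁻′ _ ms j
  ... | l , _ , refl | m′ , nm , j′ with ∈-map⁻ _ j′
  ... | l′ , _ , refl = inj₁ (All.lookup a nm)

feasibleCells-◁ : ∀ ρ → AllPairs _◁_ (feasibleCells ρ)
feasibleCells-◁ ρ = APP.filter⁺ _ (grid-sorted _ _ (AllPairs-reverse (range-sorted 1 (suc (sz ρ)))) (range-sorted 1 (suc (suc (sz ρ)))))

feasibleCells-Unique : ∀ ρ → Unique (feasibleCells ρ)
feasibleCells-Unique ρ = AP.map (λ { {m , l} (inj₁ h) e′ → <-irrefl (sym (cong proj₁ e′)) h ; {m , l} (inj₂ (_ , h)) e′ → <-irrefl (cong proj₂ e′) h }) (feasibleCells-◁ ρ)

module KernelShape {ρ : List ℕ} (kp : KP ρ) where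
  open KP kp

  cell-Feas : ∀ {m l} → (m , l) ∈ feasibleCells ρ → Feas ρ (l ∸ 1) (m ∸ 1)
  cell-Feas {suc m} {suc l} n with ∈-feasibleCells⁻ {ρ} n
  ... | (_ , m≤) , (_ , s≤s l≤) , h = Feasibility.feasible⁻ perm l≤ m≤ ker h
  cell-Feas {zero} n with ∈-feasibleCells⁻ {ρ} n
  ... | (() , _) , _
  cell-Feas {suc m} {zero} n with ∈-feasibleCells⁻ {ρ} n
  ... | _ , (() , _) , _

  -- Suppose one feasible cell lay strictly below and to the left of another. By `LL` for the upper
  -- cell, the first kernel entry to the right of the lower cell is above the upper cell's corner,
  -- and the lowest kernel entry above the lower cell stands to the right of that corner. These two
  -- entries form a descent to the upper right of the lower cell, against `UR`.
  cells-chain : AllPairs _≼_ (feasibleCells ρ)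
  cells-chain = AllPairs-map-∈ {R = _◁_} ord (feasibleCells-◁ ρ)
    where
    ord : ∀ {c d} → c ∈ feasibleCells ρ → d ∈ feasibleCells ρ → c ◁ d → c ≼ d
    ord mc md (inj₂ (refl , h)) = ≤-refl , <⇒≤ h
    ord {m , l} {m′ , l′} mc md (inj₁ h) = <⇒≤ h , ≮⇒≥ λ l′<l → contra l′<l
      where
      module F = Feas (cell-Feas mc)
      module F′ = Feas (cell-Feas md)
      contra : l′ < l → ⊥
      contra l′<l with ∈-feasibleCells⁻ {ρ} mc | ∈-feasibleCells⁻ {ρ} md
      ... | (_ , m≤) , (_ , l≤) , _ | (m′≥1 , _) , (l′≥1 , _) , _ =
          <⇒≱ (F′.UR k∈ v∈ (<⇒≤ (<-≤-trans v′<v v≤k)) ≤-refl (≤-reflexive (sym posk)) (subst (_< pos ρ v′) (sym posk) (<-≤-trans p′<p p≤v)))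
              (<⇒≤ (<-≤-trans v′<v v≤k))
        where
        v′ = m′ ∸ 1
        p′ = l′ ∸ 1
        v′<v : v′ < m ∸ 1
        v′<v = ∸-monoˡ-< h m′≥1
        p′<p : p′ < l ∸ 1
        p′<p = ∸-monoˡ-< l′<l l′≥1
        p′< : p′ < length ρ
        p′< = <-≤-trans p′<p (∸-monoˡ-≤ 1 l≤)
        k∈ : at ρ p′ ∈ ρ
        k∈ = at∈ ρ p′<
        posk : pos ρ (at ρ p′) ≡ p′
        posk = pos-at (proj₁ perm) p′<
        v≤k : m ∸ 1 ≤ at ρ p′
        v≤k = F.LL k∈ (subst (_< l ∸ 1) (sym posk) p′<p)
        v∈ : v′ ∈ ρ
        v∈ = IsPerm-∈ perm (<-≤-trans v′<v (≤-trans (m∸n≤m m 1) m≤))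
        p≤v : l ∸ 1 ≤ pos ρ v′
        p≤v = ≮⇒≥ (λ q → <⇒≱ v′<v (F.LL v∈ q))

  slot : ∀ {c} → c ∈ feasibleCells ρ → Slot ρ ρ 0 c
  slot {m , l} n with ∈-feasibleCells⁻ {ρ} n
  ... | (m≥1 , m≤) , (l≥1 , l≤) , _ = record
    { m≥1 = m≥1 ; l≥1 = l≥1 ; p≤ = p≤ ; v< = v< ; feas = subst (λ z → Feas ρ z (m ∸ 1)) (sym (+-identityʳ (l ∸ 1))) (cell-Feas n)
    ; rk≡ = count-<-perm perm (<⇒≤ v<) ; lf≡ = count-pos< (proj₁ perm) p≤ ⊙ +-identityʳ (l ∸ 1) }
    where
    p≤ : l ∸ 1 + 0 ≤ length ρ
    p≤ = subst (_≤ length ρ) (sym (+-identityʳ (l ∸ 1))) (∸-monoˡ-≤ 1 l≤)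
    v< : m ∸ 1 < length ρ
    v< = ∸-monoˡ-< (s≤s m≤) m≥1

-- Decomposition of a permutation along its kernel

∧-same-false : ∀ u u′ {b} → b ≡ false → u ∧ b ≡ u′ ∧ b
∧-same-false u u′ refl = ∧-zeroʳ u ⊙ sym (∧-zeroʳ u′)

∧-last-false : ∀ u b {i} → i ≡ false → u ∧ (b ∧ i) ≡ i
∧-last-false u b refl = cong (u ∧_) (∧-zeroʳ b) ⊙ ∧-zeroʳ u

∧-last-false′ : ∀ u b {i} → i ≡ false → u ∧ (b ∧ i) ≡ false
∧-last-false′ u b refl = ∧-last-false u b refl

∧-mid-false : ∀ u i {b} → b ≡ false → u ∧ (b ∧ i) ≡ false
∧-mid-false u i refl = ∧-zeroʳ u

∧-clash : ∀ b {c d} → b ∧ c ≡ true → not b ∧ d ≡ true → ⊥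
∧-clash true  _ ()
∧-clash false ()

-- Cuts a word at a place that is not given as an index but by a test closed towards the front.
split-sorted : ∀ (D : ℕ → Bool) {xs} → AllPairs (λ x y → D y ≡ true → D x ≡ true) xs → xs ≡ filterᵇ D xs ++ filterᵇ (not ∘ D) xs
split-sorted D [] = refl
split-sorted D {x ∷ xs} (a ∷ as) with D x in eq
... | true = cong (x ∷_) (split-sorted D as)
... | false = cong (x ∷_) (sym (filter-all (not ∘ D) xs rest)) ⊙ cong (_++ x ∷ filterᵇ (not ∘ D) xs) (sym (filter-none D xs dead))
  where
  dead : ∀ {y} → y ∈ xs → D y ≡ false
  dead m = ≢true⇒false (λ t → true≢false (All.lookup a m t) refl)
  rest : ∀ {y} → y ∈ xs → not (D y) ≡ true
  rest m = cong not (dead m)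

-- The hypotheses make `B` an interval in value relative to the other letters, `low` marking those
-- below it. A letter outside `B` gains the size of `B` in rank exactly when it lies above, and a
-- letter of `B` has the number of low letters added to its rank within `B`.
std-insB : ∀ us B vs (low : ℕ → Bool) → (∀ {b y} → b ∈ B → y ∈ us ++ vs → (y <ᵇ b) ≡ low y) →
  (∀ {b y} → b ∈ B → y ∈ us ++ vs → (b <ᵇ y) ≡ not (low y)) →
  (∀ {y z} → y ∈ us ++ vs → z ∈ us ++ vs → low y ≡ true → z < y → low z ≡ true) →
  std (us ++ B ++ vs) ≡ insB (length us) (countᵇ low (us ++ vs)) (std B) (std (us ++ vs))
std-insB us B vs low h₁ h₂ h₃ = map-++ (rk X) us (B ++ vs) ⊙ cong₂ _++_ (outer us (∈-++⁺ˡ) ⊙ cong (map g) (sym takes))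
    (map-++ (rk X) B vs ⊙ cong₂ _++_ (map-cong-∈ B inner ⊙ map-∘ B) (outer vs (∈-++⁺ʳ us) ⊙ cong (map g) (sym drops)))
  where
  X = us ++ B ++ vs
  R = us ++ vs
  v = countᵇ low R
  g = lift v (length (std B))
  rkX : ∀ y → rk X y ≡ rk R y + rk B y
  rkX y = count-++ (_<ᵇ y) us (B ++ vs) ⊙ cong (rk us y +_) (count-++ (_<ᵇ y) B vs) ⊙
    solve 3 (λ a b c → a :+ (b :+ c) := (a :+ c) :+ b) refl (rk us y) (rk B y) (rk vs y) ⊙ cong (_+ rk B y) (sym (count-++ (_<ᵇ y) us vs))
  takes : take (length us) (std R) ≡ map (rk R) us
  takes = take-map {f = rk R} (length us) R ⊙ cong (map (rk R)) (take-++-length us)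
    where
    take-++-length : ∀ xs → take (length xs) (xs ++ vs) ≡ xs
    take-++-length [] = refl
    take-++-length (x ∷ xs) = cong (x ∷_) (take-++-length xs)
  drops : drop (length us) (std R) ≡ map (rk R) vs
  drops = drop-map {f = rk R} (length us) R ⊙ cong (map (rk R)) (drop-++-length us)
    where
    drop-++-length : ∀ xs → drop (length xs) (xs ++ vs) ≡ vs
    drop-++-length [] = refl
    drop-++-length (x ∷ xs) = drop-++-length xs
  inner : ∀ {b} → b ∈ B → rk X b ≡ v + rk B b
  inner {b} m = rkX b ⊙ cong (_+ rk B b) (count-cong R (λ n → h₁ m n))
  shifted : ∀ {y} → y ∈ R → rk X y ≡ g (rk R y)
  shifted {y} m with low y in eq
  ... | true = rkX y ⊙ cong (rk R y +_) (count-none (_<ᵇ y) B (λ n → h₂ n m ⊙ cong not eq)) ⊙ +-identityʳ _ ⊙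
      sym (lift-lo v (length (std B)) (count-strict (_<ᵇ y) low R (λ n t → h₃ m n eq (<ᵇ-true⁻ t)) m (<ᵇ-false (≤-refl {y})) eq))
  ... | false = rkX y ⊙ cong (rk R y +_) (count-all (_<ᵇ y) B (λ n → h₂ n m ⊙ cong not eq) ⊙ sym (length-map _ B)) ⊙ +-comm (rk R y) _ ⊙
      sym (lift-hi v (length (std B)) (count-mono low (_<ᵇ y) R below))
    where
    below : ∀ {z} → z ∈ R → low z ≡ true → (z <ᵇ y) ≡ true
    below {z} n t with <-cmp z y
    ... | tri< a _ _ = <ᵇ-true a
    ... | tri≈ _ refl _ = true≢false t eq
    ... | tri> _ _ c = true≢false (h₃ n m t c) eq
  outer : ∀ ys → (∀ {y} → y ∈ ys → y ∈ R) → map (rk X) ys ≡ map g (map (rk R) ys)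
  outer ys s = map-cong-∈ ys (shifted ∘ s) ⊙ map-∘ ys

rk-mono : ∀ κ {x y} → x ≤ y → rk κ x ≤ rk κ y
rk-mono κ {x} {y} h = count-mono (_<ᵇ x) (_<ᵇ y) κ (λ {z} _ t → <ᵇ-true (<-≤-trans (<ᵇ-true⁻ {z} t) h))

rk-strict : ∀ {κ x y} → x ∈ κ → x < y → rk κ x < rk κ y
rk-strict {κ} {x} {y} m h = count-strict (_<ᵇ x) (_<ᵇ y) κ (λ {z} _ t → <ᵇ-true (<-trans (<ᵇ-true⁻ {z} t) h)) m (<ᵇ-false (≤-refl {x})) (<ᵇ-true h)

lf-mono : ∀ w κ {x y} → x ≤ y → lf w κ x ≤ lf w κ y
lf-mono w κ {x} {y} h = count-mono (λ z → pos w z <ᵇ x) (λ z → pos w z <ᵇ y) κ (λ {z} _ t → <ᵇ-true (<-≤-trans (<ᵇ-true⁻ {pos w z} t) h))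

lf-strict : ∀ w {κ x y} → x ∈ κ → pos w x < y → lf w κ (pos w x) < lf w κ y
lf-strict w {κ} {x} {y} m h = count-strict (λ z → pos w z <ᵇ pos w x) (λ z → pos w z <ᵇ y) κ (λ {z} _ t → <ᵇ-true (<-trans (<ᵇ-true⁻ {pos w z} t) h)) m
  (<ᵇ-false (≤-refl {pos w x})) (<ᵇ-true h)

rk< : ∀ {κ x y} → y ∈ κ → x ≤ y → rk κ x < length κ
rk< {κ} {x} m h = subst (rk κ x <_) (count-all (λ _ → true) κ (λ _ → refl)) (count-strict (_<ᵇ x) (λ _ → true) κ (λ _ _ → refl) m (<ᵇ-false h) refl)

std-perm : ∀ {κ} → Unique κ → IsPerm (std κ)
std-perm {κ} u = Unique-map (rk κ) (Mono-inj (λ m _ → rk-strict m)) u , λ m → bound (∈-map⁻ _ m)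
  where
  bound : ∀ {z} → (∃ λ x → x ∈ κ × z ≡ rk κ x) → z < length (std κ)
  bound (x , m , refl) = subst (rk κ x <_) (sym (length-map _ κ)) (rk< m ≤-refl)

-- The entries outside the kernel are discarded by `Ker-self`, then letters are replaced by their
-- ranks. The maximum of `π` belongs to `κ` and receives the largest rank.
Ker-shape : ∀ {π κ} → IsPerm π → Ker (length π ∸ 1) π κ → KP (std κ)
Ker-shape {π} {κ} pπ K = record { perm = ps ; nonempty = ne ; ker = subst (λ z → Ker z (std κ) (std κ)) top (Ker-map (λ m _ → rk-strict m) (Ker-self K)) }
  where
  module K = Ker K
  M = length π ∸ 1
  ps = std-perm (K.uniqueκ (proj₁ pπ))
  ne : 0 < length (std κ)
  ne = ∈-length (∈-map⁺ (rk κ) K.top)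
  below : ∀ {z} → (∃ λ x → x ∈ κ × z ≡ rk κ x) → z ≤ rk κ M
  below (x , m , refl) = rk-mono κ (<⇒≤pred (proj₂ pπ (K.∈w m)))
  top : rk κ M ≡ length (std κ) ∸ 1
  top = ≤-antisym (<⇒≤pred (proj₂ ps (∈-map⁺ (rk κ) K.top))) (below (∈-map⁻ _ (IsPerm-∈ ps (∸-monoʳ-< {length (std κ)} (s≤s z≤n) ne))))

module Decompose {π κ : List ℕ} (pπ : IsPerm π) (K : Ker (length π ∸ 1) π κ) where
  private
    module K = Ker K
    M = length π ∸ 1
    uπ = proj₁ pπ
    uκ = K.uniqueκ uπ
    ρ = std κ
    pρ : IsPerm ρ
    pρ = std-perm uκ
    rkM : Mono (rk κ) κ
    rkM m _ = rk-strict m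
    col : ℕ → ℕ
    col x = lf π κ (pos π x)

  memb-mark : ∀ {x} → x ∈ π → memb x κ ≡ K.mark x
  memb-mark {x} m = iff⇒≡ (λ t → K.mark⁺ (memb-true⁻ {x} κ t)) (λ t → memb-true {x} (K.mark⁻ m t))

  col-κ : ∀ {x} → x ∈ κ → col x ≡ pos κ x
  col-κ {x} m = count-cong κ (λ n → iff⇒≡ (λ t → <ᵇ-true (K.posκ n m (<ᵇ-true⁻ t))) (λ t → <ᵇ-true (K.posκ⁻ n m (<ᵇ-true⁻ t)))) ⊙
    count-pos< uκ (<⇒≤ (pos< m))

  module NonKernel {y : ℕ} (y∈ : y ∈ π) (y∉ : y ∉ κ) where
    y<M : y < M
    y<M = ≤∧≢⇒< (<⇒≤pred (proj₂ pπ y∈)) (λ { refl → y∉ K.top })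
    -- An occurrence of `y` with even one kernel letter would already put `y` into the kernel.
    open LowerLeft {π} {κ} {y} {M} y∈ y∉ K.∈w y<M (λ m _ o → y∉ (proj₁ (K.closed o (inj₂ (inj₁ m)))))
      (λ m _ o → y∉ (proj₁ (proj₂ (K.closed o (inj₁ m))))) (λ m _ o → y∉ (proj₂ (proj₂ (K.closed o (inj₁ m)))))
      (λ Q q c m → Ker.least (Ker-self K) Q q (λ o t → c (Occ.a∈ o , Occ.c∈ o , Occ.b∈ o) (K.occκ o) t) m) public

    above : ∀ {x} → x ∈ κ → rk κ y ≤ rk κ x → y < x
    above {x} m h with <-cmp x y
    ... | tri< a _ _ = ⊥-elim (<⇒≱ (rk-strict m a) h)
    ... | tri≈ _ refl _ = ⊥-elim (y∉ m)
    ... | tri> _ _ c = c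

    posρ : ∀ {x} → x ∈ κ → pos ρ (rk κ x) ≡ col x
    posρ m = Mono-pos rkM m ⊙ sym (col-κ m)

    left : ∀ {x} → x ∈ κ → pos ρ (rk κ x) < col y → pos π x < pos π y
    left {x} m h = ≰⇒> (λ q → <⇒≱ (subst (_< col y) (posρ m) h) (lf-mono π κ q))

    right : ∀ {x} → x ∈ κ → col y ≤ pos ρ (rk κ x) → pos π y < pos π x
    right {x} m h with pos-total (K.∈w m) y∈ (λ { refl → y∉ m })
    ... | inj₂ q = q
    ... | inj₁ q = ⊥-elim (<⇒≱ (lf-strict π m q) (subst (col y ≤_) (posρ m) h))

    feas : Feas ρ (col y) (rk κ y)
    feas = record { LL = λ m h → ll (∈-map⁻ _ m) h ; UR = λ m n → ur (∈-map⁻ _ m) (∈-map⁻ _ n) }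
      where
      ll : ∀ {z} → (∃ λ x → x ∈ κ × z ≡ rk κ x) → pos ρ z < col y → rk κ y ≤ z
      ll (x , m , refl) h = rk-mono κ (<⇒≤ (lower-left-empty m (left m h)))
      ur : ∀ {z t} → (∃ λ x → x ∈ κ × z ≡ rk κ x) → (∃ λ x → x ∈ κ × t ≡ rk κ x) → rk κ y ≤ z → rk κ y ≤ t →
        col y ≤ pos ρ z → pos ρ z < pos ρ t → z < t
      ur (x , m , refl) (x′ , m′ , refl) hz ht p q = rk-strict m (upper-right-increasing m m′ (above m hz) (above m′ ht) (right m p)
        (K.posκ⁻ m m′ (subst₂ _<_ (Mono-pos rkM m) (Mono-pos rkM m′) q)))

    rk<len : rk κ y < length ρ
    rk<len = subst (rk κ y <_) (sym (length-map _ κ)) (rk< K.top (<⇒≤ y<M))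

    col≤len : col y ≤ length ρ
    col≤len = subst (col y ≤_) (sym (length-map _ κ)) (count≤length _ κ)

    cell∈ : cellOf π κ y ∈ feasibleCells ρ
    cell∈ = ∈-feasibleCells⁺ {ρ} (s≤s z≤n) rk<len (s≤s z≤n) (s≤s col≤len) (Feasibility.feasible pρ col≤len rk<len feas)

  -- If this failed, a kernel letter separating the two cells would form an occurrence
  -- with x and y.
  chain-order : ∀ {x y} → x ∈ π → x ∉ κ → y ∈ π → y ∉ κ → cellOf π κ x ≼ cellOf π κ y → cellOf π κ x ≢ cellOf π κ y → pos π x < pos π y × y < x
  chain-order {x} {y} x∈ x∉ y∈ y∉ (s≤s a , s≤s b) ne = before , below
    where
    module X = NonKernel x∈ x∉
    module Y = NonKernel y∈ y∉
    x≢y : x ≢ y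
    x≢y refl = ne refl
    by-rk : rk κ y < rk κ x → y < x
    by-rk h = ≰⇒> (λ q → <⇒≱ h (rk-mono κ q))
    by-col : col x < col y → pos π x < pos π y
    by-col h = ≰⇒> (λ q → <⇒≱ h (lf-mono π κ q))
    before : pos π x < pos π y
    before with m≤n⇒m<n∨m≡n b
    ... | inj₁ h = by-col h
    ... | inj₂ e₁ with m≤n⇒m<n∨m≡n a
    ... | inj₂ e₂ = ⊥-elim (ne (cong₂ (λ i j → suc i , suc j) (sym e₂) e₁))
    ... | inj₁ h with pos-total x∈ y∈ x≢y
    ... | inj₁ q = q
    ... | inj₂ q with count-diff (_<ᵇ y) (_<ᵇ x) κ h
    ... | k , k∈ , k<x , k≮y with pos-total x∈ (K.∈w k∈) (λ { refl → x∉ k∈ })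
    ... | inj₂ r = ⊥-elim (<-asym (X.lower-left-empty k∈ r) (<ᵇ-true⁻ k<x))
    ... | inj₁ r = ⊥-elim (y∉ (proj₁ (K.closed (occ y∈ x∈ (K.∈w k∈) q r (≤∧≢⇒< (<ᵇ-false⁻ k≮y) (λ { refl → y∉ k∈ })) (<ᵇ-true⁻ k<x)) (inj₂ (inj₂ k∈)))))
    below : y < x
    below with m≤n⇒m<n∨m≡n a
    ... | inj₁ h = by-rk h
    ... | inj₂ e₂ with m≤n⇒m<n∨m≡n b
    ... | inj₂ e₁ = ⊥-elim (ne (cong₂ (λ i j → suc i , suc j) (sym e₂) e₁))
    ... | inj₁ h with <-cmp x y
    ... | tri≈ _ e₁ _ = ⊥-elim (x≢y e₁)
    ... | tri> _ _ q = q
    ... | tri< q _ _ with count-diff (λ z → pos π z <ᵇ pos π x) (λ z → pos π z <ᵇ pos π y) κ h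
    ... | k , k∈ , k<y , k≮x with pos-total x∈ (K.∈w k∈) (λ { refl → x∉ k∈ })
    ... | inj₂ r = true≢false (<ᵇ-true r) k≮x
    ... | inj₁ r = ⊥-elim (x∉ (proj₁ (K.closed (occ x∈ (K.∈w k∈) y∈ r (<ᵇ-true⁻ k<y) q (Y.lower-left-empty k∈ (<ᵇ-true⁻ k<y))) (inj₂ (inj₁ k∈)))))

  cellIn : List Cell → ℕ → Bool
  cellIn D x = any (ceq (cellOf π κ x)) D

  upTo-cells : List Cell → ℕ → Bool
  upTo-cells D x = memb x κ ∨ cellIn D x

  -- The part of `π` that is present once the cells in `D` have been filled.
  A : List Cell → List ℕ
  A D = filterᵇ (upTo-cells D) π

  B : Cell → List ℕ
  B c = filterᵇ (inCell π κ c) π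

  block : Cell → List ℕ
  block c = std (B c)

  placed : List Cell → ℕ
  placed D = countᵇ (λ x → not (memb x κ) ∧ cellIn D x) π

  cellIn⁻ : ∀ {D x} → cellIn D x ≡ true → cellOf π κ x ∈ D
  cellIn⁻ {D} {x} t with any-true⁻ (ceq (cellOf π κ x)) D t
  ... | c , m , q = subst (_∈ D) (sym (ceq-true⁻ {cellOf π κ x} q)) m

  cellIn⁺ : ∀ {D x} → cellOf π κ x ∈ D → cellIn D x ≡ true
  cellIn⁺ {D} {x} m = any-true (ceq (cellOf π κ x)) m (ceq-refl (cellOf π κ x))

  data Kind (D : List Cell) (c : Cell) (x : ℕ) : Set where
    kernel-letter : x ∈ κ → Kind D c x
    earlier : x ∉ κ → cellOf π κ x ∈ D → Kind D c x
    current : x ∉ κ → cellOf π κ x ≡ c → Kind D c x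
    later   : x ∉ κ → cellIn D x ≡ false → ceq (cellOf π κ x) c ≡ false → Kind D c x

  kind : ∀ D c x → Kind D c x
  kind D c x with memb x κ in e₁
  ... | true = kernel-letter (memb-true⁻ {x} κ e₁)
  ... | false with cellIn D x in e₂
  ... | true = earlier (memb-false⁻ {x} {κ} e₁) (cellIn⁻ {D} {x} e₂)
  ... | false with ceq (cellOf π κ x) c in e₃
  ... | true = current (memb-false⁻ {x} {κ} e₁) (ceq-true⁻ {cellOf π κ x} e₃)
  ... | false = later (memb-false⁻ {x} {κ} e₁) e₂ e₃

  count-κ : ∀ (q : ℕ → Bool) → countᵇ (λ x → memb x κ ∧ q x) π ≡ countᵇ q κ
  count-κ q = count-cong π (λ m → cong (_∧ q _) (memb-mark m)) ⊙ sym (count-filter q K.mark π) ⊙ cong (countᵇ q) (sym K.sub)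

  -- Compares the subwords before and after the cell `(m , l)` is added to `D`. `bef` marks the
  -- letters in front of the new block and `low` those below it: kernel letters are judged by column
  -- and row, while entries of earlier cells are all in front and above by `chain-order`.
  module Step (D : List Cell) (m l : ℕ) (c∉ : (m , l) ∉ D) (D≼ : ∀ {d} → d ∈ D → d ≼ (m , l))
    (m≤ : m ∸ 1 ≤ length ρ) (l≤ : l ∸ 1 ≤ length ρ) where
    private
      c = (m , l)
      bef low : ℕ → Bool
      bef x = if memb x κ then col x <ᵇ l ∸ 1 else cellIn D x
      low x = if memb x κ then rk κ x <ᵇ m ∸ 1 else false

      bef-κ : ∀ {x} → x ∈ κ → bef x ≡ (col x <ᵇ l ∸ 1)
      bef-κ {x} n rewrite memb-true {x} n = refl
      bef-∉ : ∀ {x} → x ∉ κ → bef x ≡ cellIn D x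
      bef-∉ {x} n rewrite memb-false {x} κ n = refl
      low-κ : ∀ {x} → x ∈ κ → low x ≡ (rk κ x <ᵇ m ∸ 1)
      low-κ {x} n rewrite memb-true {x} n = refl
      low-∉ : ∀ {x} → x ∉ κ → low x ≡ false
      low-∉ {x} n rewrite memb-false {x} κ n = refl
      inC : ℕ → Bool
      inC = inCell π κ c
      inC-κ : ∀ {x} → x ∈ κ → inC x ≡ false
      inC-κ {x} n rewrite memb-true {x} n = refl
      inC-∉ : ∀ {x} → x ∉ κ → inC x ≡ ceq (cellOf π κ x) c
      inC-∉ {x} n rewrite memb-false {x} κ n = refl
      up-κ : ∀ E {x} → x ∈ κ → upTo-cells E x ≡ true
      up-κ E {x} n rewrite memb-true {x} n = refl
      up-∉ : ∀ E {x} → x ∉ κ → upTo-cells E x ≡ cellIn E x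
      up-∉ E {x} n rewrite memb-false {x} κ n = refl
      cur-col : ∀ {x} → cellOf π κ x ≡ c → col x ≡ l ∸ 1
      cur-col q = cong (λ z → proj₂ z ∸ 1) q
      cur-rk : ∀ {x} → cellOf π κ x ≡ c → rk κ x ≡ m ∸ 1
      cur-rk q = cong (λ z → proj₁ z ∸ 1) q
      cur-notD : ∀ {x} → cellOf π κ x ≡ c → cellIn D x ≡ false
      cur-notD {x} q = ≢true⇒false (λ t → c∉ (subst (_∈ D) q (cellIn⁻ {D} {x} t)))
      ear-notC : ∀ {x} → cellOf π κ x ∈ D → ceq (cellOf π κ x) c ≡ false
      ear-notC {x} n = ceq-false (λ q → c∉ (subst (_∈ D) q n))
      ear-col : ∀ {x} → cellOf π κ x ∈ D → col x ≤ l ∸ 1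
      ear-col n = ∸-monoˡ-≤ 1 (proj₂ (D≼ n))
      ear-rk : ∀ {x} → cellOf π κ x ∈ D → m ∸ 1 ≤ rk κ x
      ear-rk n = ∸-monoˡ-≤ 1 (proj₁ (D≼ n))
      order : ∀ {x y} → x ∈ π → x ∉ κ → cellOf π κ x ∈ D → y ∈ π → y ∉ κ → cellOf π κ y ≡ c → pos π x < pos π y × y < x
      order x∈ x∉ xD y∈ y∉ yc = chain-order x∈ x∉ y∈ y∉ (subst (_ ≼_) (sym yc) (D≼ xD)) (λ q → c∉ (subst (_∈ D) (q ⊙ yc) xD))

      us = filterᵇ bef (A D)
      vs = filterᵇ (not ∘ bef) (A D)
      X = A (c ∷ D)
      Y = filterᵇ (not ∘ bef) X

      inX⁻ : ∀ {x} → x ∉ κ → cellIn D x ≡ false → ceq (cellOf π κ x) c ≡ false → upTo-cells (c ∷ D) x ≡ true → ⊥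
      inX⁻ {x} a b d t = true≢false t (up-∉ (c ∷ D) a ⊙ cong₂ _∨_ d b)

      -- `E` is taken as `D` and as `c ∷ D`, so that the subwords without and with the block are cut
      -- by the same test.
      bef-closed : ∀ E {x y} → x ∈ A E → y ∈ π → upTo-cells (c ∷ D) x ≡ true → pos π x < pos π y → bef y ≡ true → bef x ≡ true
      bef-closed E {x} {y} mx y∈ ux h t with ∈-filterᵇ⁻ (upTo-cells E) π mx
      ... | x∈ , _ with kind D c x | kind D c y
      ... | earlier n xD | _ = bef-∉ n ⊙ cellIn⁺ {D} {x} xD
      ... | later n a b | _ = ⊥-elim (inX⁻ n a b ux)
      ... | kernel-letter n | kernel-letter n′ = bef-κ n ⊙ <ᵇ-true (≤-<-trans (lf-mono π κ (<⇒≤ h)) (<ᵇ-true⁻ {col y} {l ∸ 1} (sym (bef-κ n′) ⊙ t)))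
      ... | kernel-letter n | earlier n′ yD = bef-κ n ⊙ <ᵇ-true (<-≤-trans (lf-strict π n h) (ear-col {y} yD))
      ... | current n xc | kernel-letter n′ = ⊥-elim (<⇒≱ (<ᵇ-true⁻ {col y} {l ∸ 1} (sym (bef-κ n′) ⊙ t)) (subst (_≤ col y) (cur-col {x} xc) (lf-mono π κ (<⇒≤ h))))
      ... | current n xc | earlier n′ yD = ⊥-elim (<-asym h (proj₁ (order y∈ n′ yD x∈ n xc)))
      ... | _ | current n′ yc = true≢false t (bef-∉ n′ ⊙ cur-notD {y} yc)
      ... | _ | later n′ a b = true≢false t (bef-∉ n′ ⊙ a)

      same-κ : ∀ {x} → x ∈ κ → upTo-cells (c ∷ D) x ≡ upTo-cells D x
      same-κ n = up-κ (c ∷ D) n ⊙ sym (up-κ D n)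
      same-other : ∀ {x} → x ∉ κ → ceq (cellOf π κ x) c ≡ false → upTo-cells (c ∷ D) x ≡ upTo-cells D x
      same-other {x} n b = up-∉ (c ∷ D) n ⊙ cong (_∨ cellIn D x) b ⊙ sym (up-∉ D n)

      split-AD : A D ≡ us ++ vs
      split-AD = split-sorted bef (AllPairs-map-∈ {R = λ x y → pos π x < pos π y} (λ {x} {y} mx my h → bef-closed D mx (proj₁ (∈-filterᵇ⁻ (upTo-cells D) π my)) (wider x (proj₂ (∈-filterᵇ⁻ (upTo-cells D) π mx))) h)
          (APP.filter⁺ _ (pos-sorted uπ)))
        where
        wider : ∀ x → upTo-cells D x ≡ true → upTo-cells (c ∷ D) x ≡ true
        wider x t with ∨-true⁻ {memb x κ} t
        ... | inj₁ q = ∨-trueˡ q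
        ... | inj₂ q = ∨-trueʳ {memb x κ} (∨-trueʳ {ceq (cellOf π κ x) c} q)

      split-X : X ≡ filterᵇ bef X ++ Y
      split-X = split-sorted bef (AllPairs-map-∈ {R = λ x y → pos π x < pos π y} (λ {x} {y} mx my h → bef-closed (c ∷ D) mx (proj₁ (∈-filterᵇ⁻ (upTo-cells (c ∷ D)) π my)) (proj₂ (∈-filterᵇ⁻ (upTo-cells (c ∷ D)) π mx)) h)
          (APP.filter⁺ _ (pos-sorted uπ)))

      -- Once the letters in front are removed, the block comes first: a remaining kernel letter has
      -- column at least `l - 1`, so it cannot stand before an entry of the cell.
      split-Y : Y ≡ filterᵇ inC Y ++ filterᵇ (not ∘ inC) Y
      split-Y = split-sorted inC (AllPairs-map-∈ {R = λ x y → pos π x < pos π y} closed (APP.filter⁺ _ (APP.filter⁺ _ (pos-sorted uπ))))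
        where
        closed : ∀ {x y} → x ∈ Y → y ∈ Y → pos π x < pos π y → inC y ≡ true → inC x ≡ true
        closed {x} {y} mx my h t with ∈-filterᵇ⁻ (not ∘ bef) X mx | kind D c x | kind D c y
        ... | _ | current n q | _ = inC-∉ n ⊙ cong (λ z → ceq z c) q ⊙ ceq-refl c
        ... | _ , a | kernel-letter n | current n′ q = ⊥-elim (<⇒≱ (subst (col x <_) (cur-col {y} q) (lf-strict π n h)) (<ᵇ-false⁻ {col x} {l ∸ 1} (sym (bef-κ n) ⊙ not-true⁻ a)))
        ... | _ , a | earlier n xD | _ = true≢false (bef-∉ n ⊙ cellIn⁺ {D} {x} xD) (not-true⁻ a)
        ... | mX , _ | later n a b | _ = ⊥-elim (inX⁻ n a b (proj₂ (∈-filterᵇ⁻ (upTo-cells (c ∷ D)) π mX)))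
        ... | _ | kernel-letter _ | kernel-letter n′ = true≢false t (inC-κ n′)
        ... | _ | kernel-letter _ | earlier n′ yD = true≢false t (inC-∉ n′ ⊙ ear-notC {y} yD)
        ... | _ | kernel-letter _ | later n′ _ b = true≢false t (inC-∉ n′ ⊙ b)

      part-us : filterᵇ bef X ≡ us
      part-us = filter-filter bef (upTo-cells (c ∷ D)) π ⊙ filter-cong π (λ {x} _ → pt x) ⊙ sym (filter-filter bef (upTo-cells D) π)
        where
        pt : ∀ x → upTo-cells (c ∷ D) x ∧ bef x ≡ upTo-cells D x ∧ bef x
        pt x with kind D c x
        ... | kernel-letter n = cong (_∧ bef x) (same-κ n)
        ... | earlier n q = cong (_∧ bef x) (same-other n (ear-notC {x} q))
        ... | current n q = ∧-same-false (upTo-cells (c ∷ D) x) (upTo-cells D x) (bef-∉ n ⊙ cur-notD {x} q)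
        ... | later n a b = cong (_∧ bef x) (same-other n b)

      part-B : filterᵇ inC Y ≡ B c
      part-B = filter-filter inC (not ∘ bef) X ⊙ filter-filter _ (upTo-cells (c ∷ D)) π ⊙ filter-cong π (λ {x} _ → pt x)
        where
        pt : ∀ x → upTo-cells (c ∷ D) x ∧ (not (bef x) ∧ inC x) ≡ inC x
        pt x with kind D c x
        ... | kernel-letter n = ∧-last-false (upTo-cells (c ∷ D) x) (not (bef x)) (inC-κ n)
        ... | earlier n q = ∧-last-false (upTo-cells (c ∷ D) x) (not (bef x)) (inC-∉ n ⊙ ear-notC {x} q)
        ... | current n q = cong₂ (λ u b → u ∧ (not b ∧ inC x)) (up-∉ (c ∷ D) n ⊙ cellIn⁺ {c ∷ D} {x} (here q)) (bef-∉ n ⊙ cur-notD {x} q)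
        ... | later n a b = ∧-last-false (upTo-cells (c ∷ D) x) (not (bef x)) (inC-∉ n ⊙ b)

      part-vs : filterᵇ (not ∘ inC) Y ≡ vs
      part-vs = filter-filter (not ∘ inC) (not ∘ bef) X ⊙ filter-filter _ (upTo-cells (c ∷ D)) π ⊙ filter-cong π (λ {x} _ → pt x) ⊙ sym (filter-filter (not ∘ bef) (upTo-cells D) π)
        where
        pt : ∀ x → upTo-cells (c ∷ D) x ∧ (not (bef x) ∧ not (inC x)) ≡ upTo-cells D x ∧ not (bef x)
        pt x with kind D c x
        ... | kernel-letter n = cong₂ (λ u i → u ∧ (not (bef x) ∧ not i)) (same-κ n) (inC-κ n) ⊙ cong (upTo-cells D x ∧_) (∧-identityʳ (not (bef x)))
        ... | earlier n q = ∧-mid-false (upTo-cells (c ∷ D) x) (not (inC x)) (cong not bt) ⊙ sym (cong (λ b → upTo-cells D x ∧ not b) bt ⊙ ∧-zeroʳ (upTo-cells D x))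
          where bt = bef-∉ n ⊙ cellIn⁺ {D} {x} q
        ... | current n q = ∧-last-false′ (upTo-cells (c ∷ D) x) (not (bef x)) (cong not (inC-∉ n ⊙ cong (λ z → ceq z c) q ⊙ ceq-refl c)) ⊙
             sym (cong (_∧ not (bef x)) (up-∉ D n ⊙ cur-notD {x} q))
        ... | later n a b = cong₂ (λ u i → u ∧ (not (bef x) ∧ not i)) (same-other n b) (inC-∉ n ⊙ b) ⊙ cong (upTo-cells D x ∧_) (∧-identityʳ (not (bef x)))

      X-split : X ≡ us ++ B c ++ vs
      X-split = split-X ⊙ cong₂ _++_ part-us (split-Y ⊙ cong₂ _++_ part-B part-vs)

      -- Exactly `l - 1` kernel letters stand in front of the block, and so do all entries of
      -- earlier cells. This is the insertion point used by `asm`.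
      len-us : length us ≡ l ∸ 1 + placed D
      len-us = count-filter bef (upTo-cells D) π ⊙ count-cong π (λ {x} _ → pt x) ⊙
          count-∨ (λ x → memb x κ ∧ (col x <ᵇ l ∸ 1)) (λ x → not (memb x κ) ∧ cellIn D x) π (λ {x} _ → ∧-clash (memb x κ)) ⊙
          cong (_+ placed D) (count-κ (λ x → col x <ᵇ l ∸ 1) ⊙ count-cong κ (λ n → cong (_<ᵇ l ∸ 1) (col-κ n)) ⊙ count-pos< uκ (subst (l ∸ 1 ≤_) (length-map _ κ) l≤))
        where
        pt : ∀ x → upTo-cells D x ∧ bef x ≡ (memb x κ ∧ (col x <ᵇ l ∸ 1)) ∨ (not (memb x κ) ∧ cellIn D x)
        pt x with memb x κ
        ... | true = sym (∨-identityʳ _)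
        ... | false = ∧-idem _

      count-low : countᵇ low (us ++ vs) ≡ m ∸ 1
      count-low = cong (countᵇ low) (sym split-AD) ⊙ count-filter low (upTo-cells D) π ⊙ count-cong π (λ {x} _ → pt x) ⊙
          count-κ (λ x → rk κ x <ᵇ m ∸ 1) ⊙ sym (count-map (_<ᵇ m ∸ 1) (rk κ) κ) ⊙ count-<-perm pρ m≤
        where
        pt : ∀ x → upTo-cells D x ∧ low x ≡ memb x κ ∧ (rk κ x <ᵇ m ∸ 1)
        pt x with memb x κ
        ... | true = refl
        ... | false = ∧-zeroʳ _

      inAD : ∀ {y} → y ∈ us ++ vs → y ∈ π × upTo-cells D y ≡ true
      inAD n = ∈-filterᵇ⁻ (upTo-cells D) π (subst (_ ∈_) (sym split-AD) n)

      B⁻ : ∀ {b} → b ∈ B c → b ∈ π × b ∉ κ × cellOf π κ b ≡ c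
      B⁻ {b} n = let a , t = ∈-filterᵇ⁻ inC π n ; p , q = ∧-true⁻ t in a , memb-false⁻ {b} {κ} (not-true⁻ p) , ceq-true⁻ {cellOf π κ b} q

      notAD : ∀ {y} {Z : Set} → y ∉ κ → cellIn D y ≡ false → upTo-cells D y ≡ true → Z
      notAD n a t = true≢false t (up-∉ D n ⊙ a)

      cmp-low : ∀ {b y} → b ∈ B c → y ∈ us ++ vs → (y < b × low y ≡ true) ⊎ (b < y × low y ≡ false)
      cmp-low {b} {y} mb my with B⁻ mb | inAD my | kind D c y
      ... | b∈ , b∉ , bc | y∈ , t | earlier n yD = inj₂ (proj₂ (order y∈ n yD b∈ b∉ bc) , low-∉ n)
      ... | b∈ , b∉ , bc | y∈ , t | current n yc = notAD n (cur-notD {y} yc) t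
      ... | b∈ , b∉ , bc | y∈ , t | later n a _ = notAD n a t
      ... | b∈ , b∉ , bc | y∈ , t | kernel-letter n with <-cmp y b
      ... | tri< h _ _ = inj₁ (h , (low-κ n ⊙ <ᵇ-true (subst (rk κ y <_) (cur-rk {b} bc) (rk-strict n h))))
      ... | tri≈ _ refl _ = ⊥-elim (b∉ n)
      ... | tri> _ _ h = inj₂ (h , (low-κ n ⊙ <ᵇ-false (subst (_≤ rk κ y) (cur-rk {b} bc) (rk-mono κ (<⇒≤ h)))))

      low-down : ∀ {y z} → y ∈ us ++ vs → z ∈ us ++ vs → low y ≡ true → z < y → low z ≡ true
      low-down {y} {z} my mz t h with inAD mz | kind D c y | kind D c z
      ... | _ | earlier n _ | _ = true≢false t (low-∉ n)
      ... | _ | current n _ | _ = true≢false t (low-∉ n)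
      ... | _ | later n _ _ | _ = true≢false t (low-∉ n)
      ... | _ | kernel-letter n | kernel-letter n′ = low-κ n′ ⊙ <ᵇ-true (≤-<-trans (rk-mono κ (<⇒≤ h)) (<ᵇ-true⁻ {rk κ y} {m ∸ 1} (sym (low-κ n) ⊙ t)))
      ... | _ | kernel-letter n | earlier n′ zD = ⊥-elim (<⇒≱ (<ᵇ-true⁻ {rk κ y} {m ∸ 1} (sym (low-κ n) ⊙ t)) (≤-trans (ear-rk {z} zD) (rk-mono κ (<⇒≤ h))))
      ... | _ , u | kernel-letter n | current n′ zc = notAD n′ (cur-notD {z} zc) u
      ... | _ , u | kernel-letter n | later n′ a _ = notAD n′ a u

    insert-block : insB (l ∸ 1 + placed D) (m ∸ 1) (block c) (std (A D)) ≡ std (A (c ∷ D))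
    insert-block = sym (cong std X-split ⊙ std-insB us (B c) vs low
        (λ mb my → lt (cmp-low mb my)) (λ mb my → gt (cmp-low mb my)) low-down ⊙
        cong₂ (λ p v → insB p v (block c) (std (us ++ vs))) len-us count-low ⊙ cong (insB (l ∸ 1 + placed D) (m ∸ 1) (block c) ∘ std) (sym split-AD))
      where
      lt : ∀ {b y} → (y < b × low y ≡ true) ⊎ (b < y × low y ≡ false) → (y <ᵇ b) ≡ low y
      lt (inj₁ (h , q)) = <ᵇ-true h ⊙ sym q
      lt (inj₂ (h , q)) = <ᵇ-false (<⇒≤ h) ⊙ sym q
      gt : ∀ {b y} → (y < b × low y ≡ true) ⊎ (b < y × low y ≡ false) → (b <ᵇ y) ≡ not (low y)
      gt (inj₁ (h , q)) = <ᵇ-false (<⇒≤ h) ⊙ sym (cong not q)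
      gt (inj₂ (h , q)) = <ᵇ-true h ⊙ sym (cong not q)

    placed-∷ : placed D + length (block c) ≡ placed (c ∷ D)
    placed-∷ = cong (placed D +_) (length-map _ (B c)) ⊙ sym (count-∨ (λ x → not (memb x κ) ∧ cellIn D x) inC π disj) ⊙ count-cong π (λ {x} _ → pt x)
      where
      disj : ∀ {x} → x ∈ π → not (memb x κ) ∧ cellIn D x ≡ true → inC x ≡ true → ⊥
      disj {x} _ s t = true≢false (proj₂ (∧-true⁻ s)) (cur-notD {x} (ceq-true⁻ {cellOf π κ x} (proj₂ (∧-true⁻ {not (memb x κ)} t))))
      pt : ∀ x → (not (memb x κ) ∧ cellIn D x) ∨ inC x ≡ not (memb x κ) ∧ cellIn (c ∷ D) x
      pt x with memb x κ
      ... | true = refl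
      ... | false = ∨-comm (cellIn D x) (ceq (cellOf π κ x) c)

  -- Rebuilds π from its kernel, the cells of D being already filled.
  reassemble : ∀ D cs → Unique cs → AllPairs _≼_ cs → (∀ {d c} → d ∈ D → c ∈ cs → d ≼ c × d ≢ c) → (∀ {c} → c ∈ cs → c ∈ feasibleCells ρ) →
    (∀ {x} → x ∈ π → x ∉ κ → cellOf π κ x ∈ D ⊎ cellOf π κ x ∈ cs) → asm (std (A D)) (placed D) cs (map block cs) ≡ π
  reassemble D [] _ _ _ _ cov = cong std (filter-all (upTo-cells D) π all) ⊙ std-id pπ
    where
    all : ∀ {x} → x ∈ π → upTo-cells D x ≡ true
    all {x} m with memb x κ in q
    ... | true = refl
    ... | false with cov m (memb-false⁻ {x} {κ} q)
    ... | inj₁ d = cellIn⁺ {D} {x} d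
  reassemble D (c@(m , l) ∷ cs) (n ∷ u) (h ∷ hs) dc fc cov =
    cong₂ (λ w N → asm w N cs (map block cs)) S.insert-block S.placed-∷ ⊙ reassemble (c ∷ D) cs u hs dc′ (fc ∘ there) cov′
    where
    bounds = ∈-feasibleCells⁻ {ρ} (fc (here refl))
    module S = Step D m l (λ q → proj₂ (dc q (here refl)) refl) (λ q → proj₁ (dc q (here refl)))
      (≤-trans (m∸n≤m m 1) (proj₂ (proj₁ bounds))) (∸-monoˡ-≤ 1 (proj₂ (proj₁ (proj₂ bounds))))
    dc′ : ∀ {d c′} → d ∈ c ∷ D → c′ ∈ cs → d ≼ c′ × d ≢ c′
    dc′ (here refl) k = All.lookup h k , All.lookup n k
    dc′ (there q) k = dc q (there k)
    cov′ : ∀ {x} → x ∈ π → x ∉ κ → cellOf π κ x ∈ c ∷ D ⊎ cellOf π κ x ∈ cs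
    cov′ a b with cov a b
    ... | inj₁ q = inj₁ (there q)
    ... | inj₂ (here q) = inj₁ (here q)
    ... | inj₂ (there q) = inj₂ q

  blocks : List (List ℕ)
  blocks = map block (feasibleCells ρ)

  blocks-perm : All IsPerm blocks
  blocks-perm = AllP.map⁺ (All.tabulate (λ {c} _ → std-perm (filterᵇ-Unique (inCell π κ c) uπ)))

  decomposition : asm ρ 0 (feasibleCells ρ) blocks ≡ π
  decomposition = cong₂ (λ w N → asm (std w) N (feasibleCells ρ) blocks) (sym A[]) (sym placed[]) ⊙
      reassemble [] (feasibleCells ρ) (feasibleCells-Unique ρ) (KernelShape.cells-chain (Ker-shape pπ K)) (λ ()) id (λ a b → inj₂ (NonKernel.cell∈ a b))
    where
    A[] : A [] ≡ κ
    A[] = filter-cong π (λ m → ∨-identityʳ _ ⊙ memb-mark m) ⊙ sym K.sub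
    placed[] : placed [] ≡ 0
    placed[] = count-none _ π (λ _ → ∧-zeroʳ _)

-- Enumeration of the permutations with a given kernel shape

-- A triple that meets `S` has an entry there already, so adjoining two entries completes it; it is
-- then dropped from `os`, and `n` decreases. When no remaining triple meets `S`, the set is closed.
merge : ∀ n os S → length os ≡ n → ∃ λ T → (∀ {x} → x ∈ S → x ∈ T) × ClosedPos os (_∈ T) × length T ≤ length S + 2 * n
merge n os S len with any (λ { (i , j , k) → memb i S ∨ memb j S ∨ memb k S }) os in touched
... | false = S , id , (λ {i} {j} {k} m t → true≢false (any-true _ m (Touch-memb {i} {j} {k} S t)) touched) , m≤m+n _ _
merge n os S len | true with any-true⁻ _ os touched
... | (i , j , k) , m , t with ∈-∃++ m
merge zero _ S len | true | (i , j , k) , m , t | xs , ys , refl = ⊥-elim (0≢1+n (sym len ⊙ length-++ xs ⊙ +-suc (length xs) (length ys)))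
merge (suc n) _ S len | true | (i , j , k) , m , t | xs , ys , refl = add (memb-Touch {i} {j} {k} S t)
  where
  os′ = xs ++ ys
  extend : ∀ x y → (∀ {T : List ℕ} → (∀ {z} → z ∈ x ∷ y ∷ S → z ∈ T) → Full (_∈ T) i j k) →
    ∃ λ T → (∀ {x} → x ∈ S → x ∈ T) × ClosedPos (xs ++ (i , j , k) ∷ ys) (_∈ T) × length T ≤ length S + 2 * suc n
  extend x y full with merge n os′ (x ∷ y ∷ S) (suc-injective (sym (length-++ xs ⊙ +-suc (length xs) (length ys) ⊙ cong suc (sym (length-++ xs))) ⊙ len))
  ... | T , S⊆T , cl , le = T , (λ m → S⊆T (there (there m))) , cl′ , ≤-trans le (≤-reflexive (solve 2 (λ s n → con 2 :+ s :+ con 2 :* n := s :+ con 2 :* (con 1 :+ n)) refl (length S) n))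
    where
    cl′ : ClosedPos (xs ++ (i , j , k) ∷ ys) (_∈ T)
    cl′ o with ∈-++⁻ xs o
    ... | inj₁ a = cl (∈-++⁺ˡ a)
    ... | inj₂ (here refl) = λ _ → full S⊆T
    ... | inj₂ (there b) = cl (∈-++⁺ʳ xs b)
  add : Touch (_∈ S) i j k → _
  add (inj₁ q) = extend j k (λ s → s (there (there q)) , s (here refl) , s (there (here refl)))
  add (inj₂ (inj₁ q)) = extend i k (λ s → s (here refl) , s (there (there q)) , s (there (here refl)))
  add (inj₂ (inj₂ q)) = extend i j (λ s → s (here refl) , s (there (here refl)) , s (there (there q)))

-- Every occurrence merged into the component of the maximum adds at most two entries.
KP-size : ∀ {ρ} → KP ρ → length ρ ≤ suc (2 * c132 ρ)
KP-size {ρ} kp with merge (c132 ρ) (occ132 ρ) (pos ρ (length ρ ∸ 1) ∷ []) refl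
... | T , S⊆T , cl , le = ≤-trans (subst (_≤ length T) (length-upTo (length ρ)) (Unique-⊆⇒length≤ T (UP.upTo⁺ (length ρ)) sub)) le
  where
  open KP kp
  sub : ∀ {i} → i ∈ upTo (length ρ) → i ∈ T
  sub {i} m = subst (_∈ T) (pos-at (proj₁ perm) (∈-upTo⁻ m))
    (Ker.least ker (λ z → pos ρ z ∈ T) (S⊆T (here refl)) (λ o → cl (Occ⇒occ132 o)) (at∈ ρ (∈-upTo⁻ m)))

upTo-perm : ∀ n → IsPerm (upTo n)
upTo-perm n = UP.upTo⁺ n , λ m → subst (_ <_) (sym (length-upTo n)) (∈-upTo⁻ m)

kernelShape-unique : ∀ {w κ} → IsPerm w → 0 < length w → Ker (length w ∸ 1) w κ → kernelShape w ≡ std κ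
kernelShape-unique p h K = cong std (Ker-unique (kernel-Ker p h) K)

kernelShape-KP : ∀ {w} → IsPerm w → 0 < length w → KP (kernelShape w)
kernelShape-KP p h = Ker-shape p (kernel-Ker p h)

-- Appending small entries after a kernel permutation does not change its kernel.
pad : ∀ {ρ} → KP ρ → ∀ t → ∃ λ w → IsPerm w × length w ≡ length ρ + t × kernelShape w ≡ ρ
pad {ρ} kp t = W , pW , lenW , kernelShape-unique pW (subst (0 <_) (sym lenW) (≤-trans nonempty (m≤m+n _ t))) kerW ⊙ std-map g ρ (lift-Mono 0 (length α) ρ) ⊙ std-id perm
  where
  open KP kp
  α = upTo t
  g = lift 0 (length α)
  W = insB (length ρ) 0 α ρ
  module I = Insertion perm (upTo-perm t) {length ρ} {0} ≤-refl
  pW : IsPerm W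
  pW = I.perm z≤n
  lenW : length W ≡ length ρ + t
  lenW = length-insB (length ρ) 0 α ρ ⊙ cong (length ρ +_) (length-upTo t)
  feas : Feas ρ (length ρ) 0
  feas = record { LL = λ _ _ → z≤n ; UR = λ m _ _ _ h _ → ⊥-elim (<⇒≱ (pos< m) h) }
  top : g (length ρ ∸ 1) ≡ length W ∸ 1
  top = sym (+-∸-assoc (length α) nonempty) ⊙ cong (_∸ 1) (+-comm (length α) (length ρ) ⊙ sym (length-insB (length ρ) 0 α ρ))
  kerW : Ker (length W ∸ 1) W (map g ρ)
  kerW = subst (λ z → Ker z W (map g ρ)) top (I.Ker-insB feas ker)

-- The list of all permutations of a given length

∈-insertions⁻ : ∀ {x z} ys → z ∈ insertions x ys → ∃₂ λ us vs → ys ≡ us ++ vs × z ≡ us ++ x ∷ vs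
∈-insertions⁻ [] (here refl) = [] , [] , refl , refl
∈-insertions⁻ (y ∷ ys) (here refl) = [] , y ∷ ys , refl , refl
∈-insertions⁻ (y ∷ ys) (there m) with ∈-map⁻ (y ∷_) m
... | z , m′ , refl with ∈-insertions⁻ ys m′
... | us , vs , refl , refl = y ∷ us , vs , refl , refl

∈-insertions⁺ : ∀ {x} us vs → us ++ x ∷ vs ∈ insertions x (us ++ vs)
∈-insertions⁺ [] [] = here refl
∈-insertions⁺ [] (v ∷ vs) = here refl
∈-insertions⁺ (u ∷ us) vs = there (∈-map⁺ (u ∷_) (∈-insertions⁺ us vs))

length-mid : ∀ {A : Set} (us : List A) x vs → length (us ++ x ∷ vs) ≡ suc (length (us ++ vs))
length-mid us x vs = PP.↭-length (PP.shift x us vs)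

Unique-mid : ∀ {A : Set} (us : List A) {x vs} → Unique (us ++ vs) → x ∉ us ++ vs → Unique (us ++ x ∷ vs)
Unique-mid us {x} {vs} u n with ++-Unique⁻ us u
... | a , b , c = Unique-++ a (All.tabulate (λ m e → n (∈-++⁺ʳ us (subst (_∈ vs) (sym e) m))) ∷ b) d
  where
  d : ∀ {y} → y ∈ us → y ∈ x ∷ vs → ⊥
  d m (here refl) = n (∈-++⁺ˡ m)
  d m (there k) = c m k

perms-sound : ∀ {w} n → w ∈ perms n → IsPerm w × length w ≡ n
perms-sound zero (here refl) = ([] , λ ()) , refl
perms-sound (suc n) m with ∈-concatMap⁻′ (insertions n) (perms n) m
... | y , my , mi with perms-sound n my | ∈-insertions⁻ y mi
... | (u , b) , len | us , vs , refl , refl = (Unique-mid us u (λ k → <-irrefl (sym len) (b k)) , bound) , lw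
  where
  lw : length (us ++ n ∷ vs) ≡ suc n
  lw = length-mid us n vs ⊙ cong suc len
  bound : ∀ {x} → x ∈ us ++ n ∷ vs → x < length (us ++ n ∷ vs)
  bound {x} k with PP.∈-resp-↭ (PP.shift n us vs) k
  ... | here refl = subst (x <_) (sym lw) ≤-refl
  ... | there k′ = subst (x <_) (sym lw ) (m≤n⇒m≤1+n (subst (x <_) len (b k′)))

perms-complete : ∀ {w} n → IsPerm w → length w ≡ n → w ∈ perms n
perms-complete {[]} zero p l = here refl
perms-complete {w} (suc n) p@(u , b) l with ∈-∃++ (IsPerm-∈ {x = n} p (subst (n <_) (sym l) ≤-refl))
... | us , vs , refl = ∈-concatMap⁺′ (insertions n) (perms-complete n (u′ , bound) len) (∈-insertions⁺ us vs)
  where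
  u′ = proj₁ (Unique-mid⁻ us u)
  len : length (us ++ vs) ≡ n
  len = suc-injective (sym (length-mid us n vs) ⊙ l)
  bound : ∀ {x} → x ∈ us ++ vs → x < length (us ++ vs)
  bound {x} k = subst (x <_) (sym len) (≤∧≢⇒< (≤-pred (subst (x <_) l (b (PP.∈-resp-↭ (↭-sym (PP.shift n us vs)) (there k)))))
    (λ { refl → proj₂ (Unique-mid⁻ us u) k }))

Unique-concatMap : ∀ {A B : Set} (h : A → List B) {xs} → Unique xs → (∀ {x} → x ∈ xs → Unique (h x)) →
  (∀ {x y z} → x ∈ xs → y ∈ xs → z ∈ h x → z ∈ h y → x ≡ y) → Unique (concatMap h xs)
Unique-concatMap h [] a b = []
Unique-concatMap h {x ∷ xs} (n ∷ u) a b = Unique-++ (a (here refl)) (Unique-concatMap h u (a ∘ there) (λ p q → b (there p) (there q))) dis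
  where
  dis : ∀ {z} → z ∈ h x → z ∈ concatMap h xs → ⊥
  dis p q with ∈-concatMap⁻′ h xs q
  ... | y , my , mz = All.lookup n my (b (here refl) (there my) p mz)

insertions-Unique : ∀ {x} ys → x ∉ ys → Unique (insertions x ys)
insertions-Unique [] n = [] ∷ []
insertions-Unique {x} (y ∷ ys) n = All.tabulate neq ∷ Unique-map (y ∷_) (λ _ _ → ∷-injectiveʳ) (insertions-Unique ys (n ∘ there))
  where
  neq : ∀ {z} → z ∈ map (y ∷_) (insertions x ys) → x ∷ y ∷ ys ≢ z
  neq m refl with ∈-map⁻ (y ∷_) m
  ... | _ , _ , q = n (here (∷-injectiveˡ q))

delete : ℕ → List ℕ → List ℕ
delete n = filterᵇ (λ y → not (y ≡ᵇ n))

-- Deleting the largest letter recovers the shorter permutation, so the lists concatenated in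
-- `perms (suc n)` are disjoint.
delete-insertions : ∀ {n z} ys → n ∉ ys → z ∈ insertions n ys → delete n z ≡ ys
delete-insertions {n} ys h m with ∈-insertions⁻ ys m
... | us , vs , refl , refl = filter-++ᵇ q us (n ∷ vs) ⊙ cong₂ _++_ (filter-all q us (λ k → ok (∈-++⁺ˡ k)))
    (filter-false q {n} {vs} (cong not (≡ᵇ-true {n} refl)) ⊙ filter-all q vs (λ k → ok (∈-++⁺ʳ us k)))
  where
  q = λ y → not (y ≡ᵇ n)
  ok : ∀ {y} → y ∈ us ++ vs → q y ≡ true
  ok {y} k = cong not (≡ᵇ-false {y} {n} (λ { refl → h k }))

perms-Unique : ∀ n → Unique (perms n)
perms-Unique zero = [] ∷ []
perms-Unique (suc n) = Unique-concatMap (insertions n) (perms-Unique n) (λ m → insertions-Unique _ (fresh m))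
    (λ {x} {y} mx my p q → sym (delete-insertions x (fresh mx) p) ⊙ delete-insertions y (fresh my) q)
  where
  fresh : ∀ {w} → w ∈ perms n → n ∉ w
  fresh m k = let (_ , b) , len = perms-sound n m in <-irrefl (sym len) (b k)

-- Tuples of blocks of given total size

-- The recursion follows that of `prodS` and `_⊛_`: the first block takes size `i` and the others
-- share `N ∸ i`. This lets `prodS-∑` proceed by induction.
tuples : ℕ → ℕ → List (List (List ℕ))
tuples zero    N = if N ≡ᵇ 0 then [] ∷ [] else []
tuples (suc k) N = concatMap (λ i → concatMap (λ α → map (α ∷_) (tuples k (N ∸ i))) (perms i)) (upTo (suc N))

record IsTuple (k N : ℕ) (αs : List (List ℕ)) : Set where
  constructor tuple
  field
    count : length αs ≡ k
    perm  : All IsPerm αs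
    size  : sumBy length αs ≡ N

∈-tuples⁻ : ∀ {αs} k N → αs ∈ tuples k N → IsTuple k N αs
∈-tuples⁻ zero zero (here refl) = tuple refl [] refl
∈-tuples⁻ (suc k) N m with ∈-concatMap⁻′ _ (upTo (suc N)) m
... | i , mi , m₁ with ∈-concatMap⁻′ _ (perms i) m₁
... | α , mα , m₂ with ∈-map⁻ (α ∷_) m₂
... | αs , m₃ , refl with perms-sound i mα | ∈-tuples⁻ k (N ∸ i) m₃
... | p , l | tuple c ps s = tuple (cong suc c) (p ∷ ps) (cong₂ _+_ l s ⊙ m+[n∸m]≡n (≤-pred (∈-upTo⁻ mi)))

∈-tuples⁺ : ∀ {αs k N} → IsTuple k N αs → αs ∈ tuples k N
∈-tuples⁺ {[]} (tuple refl [] refl) = here refl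
∈-tuples⁺ {α ∷ αs} (tuple refl (p ∷ ps) refl) = ∈-concatMap⁺′ (λ i → concatMap (λ β → map (β ∷_) (tuples (length αs) (length α + sumBy length αs ∸ i))) (perms i)) (∈-upTo⁺ (s≤s (m≤m+n (length α) _)))
  (∈-concatMap⁺′ (λ β → map (β ∷_) (tuples (length αs) (length α + sumBy length αs ∸ length α))) (perms-complete (length α) p refl)
    (∈-map⁺ (α ∷_) (∈-tuples⁺ (tuple refl ps (sym (m+n∸m≡n (length α) (sumBy length αs)))))))

tuples-Unique : ∀ k N → Unique (tuples k N)
tuples-Unique zero zero = [] ∷ []
tuples-Unique zero (suc N) = []
tuples-Unique (suc k) N = Unique-concatMap _ (UP.upTo⁺ (suc N))
    (λ {i} _ → Unique-concatMap _ (perms-Unique i) (λ {α} _ → Unique-map (α ∷_) (λ _ _ → ∷-injectiveʳ) (tuples-Unique k (N ∸ i)))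
      (λ {α} {β} _ _ p q → heads {α} {β} {N ∸ i} {N ∸ i} p q)) sizes
  where
  heads : ∀ {α β N₁ N₂ z} → z ∈ map (α ∷_) (tuples k N₁) → z ∈ map (β ∷_) (tuples k N₂) → α ≡ β
  heads {α} {β} p q with ∈-map⁻ (α ∷_) p | ∈-map⁻ (β ∷_) q
  ... | _ , _ , refl | _ , _ , e′ = ∷-injectiveˡ e′
  sizes : ∀ {i j z} → i ∈ upTo (suc N) → j ∈ upTo (suc N) → z ∈ concatMap (λ α → map (α ∷_) (tuples k (N ∸ i))) (perms i) →
    z ∈ concatMap (λ α → map (α ∷_) (tuples k (N ∸ j))) (perms j) → i ≡ j
  sizes {i} {j} _ _ p q with ∈-concatMap⁻′ _ (perms i) p | ∈-concatMap⁻′ _ (perms j) q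
  ... | α , mα , p′ | β , mβ , q′ with heads {α} {β} {N ∸ i} {N ∸ j} p′ q′
  ... | refl = sym (proj₂ (perms-sound i mα)) ⊙ proj₂ (perms-sound j mβ)

K⁻ : ∀ t {ρ} → ρ ∈ K t → ∃ λ w → w ∈ perms t × ρ ≡ kernelShape w
K⁻ t m = ∈-map⁻ kernelShape (∈-deduplicate⁻ (≡-dec _≟_) (map kernelShape (perms t)) m)

K⁺ : ∀ t {w ρ} → w ∈ perms t → kernelShape w ≡ ρ → ρ ∈ K t
K⁺ t m eq = ∈-deduplicate⁺ (≡-dec _≟_) (subst (_∈ map kernelShape (perms t)) eq (∈-map⁺ kernelShape m))

K-Unique : ∀ t → Unique (K t)
K-Unique t = deduplicate-! (map kernelShape (perms t))

K-sound : ∀ t {ρ} → 0 < t → ρ ∈ K t → KP ρ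
K-sound t {ρ} t>0 m = from (K⁻ t m)
  where
  from : (∃ λ w → w ∈ perms t × ρ ≡ kernelShape w) → KP ρ
  from (w , mw , eq) = subst KP (sym eq) (kernelShape-KP (proj₁ (perms-sound t mw)) (subst (0 <_) (sym (proj₂ (perms-sound t mw))) t>0))

-- By `KP-size` the shape has at most `t` entries, so it can be padded to length exactly `t`.
K-complete : ∀ t {ρ} → KP ρ → suc (2 * c132 ρ) ≤ t → ρ ∈ K t
K-complete t {ρ} kp h = from (pad kp (t ∸ length ρ))
  where
  from : (∃ λ w → IsPerm w × length w ≡ length ρ + (t ∸ length ρ) × kernelShape w ≡ ρ) → ρ ∈ K t
  from (w , pw , len , ks) = K⁺ t (perms-complete t pw (len ⊙ m+[n∸m]≡n (≤-trans (KP-size kp) h))) ks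

-- Gluing blocks into a kernel permutation as a bijection

glue : List ℕ → List (List ℕ) → List ℕ
glue ρ αs = asm ρ 0 (feasibleCells ρ) αs

-- For `n < sz ρ` the truncated difference is 0 and would admit the tuple of empty blocks, whose
-- glued word is too long. The test agrees with the one in `shift`.
fillings : ℕ → List ℕ → List (List (List ℕ))
fillings n ρ = if n <ᵇ sz ρ then [] else tuples (f ρ) (n ∸ sz ρ)

glue-Assembled : ∀ {ρ αs N} → KP ρ → IsTuple (f ρ) N αs → Assembled ρ ρ 0 (feasibleCells ρ) αs (glue ρ αs)
glue-Assembled {ρ} {αs} kp (tuple c ps _) = assemble (feasibleCells ρ) αs perm nonempty ker (All.tabulate (KernelShape.slot kp)) (KernelShape.cells-chain kp) ps c
  where open KP kp

glue-nonempty : ∀ {ρ αs N} → KP ρ → IsTuple (f ρ) N αs → 0 < length (glue ρ αs)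
glue-nonempty kp t = subst (0 <_) (sym (Assembled.len (glue-Assembled kp t))) (≤-trans (KP.nonempty kp) (m≤m+n _ _))

glue-shape : ∀ {ρ αs N} → KP ρ → IsTuple (f ρ) N αs → kernelShape (glue ρ αs) ≡ ρ
glue-shape kp t = kernelShape-unique A.perm (glue-nonempty kp t) A.ker ⊙ A.shp ⊙ std-id (KP.perm kp)
  where module A = Assembled (glue-Assembled kp t)

-- The glued word determines its kernel letters and thereby the number of entries in each cell.
-- These numbers fix the block lengths, after which the insertions can be undone.
glue-injective : ∀ {ρ αs βs N N′} → KP ρ → IsTuple (f ρ) N αs → IsTuple (f ρ) N′ βs → glue ρ αs ≡ glue ρ βs → αs ≡ βs
glue-injective {ρ} {αs} {βs} kp t t′ e = proj₁ (asm-injective (feasibleCells ρ) αs βs (IsTuple.count t)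
    (sizeAt-determines (feasibleCells ρ) αs βs (feasibleCells-Unique ρ) (IsTuple.count t) (IsTuple.count t′) (λ {c} _ → same c)) refl e)
  where
  module A = Assembled (glue-Assembled {ρ} {αs} kp t)
  module B = Assembled (glue-Assembled {ρ} {βs} kp t′)
  kernels : A.κ′ ≡ B.κ′
  kernels = Ker-unique A.ker (subst (λ w → Ker (length w ∸ 1) w B.κ′) (sym e) B.ker)
  same : ∀ c → sizeAt c (feasibleCells ρ) αs ≡ sizeAt c (feasibleCells ρ) βs
  same c = +-cancelˡ-≡ (csize ρ ρ c) _ _ (sym (A.csz c) ⊙ cong₂ (λ w κ → csize w κ c) e kernels ⊙ B.csz c)

glued : ℕ → ℕ → List (List ℕ)
glued t n = concatMap (λ ρ → map (glue ρ) (fillings n ρ)) (K t)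

fillings-sound : ∀ {n ρ αs} → αs ∈ fillings n ρ → sz ρ ≤ n × IsTuple (f ρ) (n ∸ sz ρ) αs
fillings-sound {n} {ρ} m with n <ᵇ sz ρ in q
... | false = <ᵇ-false⁻ q , ∈-tuples⁻ (f ρ) (n ∸ sz ρ) m

fillings-complete : ∀ {n ρ αs} → sz ρ ≤ n → IsTuple (f ρ) (n ∸ sz ρ) αs → αs ∈ fillings n ρ
fillings-complete {n} {ρ} h t rewrite <ᵇ-false h = ∈-tuples⁺ t

module _ (t : ℕ) (t>0 : 0 < t) (n : ℕ) where
  private
    blocksOf : List ℕ → List (List ℕ)
    blocksOf ρ = map (glue ρ) (fillings n ρ)

    kp : ∀ {ρ} → ρ ∈ K t → KP ρ
    kp = K-sound t t>0

  fillings-Unique : ∀ ρ → Unique (fillings n ρ)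
  fillings-Unique ρ with n <ᵇ sz ρ
  ... | true = []
  ... | false = tuples-Unique (f ρ) (n ∸ sz ρ)

  shape-of : ∀ {ρ z} → ρ ∈ K t → z ∈ blocksOf ρ → kernelShape z ≡ ρ
  shape-of {ρ} {z} m p = from (∈-map⁻ (glue ρ) p)
    where
    from : (∃ λ αs → αs ∈ fillings n ρ × z ≡ glue ρ αs) → kernelShape z ≡ ρ
    from (αs , mα , eq) = cong kernelShape eq ⊙ glue-shape {ρ} {αs} (kp m) (proj₂ (fillings-sound {n} {ρ} mα))

  glued-Unique : Unique (glued t n)
  glued-Unique = Unique-concatMap blocksOf (K-Unique t)
    (λ {ρ} m → Unique-map (glue ρ) (λ {αs} {βs} p q → glue-injective {ρ} {αs} {βs} (kp m) (proj₂ (fillings-sound {n} {ρ} p)) (proj₂ (fillings-sound {n} {ρ} q))) (fillings-Unique ρ))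
    (λ mρ mσ p q → sym (shape-of mρ p) ⊙ shape-of mσ q)

  glued-sound : ∀ {π} → π ∈ glued t n → π ∈ perms n
  glued-sound {π} m = from (∈-concatMap⁻′ blocksOf (K t) m)
    where
    from′ : ∀ {ρ} → KP ρ → (∃ λ αs → αs ∈ fillings n ρ × π ≡ glue ρ αs) → π ∈ perms n
    from′ {ρ} k (αs , mα , eq) = subst (_∈ perms n) (sym eq) (perms-complete n A.perm
        (A.len ⊙ cong (length ρ +_) (IsTuple.size (proj₂ (fillings-sound {n} {ρ} mα))) ⊙ m+[n∸m]≡n (proj₁ (fillings-sound {n} {ρ} mα))))
      where module A = Assembled (glue-Assembled {ρ} {αs} k (proj₂ (fillings-sound {n} {ρ} mα)))
    from : (∃ λ ρ → ρ ∈ K t × π ∈ blocksOf ρ) → π ∈ perms n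
    from (ρ , mρ , p) = from′ (kp mρ) (∈-map⁻ (glue ρ) p)

  glued-complete : ∀ {π} → 1 ≤ c132 π → suc (2 * c132 π) ≤ t → π ∈ perms n → π ∈ glued t n
  glued-complete {π} c≥1 c≤ m = ∈-concatMap⁺′ blocksOf (K-complete t kρ (≤-trans (s≤s (*-monoʳ-≤ 2 cap≤)) c≤))
      (subst (_∈ blocksOf ρ) D.decomposition (∈-map⁺ (glue ρ) fill))
    where
    pπ = proj₁ (perms-sound n m)
    len = proj₂ (perms-sound n m)
    -- A permutation containing an occurrence has a maximum, so its kernel exists.
    nonempty : ∀ w → 1 ≤ c132 w → 0 < length w
    nonempty (x ∷ w) h = s≤s z≤n
    ne = nonempty π c≥1
    ρ = kernelShape π
    kρ : KP ρ
    kρ = kernelShape-KP pπ ne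
    module D = Decompose pπ (kernel-Ker pπ ne)
    t₀ : IsTuple (f ρ) (sumBy length D.blocks) D.blocks
    t₀ = tuple (length-map D.block (feasibleCells ρ)) D.blocks-perm refl
    module A = Assembled (glue-Assembled {ρ} {D.blocks} kρ t₀)
    size : length ρ + sumBy length D.blocks ≡ n
    size = sym A.len ⊙ cong length D.decomposition ⊙ len
    cap≤ : c132 ρ ≤ c132 π
    cap≤ = subst (c132 ρ ≤_) (sym A.c≡ ⊙ cong c132 D.decomposition) (m≤m+n _ _)
    fill : D.blocks ∈ fillings n ρ
    fill = fillings-complete {n} {ρ} (subst (sz ρ ≤_) size (m≤m+n _ _))
      (tuple (IsTuple.count t₀) D.blocks-perm (sym (m+n∸m≡n (length ρ) _) ⊙ cong (_∸ length ρ) size))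

  -- The comparison is restricted to exactly `r` occurrences: permutations with more of them may
  -- have shapes that `K t` does not contain.
  glued-↭ : ∀ r → 1 ≤ r → suc (2 * r) ≤ t → filterᵇ (λ π → c132 π ≡ᵇ r) (perms n) ↭ filterᵇ (λ π → c132 π ≡ᵇ r) (glued t n)
  glued-↭ r r≥1 r≤ = ∼bag⇒↭ (unique∧set⇒bag (filterᵇ-Unique q (perms-Unique n)) (filterᵇ-Unique q glued-Unique) (mk⇔ to from))
    where
    q = λ π → c132 π ≡ᵇ r
    to : ∀ {π} → π ∈ filterᵇ q (perms n) → π ∈ filterᵇ q (glued t n)
    to {π} m = ∈-filterᵇ⁺ (glued-complete (subst (1 ≤_) (sym eq) r≥1) (subst (λ z → suc (2 * z) ≤ t) (sym eq) r≤) (proj₁ s)) (proj₂ s)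
      where
      s = ∈-filterᵇ⁻ q (perms n) m
      eq : c132 π ≡ r
      eq = ≡ᵇ-true⁻ (proj₂ s)
    from : ∀ {π} → π ∈ filterᵇ q (glued t n) → π ∈ filterᵇ q (perms n)
    from {π} m = ∈-filterᵇ⁺ (glued-sound (proj₁ s)) (proj₂ s)
      where s = ∈-filterᵇ⁻ q (glued t n) m

-- Generating functions

∑ : ∀ {A : Set} → List A → (A → ℤ) → ℤ
∑ []       h = 0ℤ
∑ (x ∷ xs) h = h x +ᶻ ∑ xs h

∑-cong : ∀ {A : Set} {h g : A → ℤ} xs → (∀ {x} → x ∈ xs → h x ≡ g x) → ∑ xs h ≡ ∑ xs g
∑-cong [] eq = refl
∑-cong (x ∷ xs) eq = cong₂ _+ᶻ_ (eq (here refl)) (∑-cong xs (eq ∘ there))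

∑-++ : ∀ {A : Set} (h : A → ℤ) xs ys → ∑ (xs ++ ys) h ≡ ∑ xs h +ᶻ ∑ ys h
∑-++ h [] ys = sym (ℤP.+-identityˡ _)
∑-++ h (x ∷ xs) ys = cong (h x +ᶻ_) (∑-++ h xs ys) ⊙ sym (ℤP.+-assoc (h x) (∑ xs h) (∑ ys h))

∑-map : ∀ {A B : Set} (k : A → B) (h : B → ℤ) xs → ∑ (map k xs) h ≡ ∑ xs (h ∘ k)
∑-map k h [] = refl
∑-map k h (x ∷ xs) = cong (h (k x) +ᶻ_) (∑-map k h xs)

∑-concatMap : ∀ {A B : Set} (k : A → List B) (h : B → ℤ) xs → ∑ (concatMap k xs) h ≡ ∑ xs (λ x → ∑ (k x) h)
∑-concatMap k h [] = refl
∑-concatMap k h (x ∷ xs) = ∑-++ h (k x) (concatMap k xs) ⊙ cong (∑ (k x) h +ᶻ_) (∑-concatMap k h xs)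

∑-zero : ∀ {A : Set} {h : A → ℤ} xs → (∀ {x} → x ∈ xs → h x ≡ 0ℤ) → ∑ xs h ≡ 0ℤ
∑-zero [] eq = refl
∑-zero (x ∷ xs) eq = cong₂ _+ᶻ_ (eq (here refl)) (∑-zero xs (eq ∘ there))

∑-*ˡ : ∀ {A : Set} c (h : A → ℤ) xs → ∑ xs (λ x → c *ᶻ h x) ≡ c *ᶻ ∑ xs h
∑-*ˡ c h [] = sym (ℤP.*-zeroʳ c)
∑-*ˡ c h (x ∷ xs) = cong (c *ᶻ h x +ᶻ_) (∑-*ˡ c h xs) ⊙ sym (ℤP.*-distribˡ-+ c (h x) (∑ xs h))

∑-*ʳ : ∀ {A : Set} (h : A → ℤ) c xs → ∑ xs h *ᶻ c ≡ ∑ xs (λ x → h x *ᶻ c)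
∑-*ʳ h c xs = ℤP.*-comm (∑ xs h) c ⊙ sym (∑-*ˡ c h xs) ⊙ ∑-cong xs (λ {x} _ → ℤP.*-comm c (h x))

∑-+ : ∀ {A : Set} (h g : A → ℤ) xs → ∑ xs (λ x → h x +ᶻ g x) ≡ ∑ xs h +ᶻ ∑ xs g
∑-+ h g [] = refl
∑-+ h g (x ∷ xs) = cong (h x +ᶻ g x +ᶻ_) (∑-+ h g xs) ⊙
  ZS.solve 4 (λ a b c d → (a ZS.:+ b) ZS.:+ (c ZS.:+ d) ZS.:= (a ZS.:+ c) ZS.:+ (b ZS.:+ d)) refl (h x) (g x) (∑ xs h) (∑ xs g)

∑-swap : ∀ {A B : Set} (h : A → B → ℤ) xs ys → ∑ xs (λ x → ∑ ys (h x)) ≡ ∑ ys (λ y → ∑ xs (λ x → h x y))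
∑-swap h [] ys = sym (∑-zero ys (λ _ → refl))
∑-swap h (x ∷ xs) ys = cong (∑ ys (h x) +ᶻ_) (∑-swap h xs ys) ⊙ sym (∑-+ (h x) (λ y → ∑ xs (λ x → h x y)) ys)

∑-↭ : ∀ {A : Set} (h : A → ℤ) {xs ys : List A} → xs ↭ ys → ∑ xs h ≡ ∑ ys h
∑-↭ h _↭_.refl = refl
∑-↭ h (_↭_.prep x p) = cong (h x +ᶻ_) (∑-↭ h p)
∑-↭ h (_↭_.swap {xs} x y p) = sym (ℤP.+-assoc (h x) (h y) (∑ xs h)) ⊙ cong₂ _+ᶻ_ (ℤP.+-comm (h x) (h y)) (∑-↭ h p) ⊙ ℤP.+-assoc (h y) (h x) _
∑-↭ h (_↭_.trans p q) = ∑-↭ h p ⊙ ∑-↭ h q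

-- The Iverson bracket, by which conditions become factors.
ι : Bool → ℤ
ι true  = 1ℤ
ι false = 0ℤ

∑-filter : ∀ {A : Set} (p : A → Bool) (h : A → ℤ) xs → ∑ (filterᵇ p xs) h ≡ ∑ xs (λ x → ι (p x) *ᶻ h x)
∑-filter p h [] = refl
∑-filter p h (x ∷ xs) with p x
... | true = cong₂ _+ᶻ_ (sym (ℤP.*-identityˡ (h x))) (∑-filter p h xs)
... | false = ∑-filter p h xs ⊙ sym (ℤP.+-identityˡ _)

∑-filter-support : ∀ {A : Set} (p : A → Bool) (h : A → ℤ) xs → (∀ x → p x ≡ false → h x ≡ 0ℤ) → ∑ (filterᵇ p xs) h ≡ ∑ xs h
∑-filter-support p h xs z = ∑-filter p h xs ⊙ ∑-cong xs (λ {x} _ → bool-case (p x)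
  (λ t → cong (λ b → ι b *ᶻ h x) t ⊙ ℤP.*-identityˡ (h x)) (λ t → cong (λ b → ι b *ᶻ h x) t ⊙ sym (z x t)))

∑-count : ∀ {A : Set} (p : A → Bool) xs → ℤ.+ countᵇ p xs ≡ ∑ xs (ι ∘ p)
∑-count p [] = refl
∑-count p (x ∷ xs) with p x
... | true = cong (1ℤ +ᶻ_) (∑-count p xs)
... | false = ∑-count p xs ⊙ sym (ℤP.+-identityˡ _)

sumS-∑ : ∀ fs n → sumS fs n ≡ ∑ fs (λ s → s n)
sumS-∑ [] n = refl
sumS-∑ (s ∷ fs) n = cong (s n +ᶻ_) (sumS-∑ fs n)

⊛-∑ : ∀ s t n → (s ⊛ t) n ≡ ∑ (upTo (suc n)) (λ i → s i *ᶻ t (n ∸ i))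
⊛-∑ s t n = go (upTo (suc n))
  where
  go : ∀ is → foldr _+ᶻ_ 0ℤ (map (λ i → s i *ᶻ t (n ∸ i)) is) ≡ ∑ is (λ i → s i *ᶻ t (n ∸ i))
  go [] = refl
  go (i ∷ is) = cong (s i *ᶻ t (n ∸ i) +ᶻ_) (go is)

beq : Bool → Bool → Bool
beq x y = not (x xor y)

χ : ℕ → Bool → Bool → List ℕ → ℤ
χ r a b π = ι (c132 π ≡ᵇ r) *ᶻ (ι (beq (odd (length π)) a) *ᶻ ι (beq (odd (inv π)) b))

half-double : ∀ c → (ℤ.+ c +ᶻ ℤ.+ c) / ℤ.+ 2 ≡ ℤ.+ c
half-double c = ℤP.*-identityˡ _ ⊙ cong ℤ.+_ (cong (ℕD._/ 2) (cong (c +_) (sym (+-identityʳ c)) ⊙ *-comm 2 c) ⊙ ℕD.m*n/n≡m c 2)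

-- The two summands agree when `n` has parity `a` and cancel otherwise, so the integer division is
-- exact in both cases.
half-parity : ∀ (s : Series) n a c → s n ≡ ℤ.+ c → half (s ⊕ scale (sgn (bit a)) (negX s)) n ≡ (if beq (odd n) a then ℤ.+ c else 0ℤ)
half-parity s n a c eq rewrite eq with odd n | a
... | false | false = cong (_/ ℤ.+ 2) (cong (ℤ.+ c +ᶻ_) (ℤP.*-identityˡ (1ℤ *ᶻ ℤ.+ c) ⊙ ℤP.*-identityˡ (ℤ.+ c))) ⊙ half-double c
... | true  | true  = cong (_/ ℤ.+ 2) (cong (ℤ.+ c +ᶻ_) (sym (ℤP.*-assoc ℤ.-1ℤ ℤ.-1ℤ (ℤ.+ c)) ⊙ ℤP.*-identityˡ (ℤ.+ c))) ⊙ half-double c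
... | true  | false = cong (_/ ℤ.+ 2) (cong (ℤ.+ c +ᶻ_) (ℤP.*-identityˡ (ℤ.-1ℤ *ᶻ ℤ.+ c) ⊙ ℤP.-1*i≡-i (ℤ.+ c)) ⊙ ℤP.+-inverseʳ (ℤ.+ c))
... | false | true  = cong (_/ ℤ.+ 2) (cong (ℤ.+ c +ᶻ_) (cong (ℤ.-1ℤ *ᶻ_) (ℤP.*-identityˡ (ℤ.+ c)) ⊙ ℤP.-1*i≡-i (ℤ.+ c)) ⊙ ℤP.+-inverseʳ (ℤ.+ c))

H-count : ∀ r a b n → H r a b n ≡ (if beq (odd n) a then ℤ.+ countᵇ (λ π → beq (odd (inv π)) b ∧ (c132 π ≡ᵇ r)) (perms n) else 0ℤ)
H-count r a false n = half-parity (E r) n a _ (cong ℤ.+_ (count-cong (perms n) (λ {π} _ → cong (_∧ (c132 π ≡ᵇ r)) (even (odd (inv π))))))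
  where
  even : ∀ x → not x ≡ beq x false
  even true = refl
  even false = refl
H-count r a true n = half-parity (O r) n a _ (cong ℤ.+_ (count-cong (perms n) (λ {π} _ → cong (_∧ (c132 π ≡ᵇ r)) (odd′ (odd (inv π))))))
  where
  odd′ : ∀ x → not (not x) ≡ beq x true
  odd′ true = refl
  odd′ false = refl

H-∑ : ∀ r a b n → H r a b n ≡ ∑ (perms n) (χ r a b)
H-∑ r a b n = H-count r a b n ⊙ go (beq (odd n) a) refl
  where
  go : ∀ t → beq (odd n) a ≡ t → (if t then ℤ.+ countᵇ (λ π → beq (odd (inv π)) b ∧ (c132 π ≡ᵇ r)) (perms n) else 0ℤ) ≡ ∑ (perms n) (χ r a b)
  go true eq = ∑-count _ (perms n) ⊙ ∑-cong (perms n) λ {π} m → pt (beq (odd (inv π)) b) (c132 π ≡ᵇ r) ⊙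
      cong (λ t → ι (c132 π ≡ᵇ r) *ᶻ (ι t *ᶻ ι (beq (odd (inv π)) b))) (sym (cong (λ z → beq (odd z) a) (proj₂ (perms-sound n m)) ⊙ eq))
    where
    pt : ∀ x y → ι (x ∧ y) ≡ ι y *ᶻ (1ℤ *ᶻ ι x)
    pt true true = refl
    pt true false = refl
    pt false true = refl
    pt false false = refl
  go false eq = sym (∑-zero (perms n) λ {π} m → cong (λ t → ι (c132 π ≡ᵇ r) *ᶻ (ι t *ᶻ ι (beq (odd (inv π)) b)))
      (cong (λ z → beq (odd z) a) (proj₂ (perms-sound n m)) ⊙ eq) ⊙ ℤP.*-zeroʳ (ι (c132 π ≡ᵇ r)))

δ : ∀ {A B : Set} → (A → B → Bool) → List A → List B → ℤ
δ t (x ∷ xs) (y ∷ ys) = ι (t x y) *ᶻ δ t xs ys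
δ t _ _ = 1ℤ

has-c132 : List ℕ → ℕ → Bool
has-c132 α r = c132 α ≡ᵇ r

has-parity : (List ℕ → Bool) → List ℕ → Bool → Bool
has-parity s α v = beq (s α) v

-- The contribution of one tuple of blocks to the coefficient of a product of series `H`: 1 if every
-- block has the prescribed statistics, 0 otherwise.
X : List (List ℕ) → List ℕ → List Bool → List Bool → ℤ
X αs rs vs us = δ has-c132 αs rs *ᶻ (δ (has-parity (odd ∘ length)) αs vs *ᶻ δ (has-parity (odd ∘ inv)) αs us)

prodS-∑ : ∀ k N rs vs us → length rs ≡ k → length vs ≡ k → length us ≡ k →
  prodS (zipWith3 H rs vs us) N ≡ ∑ (tuples k N) (λ αs → X αs rs vs us)
prodS-∑ zero zero [] [] [] _ _ _ = refl
prodS-∑ zero (suc N) [] [] [] _ _ _ = refl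
prodS-∑ (suc k) N (r ∷ rs) (v ∷ vs) (u ∷ us) e₁ e₂ e₃ =
  ⊛-∑ (H r v u) (prodS (zipWith3 H rs vs us)) N ⊙
  ∑-cong (upTo (suc N)) (λ {i} _ → cong₂ _*ᶻ_ (H-∑ r v u i) (prodS-∑ k (N ∸ i) rs vs us (suc-injective e₁) (suc-injective e₂) (suc-injective e₃)) ⊙
    ∑-*ʳ (χ r v u) _ (perms i) ⊙
    ∑-cong (perms i) (λ {α} _ → sym (∑-*ˡ (χ r v u α) _ (tuples k (N ∸ i))) ⊙
       ∑-cong (tuples k (N ∸ i)) (λ {αs} _ → rearrange (ι (has-c132 α r)) (ι (has-parity (odd ∘ length) α v)) (ι (has-parity (odd ∘ inv) α u)) (δ has-c132 αs rs) _ _) ⊙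
       sym (∑-map (α ∷_) (λ βs → X βs (r ∷ rs) (v ∷ vs) (u ∷ us)) (tuples k (N ∸ i)))) ⊙
    sym (∑-concatMap (λ α → map (α ∷_) (tuples k (N ∸ i))) _ (perms i))) ⊙
  sym (∑-concatMap (λ i → concatMap (λ α → map (α ∷_) (tuples k (N ∸ i))) (perms i)) _ (upTo (suc N)))
  where
  rearrange : ∀ a b c x y z → (a *ᶻ (b *ᶻ c)) *ᶻ (x *ᶻ (y *ᶻ z)) ≡ (a *ᶻ x) *ᶻ ((b *ᶻ y) *ᶻ (c *ᶻ z))
  rearrange = ZS.solve 6 (λ a b c x y z → (a ZS.:* (b ZS.:* c)) ZS.:* (x ZS.:* (y ZS.:* z)) ZS.:= (a ZS.:* x) ZS.:* ((b ZS.:* y) ZS.:* (c ZS.:* z))) refl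

bools-length : ∀ k {v} → v ∈ bools k → length v ≡ k
bools-length zero (here refl) = refl
bools-length (suc k) m with ∈-concatMap⁻′ (λ v → (false ∷ v) ∷ (true ∷ v) ∷ []) (bools k) m
... | v , mv , here refl = cong suc (bools-length k mv)
... | v , mv , there (here refl) = cong suc (bools-length k mv)

comps-length : ∀ N k {rs} → rs ∈ comps N k → length rs ≡ k
comps-length zero zero (here refl) = refl
comps-length N (suc k) m with ∈-concatMap⁻′ (λ r₁ → map (r₁ ∷_) (comps (N ∸ r₁) k)) (upTo (suc N)) m
... | r₁ , _ , m₁ with ∈-map⁻ (r₁ ∷_) m₁
... | rs , m₂ , refl = cong suc (comps-length (N ∸ r₁) k m₂)

-- For a fixed tuple the brackets vanish at every vector except that of its own parities. This is
-- how the sums over `v` and `u` disappear.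
∑-bools : ∀ k (s : List ℕ → Bool) αs → length αs ≡ k → (h : List Bool → ℤ) →
  ∑ (bools k) (λ v → h v *ᶻ δ (has-parity s) αs v) ≡ h (map s αs)
∑-bools zero s [] _ h = ℤP.+-identityʳ _ ⊙ ℤP.*-identityʳ (h [])
∑-bools (suc k) s (α ∷ αs) e h = ∑-concatMap (λ v → (false ∷ v) ∷ (true ∷ v) ∷ []) _ (bools k) ⊙ collapse (s α) refl
  where
  collapse : ∀ b → s α ≡ b → ∑ (bools k) (λ v → ∑ ((false ∷ v) ∷ (true ∷ v) ∷ []) (λ v → h v *ᶻ δ (has-parity s) (α ∷ αs) v)) ≡ h (s α ∷ map s αs)
  collapse false eq = ∑-cong (bools k) (λ {v} _ → cong (λ b → h (false ∷ v) *ᶻ (ι (beq b false) *ᶻ δ (has-parity s) αs v) +ᶻ (h (true ∷ v) *ᶻ (ι (beq b true) *ᶻ δ (has-parity s) αs v) +ᶻ 0ℤ)) eq ⊙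
      ZS.solve 3 (λ x y d → x ZS.:* (ZS.con 1ℤ ZS.:* d) ZS.:+ (y ZS.:* (ZS.con 0ℤ ZS.:* d) ZS.:+ ZS.con 0ℤ) ZS.:= x ZS.:* d) refl (h (false ∷ v)) (h (true ∷ v)) (δ (has-parity s) αs v)) ⊙
    ∑-bools k s αs (suc-injective e) (h ∘ (false ∷_)) ⊙ cong (λ b → h (b ∷ map s αs)) (sym eq)
  collapse true eq = ∑-cong (bools k) (λ {v} _ → cong (λ b → h (false ∷ v) *ᶻ (ι (beq b false) *ᶻ δ (has-parity s) αs v) +ᶻ (h (true ∷ v) *ᶻ (ι (beq b true) *ᶻ δ (has-parity s) αs v) +ᶻ 0ℤ)) eq ⊙
      ZS.solve 3 (λ x y d → x ZS.:* (ZS.con 0ℤ ZS.:* d) ZS.:+ (y ZS.:* (ZS.con 1ℤ ZS.:* d) ZS.:+ ZS.con 0ℤ) ZS.:= y ZS.:* d) refl (h (false ∷ v)) (h (true ∷ v)) (δ (has-parity s) αs v)) ⊙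
    ∑-bools k s αs (suc-injective e) (h ∘ (true ∷_)) ⊙ cong (λ b → h (b ∷ map s αs)) (sym eq)

∑-upTo-δ : ∀ c M (h : ℕ → ℤ) → ∑ (upTo M) (λ i → ι (c ≡ᵇ i) *ᶻ h i) ≡ (if c <ᵇ M then h c else 0ℤ)
∑-upTo-δ c zero h = refl
∑-upTo-δ zero (suc M) h = cong (λ l → ∑ l (λ i → ι (0 ≡ᵇ i) *ᶻ h i)) (upTo-suc M) ⊙
  cong₂ _+ᶻ_ (ℤP.*-identityˡ (h 0)) (∑-map suc _ (upTo M) ⊙ ∑-zero (upTo M) (λ _ → refl)) ⊙ ℤP.+-identityʳ (h 0)
∑-upTo-δ (suc c) (suc M) h = cong (λ l → ∑ l (λ i → ι (suc c ≡ᵇ i) *ᶻ h i)) (upTo-suc M) ⊙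
  ℤP.+-identityˡ _ ⊙ ∑-map suc _ (upTo M) ⊙ ∑-upTo-δ c M (h ∘ suc)

≡ᵇ-cong-+ : ∀ c x y → (c + x ≡ᵇ c + y) ≡ (x ≡ᵇ y)
≡ᵇ-cong-+ zero x y = refl
≡ᵇ-cong-+ (suc c) x y = ≡ᵇ-cong-+ c x y

-- The only candidate for a nonzero term is the list of the blocks' own occurrence numbers, and it
-- is a composition of `R` exactly when these add up to `R`.
∑-comps : ∀ R k αs → length αs ≡ k → ∑ (comps R k) (δ has-c132 αs) ≡ ι (sumBy c132 αs ≡ᵇ R)
∑-comps zero zero [] _ = refl
∑-comps (suc R) zero [] _ = refl
∑-comps R (suc k) (α ∷ αs) e = ∑-concatMap (λ r₁ → map (r₁ ∷_) (comps (R ∸ r₁) k)) _ (upTo (suc R)) ⊙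
    ∑-cong (upTo (suc R)) (λ {i} _ → ∑-map (i ∷_) _ (comps (R ∸ i) k) ⊙ ∑-*ˡ (ι (c132 α ≡ᵇ i)) (δ has-c132 αs) (comps (R ∸ i) k) ⊙
      cong (ι (c132 α ≡ᵇ i) *ᶻ_) (∑-comps (R ∸ i) k αs (suc-injective e))) ⊙
    ∑-upTo-δ (c132 α) (suc R) (λ i → ι (S ≡ᵇ R ∸ i)) ⊙ bool-case (c132 α <ᵇ suc R) small large
  where
  S = sumBy c132 αs
  small : (c132 α <ᵇ suc R) ≡ true → (if c132 α <ᵇ suc R then ι (S ≡ᵇ R ∸ c132 α) else 0ℤ) ≡ ι (c132 α + S ≡ᵇ R)
  small t rewrite t = cong ι (sym (≡ᵇ-cong-+ (c132 α) S (R ∸ c132 α)) ⊙ cong (c132 α + S ≡ᵇ_) (m+[n∸m]≡n (≤-pred (<ᵇ-true⁻ {c132 α} {suc R} t))))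
  large : (c132 α <ᵇ suc R) ≡ false → (if c132 α <ᵇ suc R then ι (S ≡ᵇ R ∸ c132 α) else 0ℤ) ≡ ι (c132 α + S ≡ᵇ R)
  large t rewrite t = cong ι (sym (≡ᵇ-false (λ q → <⇒≱ (<ᵇ-false⁻ {c132 α} {suc R} t) (subst (c132 α ≤_) q (m≤m+n (c132 α) S)))))

-- Parities of lengths and inversions

odd-+ : ∀ m n → odd (m + n) ≡ odd m xor odd n
odd-+ zero n = refl
odd-+ (suc m) n rewrite odd-+ m n with odd m | odd n
... | true  | true  = refl
... | true  | false = refl
... | false | true  = refl
... | false | false = refl

odd-* : ∀ m n → odd (m * n) ≡ odd m ∧ odd n
odd-* zero n = refl
odd-* (suc m) n rewrite odd-+ n (m * n) | odd-* m n with odd m | odd n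
... | true  | true  = refl
... | true  | false = refl
... | false | true  = refl
... | false | false = refl

odd-count : ∀ (h : List ℕ → ℕ) αs → odd ∣ map (odd ∘ h) αs ∣ ≡ odd (sumBy h αs)
odd-count h [] = refl
odd-count h (α ∷ αs) rewrite odd-+ (h α) (sumBy h αs) | sym (odd-count h αs) with odd (h α)
... | true  = refl
... | false = refl

-- By `LL` every entry left of the corner is above it, so all `p` of them count as above-left, and
-- all `v` entries below it count as below-right. The result is the number of inversions that an
-- entry of the cell forms with the kernel.
lcell-Feas : ∀ {ρ v p} → IsPerm ρ → Feas ρ p v → p ≤ length ρ → v ≤ length ρ → lcell ρ (suc v , suc p) ≡ p + v
lcell-Feas {ρ} {v} {p} pρ F p≤ v≤ = count-map q suc (upTo (length ρ)) ⊙
    cong (countᵇ q′) (sym (map-pos (proj₁ pρ))) ⊙ count-map q′ (pos ρ) ρ ⊙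
    count-cong ρ (λ {x} m → letter x m) ⊙ count-∨ (λ x → pos ρ x <ᵇ p) (_<ᵇ v) ρ (λ m a b → <⇒≱ (<ᵇ-true⁻ b) (LL m (<ᵇ-true⁻ a))) ⊙
    cong₂ _+_ (count-pos< (proj₁ pρ) p≤) (count-<-perm pρ v≤)
  where
  open Feas F
  q : ℕ → Bool
  q k = ((suc v ≤ᵇ val ρ k) ∧ (k <ᵇ suc p)) ∨ ((val ρ k <ᵇ suc v) ∧ (suc p ≤ᵇ k))
  q′ : ℕ → Bool
  q′ = q ∘ suc
  letter : ∀ x → x ∈ ρ → q′ (pos ρ x) ≡ (pos ρ x <ᵇ p) ∨ (x <ᵇ v)
  letter x m rewrite at-pos m with pos ρ x <? p
  ... | yes h rewrite <ᵇ-true h | <ᵇ-true (s≤s (LL m h)) = refl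
  ... | no h rewrite <ᵇ-false (≮⇒≥ h) | <ᵇ-true (s≤s (≮⇒≥ h)) | ∧-zeroʳ (v <ᵇ suc x) = ∧-identityʳ (x <ᵇ v)

-- `lSum` over an arbitrary list of cells, for the induction along the chain.
cellSum : List ℕ → List Cell → List Bool → ℕ
cellSum ρ cs v = foldr _+_ 0 (zipWith (λ c b → if b then lcell ρ c else 0) cs v)

-- As `N` accumulates the lengths of earlier blocks, the products of each length with the current
-- `N` produce modulo 2 the terms of `pairSum`, together with one term for the initial `N`; the
-- latter vanishes at the start, where `N` is 0.
odd-crossSum : ∀ ρ N cs αs → (∀ {c} → c ∈ cs → lcell ρ c ≡ proj₂ c ∸ 1 + (proj₁ c ∸ 1)) → length αs ≡ length cs →
  odd (crossSum N cs αs) ≡ (odd N ∧ odd ∣ map (odd ∘ length) αs ∣) xor (odd (pairSum (map (odd ∘ length) αs)) xor odd (cellSum ρ cs (map (odd ∘ length) αs)))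
odd-crossSum ρ N [] [] h e = sym (cong (_xor false) (∧-zeroʳ (odd N)))
odd-crossSum ρ N (c@(m , l) ∷ cs) (α ∷ αs) h e =
    odd-+ (length α * (l ∸ 1 + N + (m ∸ 1))) (crossSum (N + length α) cs αs) ⊙
    cong₂ _xor_ (odd-* (length α) (l ∸ 1 + N + (m ∸ 1)) ⊙ cong (odd (length α) ∧_) (odd-+ (l ∸ 1 + N) (m ∸ 1) ⊙ cong (_xor odd (m ∸ 1)) (odd-+ (l ∸ 1) N)))
      (odd-crossSum ρ (N + length α) cs αs (h ∘ there) (suc-injective e) ⊙ cong (λ z → (z ∧ V) xor (P xor C)) (odd-+ N (length α))) ⊙
    BZ.solve 7 (λ k l n m v p c → (k BZ.:* ((l BZ.:+ n) BZ.:+ m)) BZ.:+ (((n BZ.:+ k) BZ.:* v) BZ.:+ (p BZ.:+ c)) BZ.:=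
        (n BZ.:* (k BZ.:+ v)) BZ.:+ (((k BZ.:* v) BZ.:+ p) BZ.:+ ((k BZ.:* (l BZ.:+ m)) BZ.:+ c))) refl k (odd (l ∸ 1)) (odd N) (odd (m ∸ 1)) V P C ⊙
    sym (cong₂ (λ y z → (odd N ∧ y) xor z) heads (cong₂ _xor_ pairs cells))
  where
  k = odd (length α)
  v = map (odd ∘ length) αs
  V = odd ∣ v ∣
  P = odd (pairSum v)
  C = odd (cellSum ρ cs v)
  heads : odd ∣ k ∷ v ∣ ≡ k xor V
  heads with k
  ... | true = refl
  ... | false = refl
  pairs : odd (pairSum (k ∷ v)) ≡ (k ∧ V) xor P
  pairs with k
  ... | true = odd-+ ∣ v ∣ (pairSum v)
  ... | false = refl
  cells : odd (cellSum ρ (c ∷ cs) (k ∷ v)) ≡ (k ∧ (odd (l ∸ 1) xor odd (m ∸ 1))) xor C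
  cells with k
  ... | true = odd-+ (lcell ρ c) (cellSum ρ cs v) ⊙ cong (_xor C) (cong odd (h (here refl)) ⊙ odd-+ (l ∸ 1) (m ∸ 1))
  ... | false = refl

-- `inX` is the parity of the glued length. `inY` is the inversion formula modulo 2, solved for the
-- inversions inside the blocks.
χ-glue : ∀ {ρ αs N} r a b → KP ρ → IsTuple (f ρ) N αs → cap ρ ≤ r →
  ι (sumBy c132 αs ≡ᵇ r ∸ cap ρ) *ᶻ (ι (inX ρ a (map (odd ∘ length) αs)) *ᶻ ι (inY ρ b (map (odd ∘ length) αs) (map (odd ∘ inv) αs))) ≡ χ r a b (glue ρ αs)
χ-glue {ρ} {αs} {N} r a b kp t cap≤ = cong₂ (λ x y → ι x *ᶻ y) occurrences (cong₂ (λ x y → ι x *ᶻ ι y) (cong (λ z → beq z a) sizes) signs)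
  where
  module A = Assembled (glue-Assembled {ρ} {αs} kp t)
  cs = feasibleCells ρ
  v = map (odd ∘ length) αs
  u = map (odd ∘ inv) αs
  occurrences : (sumBy c132 αs ≡ᵇ r ∸ cap ρ) ≡ (c132 (glue ρ αs) ≡ᵇ r)
  occurrences = sym (≡ᵇ-cong-+ (cap ρ) (sumBy c132 αs) (r ∸ cap ρ)) ⊙ cong₂ _≡ᵇ_ (sym A.c≡) (m+[n∸m]≡n cap≤)
  sizes : odd (∣ v ∣ + sz ρ) ≡ odd (length (glue ρ αs))
  sizes = odd-+ ∣ v ∣ (sz ρ) ⊙ cong (_xor odd (sz ρ)) (odd-count length αs) ⊙ sym (odd-+ (sumBy length αs) (sz ρ)) ⊙ cong odd (+-comm _ (sz ρ) ⊙ sym A.len)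
  weight : ∀ {c} → c ∈ cs → lcell ρ c ≡ proj₂ c ∸ 1 + (proj₁ c ∸ 1)
  weight {suc m , suc l} n with ∈-feasibleCells⁻ {ρ} n
  ... | (_ , m≤) , (_ , l≤) , _ = lcell-Feas (KP.perm kp) (KernelShape.cell-Feas kp n) (≤-pred l≤) (<⇒≤ m≤)
  weight {zero , _} n with ∈-feasibleCells⁻ {ρ} n
  ... | (() , _) , _
  weight {suc m , zero} n with ∈-feasibleCells⁻ {ρ} n
  ... | _ , (() , _) , _
  crossings : odd (crossSum 0 cs αs) ≡ odd (pairSum v) xor odd (lSum ρ v)
  crossings = odd-crossSum ρ 0 cs αs weight (IsTuple.count t)
  exponent : odd (bit b + zExp ρ v) ≡ b xor ((odd (pairSum v) xor odd (lSum ρ v)) xor odd (inv ρ))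
  exponent = odd-+ (bit b) (zExp ρ v) ⊙ cong₂ _xor_ (odd-bit b) (odd-+ (pairSum v + lSum ρ v) (inv ρ) ⊙ cong (_xor odd (inv ρ)) (odd-+ (pairSum v) (lSum ρ v)))
    where
    odd-bit : ∀ b → odd (bit b) ≡ b
    odd-bit true = refl
    odd-bit false = refl
  total : odd (inv (glue ρ αs)) ≡ (odd (inv ρ) xor odd ∣ u ∣) xor (odd (pairSum v) xor odd (lSum ρ v))
  total = cong odd A.inv≡ ⊙ odd-+ (inv ρ + sumBy inv αs) (crossSum 0 cs αs) ⊙ cong₂ _xor_ (odd-+ (inv ρ) (sumBy inv αs) ⊙ cong (odd (inv ρ) xor_) (sym (odd-count inv αs))) crossings
  signs : inY ρ b v u ≡ beq (odd (inv (glue ρ αs))) b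
  signs = cong not (cong (odd ∣ u ∣ xor_) exponent ⊙
    BZ.solve 4 (λ u b z i → u BZ.:+ (b BZ.:+ (z BZ.:+ i)) BZ.:= ((i BZ.:+ u) BZ.:+ z) BZ.:+ b) refl (odd ∣ u ∣) b (odd (pairSum v) xor odd (lSum ρ v)) (odd (inv ρ)) ⊙
    cong (_xor b) (sym total))

-- The condition on `u` depends on `v`, so the sum over `u` is collapsed first with `v` fixed, and
-- the sum over `v` afterwards.
L-∑ : ∀ ρ rs a b N → length rs ≡ f ρ → L ρ rs a b N ≡ ∑ (tuples (f ρ) N) (λ αs → δ has-c132 αs rs *ᶻ
  (ι (inX ρ a (map (odd ∘ length) αs)) *ᶻ ι (inY ρ b (map (odd ∘ length) αs) (map (odd ∘ inv) αs))))
L-∑ ρ rs a b N len = sumS-∑ (concatMap row (filterᵇ (inX ρ a) (bools k))) N ⊙ ∑-concatMap row (λ s → s N) (filterᵇ (inX ρ a) (bools k)) ⊙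
    ∑-filter (inX ρ a) _ (bools k) ⊙
    ∑-cong (bools k) (λ {v} mv → cong (ι (inX ρ a v) *ᶻ_) (inner v mv) ⊙ sym (∑-*ˡ (ι (inX ρ a v)) _ (tuples k N))) ⊙
    ∑-swap (λ v αs → ι (inX ρ a v) *ᶻ ((δ has-c132 αs rs *ᶻ Vδ αs v) *ᶻ ι (inY ρ b v (map (odd ∘ inv) αs)))) (bools k) (tuples k N) ⊙
    ∑-cong (tuples k N) (λ {αs} m → outer αs (IsTuple.count (∈-tuples⁻ k N m)))
  where
  k = f ρ
  row : List Bool → List Series
  row v = map (λ u → prodS (zipWith3 H rs v u)) (filterᵇ (inY ρ b v) (bools k))
  Vδ = λ αs v → δ (has-parity (odd ∘ length)) αs v
  Uδ = λ αs u → δ (has-parity (odd ∘ inv)) αs u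
  inner : ∀ v → v ∈ bools k → ∑ (row v) (λ s → s N) ≡
    ∑ (tuples k N) (λ αs → (δ has-c132 αs rs *ᶻ Vδ αs v) *ᶻ ι (inY ρ b v (map (odd ∘ inv) αs)))
  inner v mv = ∑-map (λ u → prodS (zipWith3 H rs v u)) (λ s → s N) (filterᵇ (inY ρ b v) (bools k)) ⊙ ∑-filter (inY ρ b v) _ (bools k) ⊙
    ∑-cong (bools k) (λ {u} mu → cong (ι (inY ρ b v u) *ᶻ_) (prodS-∑ k N rs v u len (bools-length k mv) (bools-length k mu)) ⊙ sym (∑-*ˡ (ι (inY ρ b v u)) _ (tuples k N))) ⊙
    ∑-swap (λ u αs → ι (inY ρ b v u) *ᶻ X αs rs v u) (bools k) (tuples k N) ⊙
    ∑-cong (tuples k N) (λ {αs} m → ∑-cong (bools k) (λ {u} _ →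
        ZS.solve 4 (λ y r v u → y ZS.:* (r ZS.:* (v ZS.:* u)) ZS.:= (r ZS.:* v) ZS.:* (y ZS.:* u)) refl (ι (inY ρ b v u)) (δ has-c132 αs rs) (Vδ αs v) (Uδ αs u)) ⊙
      ∑-*ˡ (δ has-c132 αs rs *ᶻ Vδ αs v) _ (bools k) ⊙
      cong ((δ has-c132 αs rs *ᶻ Vδ αs v) *ᶻ_) (∑-bools k (odd ∘ inv) αs (IsTuple.count (∈-tuples⁻ k N m)) (ι ∘ inY ρ b v)))
  outer : ∀ αs → length αs ≡ k → ∑ (bools k) (λ v → ι (inX ρ a v) *ᶻ ((δ has-c132 αs rs *ᶻ Vδ αs v) *ᶻ ι (inY ρ b v (map (odd ∘ inv) αs)))) ≡
    δ has-c132 αs rs *ᶻ (ι (inX ρ a (map (odd ∘ length) αs)) *ᶻ ι (inY ρ b (map (odd ∘ length) αs) (map (odd ∘ inv) αs)))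
  outer αs e = ∑-cong (bools k) (λ {v} _ → ZS.solve 4 (λ x r v y → x ZS.:* ((r ZS.:* v) ZS.:* y) ZS.:= r ZS.:* ((x ZS.:* y) ZS.:* v)) refl
        (ι (inX ρ a v)) (δ has-c132 αs rs) (Vδ αs v) (ι (inY ρ b v (map (odd ∘ inv) αs)))) ⊙
    ∑-*ˡ (δ has-c132 αs rs) _ (bools k) ⊙
    cong (δ has-c132 αs rs *ᶻ_) (∑-bools k (odd ∘ length) αs e (λ v → ι (inX ρ a v) *ᶻ ι (inY ρ b v (map (odd ∘ inv) αs))))

χ-zero : ∀ r a b π → (c132 π ≡ᵇ r) ≡ false → χ r a b π ≡ 0ℤ
χ-zero r a b π h rewrite h = refl

shape-term : ∀ {ρ} r a b n → KP ρ →
  (if cap ρ ≤ᵇ r then shift (sz ρ) (sumS (map (λ rs → L ρ rs a b) (comps (r ∸ cap ρ) (f ρ)))) else 0S) n ≡ ∑ (fillings n ρ) (χ r a b ∘ glue ρ)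
shape-term {ρ} r a b n kp = bool-case (cap ρ ≤ᵇ r) small large
  where
  k = f ρ
  R = r ∸ cap ρ
  N = n ∸ sz ρ
  S = sumS (map (λ rs → L ρ rs a b) (comps R k))
  -- Every glued word has at least the occurrences of `ρ`, so for capacity above `r` no filling
  -- contributes, in agreement with the empty sum.
  large : (cap ρ ≤ᵇ r) ≡ false → (if cap ρ ≤ᵇ r then shift (sz ρ) S else 0S) n ≡ ∑ (fillings n ρ) (χ r a b ∘ glue ρ)
  large h rewrite h = sym (∑-zero (fillings n ρ) (λ {αs} m → χ-zero r a b (glue ρ αs) (≡ᵇ-false (λ q →
     true≢false (≤ᵇ-true {cap ρ} (subst (cap ρ ≤_) (sym (Assembled.c≡ (glue-Assembled {ρ} {αs} kp (proj₂ (fillings-sound {n} {ρ} m)))) ⊙ q) (m≤m+n _ _))) h))))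
  body : cap ρ ≤ r → S N ≡ ∑ (tuples k N) (χ r a b ∘ glue ρ)
  body le = sumS-∑ (map (λ rs → L ρ rs a b) (comps R k)) N ⊙ ∑-map (λ rs → L ρ rs a b) (λ s → s N) (comps R k) ⊙
    ∑-cong (comps R k) (λ {rs} m → L-∑ ρ rs a b N (comps-length R k m)) ⊙
    ∑-swap (λ rs αs → δ has-c132 αs rs *ᶻ G αs) (comps R k) (tuples k N) ⊙
    ∑-cong (tuples k N) (λ {αs} m → let t = ∈-tuples⁻ k N m in
      sym (∑-*ʳ (δ has-c132 αs) (G αs) (comps R k)) ⊙ cong (_*ᶻ G αs) (∑-comps R k αs (IsTuple.count t)) ⊙ χ-glue {ρ} {αs} r a b kp t le)
    where
    G : List (List ℕ) → ℤ
    G αs = ι (inX ρ a (map (odd ∘ length) αs)) *ᶻ ι (inY ρ b (map (odd ∘ length) αs) (map (odd ∘ inv) αs))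
  small : (cap ρ ≤ᵇ r) ≡ true → (if cap ρ ≤ᵇ r then shift (sz ρ) S else 0S) n ≡ ∑ (fillings n ρ) (χ r a b ∘ glue ρ)
  small h rewrite h with n <ᵇ sz ρ
  ... | true = refl
  ... | false = body (≤ᵇ-true⁻ {cap ρ} {r} h)

theorem3 : (r : ℕ) → 1 ≤ r → (a b : Bool) → (n : ℕ) → H r a b n ≡ RHS r a b n
theorem3 r r≥1 a b n =
  H-∑ r a b n ⊙
  -- The lists of all permutations and of glued words are known to agree only where there are
  -- exactly `r` occurrences. The sum is restricted to these for the exchange and then extended
  -- again, as `χ` vanishes elsewhere.
  sym (∑-filter-support q (χ r a b) (perms n) (χ-zero r a b)) ⊙
  ∑-↭ (χ r a b) (glued-↭ t t>0 n r r≥1 (≤-reflexive (+-comm 1 (2 * r)))) ⊙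
  ∑-filter-support q (χ r a b) (glued t n) (χ-zero r a b) ⊙
  ∑-concatMap (λ ρ → map (glue ρ) (fillings n ρ)) (χ r a b) (K t) ⊙
  ∑-cong (K t) (λ {ρ} m → ∑-map (glue ρ) (χ r a b) (fillings n ρ) ⊙ sym (shape-term r a b n (K-sound t t>0 m))) ⊙
  sym (sumS-∑ (map term (K t)) n ⊙ ∑-map term (λ s → s n) (K t))
  where
  t = 2 * r + 1
  t>0 : 0 < t
  t>0 = subst (0 <_) (+-comm 1 (2 * r)) (s≤s z≤n)
  q = λ π → c132 π ≡ᵇ r
  term : List ℕ → Series
  term ρ = if cap ρ ≤ᵇ r then shift (sz ρ) (sumS (map (λ rs → L ρ rs a b) (comps (r ∸ cap ρ) (f ρ)))) else 0S
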